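{- Let $n$ be a positive odd integer and let $a,b$ be indeterminates. Then, modulo $\Phi_n(q)(1-aq^n)(a-q^n)$, \[ \sum_{k=0}^{(n-1)/2} [4k+1]\frac{(aq, q/a, bq;q^2)_k\, (q;q^2)_k^3} {(aq^2, q^2/a, q^2/b;q^2)_k\, (q^2;q^2)_k^3}\left(\frac{q}{b}\right)^k \equiv [n]\,q^{(1-n)/2} \sum_{k=0}^{(n-1)/2}\frac{(aq, q/a, q/b, q;q^2)_k} {(q^2/b;q^2)_k\, (q^2;q^2)_k^3}\,q^{2k}. \]
   Context: Here $q,a,b$ are indeterminates. For $x$ and a base $p$ (a power of $q$), $(x;p)_k=\prod_{j=0}^{k-1}(1-xp^j)$ and $(x_1,\dots,x_m;p)_k=(x_1;p)_k\cdots(x_m;p)_k$. The $q$-integer is $[m]=1+q+\cdots+q^{m-1}$ and $\Phi_n(q)$ is the $n$-th cyclotomic polynomial. For rational functions $A,B$ in $q,a,b$ and a polynomial $P$, $A\equiv B\pmod{P}$ means that the numerator of the reduced form of $A-B$ is divisible by $P$ in the polynomial ring over $\mathbb{Z}$ in these variables. -}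

module Defs where

open import Data.Nat as ℕ using (ℕ; zero; suc; _≡ᵇ_; _≤ᵇ_)
open import Data.Nat.Divisibility using (_∣?_)
open import Data.Integer as ℤ using (ℤ; 0ℤ; 1ℤ; -1ℤ)
open import Data.Bool using (Bool; true; false; if_then_else_; _∧_)
open import Data.List using (List; []; _∷_; [_]; _++_; map; concatMap; foldr; length; reverse; upTo; filter; drop)
open import Data.Product using (Σ; _×_; _,_)
open import Relation.Binary.PropositionalEquality using (_≡_)
open import Relation.Nullary using (¬_)

-- Polynomials in ℤ[q,a,b] (as formal sums of monomials),
-- with equality meaning equality of all coefficients.

record Mono : Set where
  constructor mono
  field
    coef : ℤ
    eq ea eb : ℕ  -- exponents of q, a, b

Poly : Set
Poly = List Mono

coeff : Poly → ℕ → ℕ → ℕ → ℤ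
coeff p i j k = foldr ℤ._+_ 0ℤ (map pick p)
  where
  pick : Mono → ℤ
  pick (mono c e1 e2 e3) = if (e1 ≡ᵇ i) ∧ (e2 ≡ᵇ j) ∧ (e3 ≡ᵇ k) then c else 0ℤ

infix 4 _≈ₚ_
_≈ₚ_ : Poly → Poly → Set
p ≈ₚ r = ∀ i j k → coeff p i j k ≡ coeff r i j k

infixl 6 _+ₚ_ _-ₚ_
infixl 7 _*ₚ_

_+ₚ_ : Poly → Poly → Poly
p +ₚ r = p ++ r

-ₚ_ : Poly → Poly
-ₚ p = map (λ { (mono c e1 e2 e3) → mono (ℤ.- c) e1 e2 e3 }) p

_-ₚ_ : Poly → Poly → Poly
p -ₚ r = p +ₚ (-ₚ r)

mulMono : Mono → Mono → Mono
mulMono (mono c e1 e2 e3) (mono d f1 f2 f3) = mono (c ℤ.* d) (e1 ℕ.+ f1) (e2 ℕ.+ f2) (e3 ℕ.+ f3)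

_*ₚ_ : Poly → Poly → Poly
p *ₚ r = concatMap (λ m → map (mulMono m) r) p

constₚ : ℤ → Poly
constₚ c = [ mono c 0 0 0 ]

0ₚ 1ₚ qₚ aₚ bₚ : Poly
0ₚ = []
1ₚ = constₚ 1ℤ
qₚ = [ mono 1ℤ 1 0 0 ]
aₚ = [ mono 1ℤ 0 1 0 ]
bₚ = [ mono 1ℤ 0 0 1 ]

_^ₚ_ : Poly → ℕ → Poly
p ^ₚ zero = 1ₚ
p ^ₚ suc k = p *ₚ (p ^ₚ k)

infix 4 _∣ₚ_
_∣ₚ_ : Poly → Poly → Set
g ∣ₚ p = Σ Poly λ c → g *ₚ c ≈ₚ p

Coprimeₚ : Poly → Poly → Set
Coprimeₚ p r = ∀ g → g ∣ₚ p → g ∣ₚ r → g ∣ₚ 1ₚ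

-- Univariate integer polynomials (coefficient lists, lowest degree
-- first), used to compute the cyclotomic polynomials Φ_n(q).

addU : List ℤ → List ℤ → List ℤ
addU [] ys = ys
addU xs [] = xs
addU (x ∷ xs) (y ∷ ys) = (x ℤ.+ y) ∷ addU xs ys

mulU : List ℤ → List ℤ → List ℤ
mulU [] ds = []
mulU (c ∷ cs) ds = addU (map (c ℤ.*_) ds) (0ℤ ∷ mulU cs ds)

subPref : List ℤ → List ℤ → List ℤ
subPref xs [] = xs
subPref [] (y ∷ ys) = (ℤ.- y) ∷ subPref [] ys
subPref (x ∷ xs) (y ∷ ys) = (x ℤ.- y) ∷ subPref xs ys

-- long division, highest degree first; divisor is 1 ∷ rd (monic)
divH : ℕ → List ℤ → List ℤ → List ℤ
divH zero _ _ = []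
divH (suc f) [] _ = []
divH (suc f) (c ∷ cs) rd with length rd ≤ᵇ length cs
... | true  = c ∷ divH f (subPref cs (map (c ℤ.*_) rd)) rd
... | false = []

-- quotient of p by the monic polynomial d (exact division intended)
divU : List ℤ → List ℤ → List ℤ
divU p d with reverse d
... | []      = []
... | _ ∷ rd  = reverse (divH (length p) (reverse p) rd)

xnm1 : ℕ → List ℤ
xnm1 zero = []
xnm1 (suc n) = -1ℤ ∷ go n
  where
  go : ℕ → List ℤ
  go zero = [ 1ℤ ]
  go (suc k) = 0ℤ ∷ go k

properDivisors : ℕ → List ℕ
properDivisors n = filter (λ d → d ∣? n) (drop 1 (upTo n))

-- cycF fuel n; q^n - 1 = ∏_{d ∣ n} Φ_d
cycF : ℕ → ℕ → List ℤ
cycF zero n = [ 1ℤ ]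
cycF (suc f) n = divU (xnm1 n) (foldr mulU [ 1ℤ ] (map (cycF f) (properDivisors n)))

cyclotomic : ℕ → List ℤ
cyclotomic n = cycF n n

fromU : List ℤ → Poly
fromU = go 0
  where
  go : ℕ → List ℤ → Poly
  go i [] = []
  go i (c ∷ cs) = mono c i 0 0 ∷ go (suc i) cs

Φ : ℕ → Poly
Φ n = fromU (cyclotomic n)

record Frac : Set where
  constructor _/_
  field
    num den : Poly
open Frac public

infixl 6 _+f_ _-f_
infixl 7 _*f_ _÷f_

_+f_ : Frac → Frac → Frac
(n1 / d1) +f (n2 / d2) = (n1 *ₚ d2 +ₚ n2 *ₚ d1) / (d1 *ₚ d2)

_-f_ : Frac → Frac → Frac
(n1 / d1) -f (n2 / d2) = (n1 *ₚ d2 -ₚ n2 *ₚ d1) / (d1 *ₚ d2)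

_*f_ : Frac → Frac → Frac
(n1 / d1) *f (n2 / d2) = (n1 *ₚ n2) / (d1 *ₚ d2)

invf : Frac → Frac
invf (n / d) = d / n

_÷f_ : Frac → Frac → Frac
x ÷f y = x *f invf y

poly : Poly → Frac
poly p = p / 1ₚ

1f qf af bf : Frac
1f = poly 1ₚ
qf = poly qₚ
af = poly aₚ
bf = poly bₚ

_^f_ : Frac → ℕ → Frac
x ^f zero = 1f
x ^f suc k = x *f (x ^f k)

sumTo : ℕ → (ℕ → Frac) → Frac
sumTo m f = foldr _+f_ (poly 0ₚ) (map f (upTo (suc m)))

poch : Frac → Frac → ℕ → Frac
poch x p zero = 1f
poch x p (suc k) = poch x p k *f (1f -f x *f (p ^f k))

qint : ℕ → Frac
qint zero = poly 0ₚ
qint (suc m) = qint m +f (qf ^f m)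

-- A ≡ B (mod P): the numerator of the reduced form of A - B is
-- divisible by P in ℤ[q,a,b].

_≡_mod_ : Frac → Frac → Poly → Set
A ≡ B mod P =
  let D = A -f B in
  ¬ (den D ≈ₚ 0ₚ) ×
  Σ Poly λ N → Σ Poly λ E →
    ¬ (E ≈ₚ 0ₚ) × (N *ₚ den D ≈ₚ num D *ₚ E) × Coprimeₚ N E × (P ∣ₚ N)

-- The two sides of Theorem 3.3 (n = 2m+1, so (n-1)/2 = m).

q2 : Frac
q2 = qf *f qf

lhsTerm : ℕ → Frac
lhsTerm k =
  qint (4 ℕ.* k ℕ.+ 1)
  *f ((poch (af *f qf) q2 k *f poch (qf ÷f af) q2 k *f poch (bf *f qf) q2 k
        *f (poch qf q2 k ^f 3))
      ÷f (poch (af *f q2) q2 k *f poch (q2 ÷f af) q2 k *f poch (q2 ÷f bf) q2 k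
        *f (poch q2 q2 k ^f 3)))
  *f ((qf ÷f bf) ^f k)

rhsTerm : ℕ → Frac
rhsTerm k =
  ((poch (af *f qf) q2 k *f poch (qf ÷f af) q2 k *f poch (qf ÷f bf) q2 k
     *f poch qf q2 k)
   ÷f (poch (q2 ÷f bf) q2 k *f (poch q2 q2 k ^f 3)))
  *f (qf ^f (2 ℕ.* k))

LHS : ℕ → Frac
LHS m = sumTo m lhsTerm

-- [n] q^{(1-n)/2} Σ ... with n = 2m+1, q^{(1-n)/2} = 1/q^m
RHS : ℕ → Frac
RHS m = qint (2 ℕ.* m ℕ.+ 1) *f (1f ÷f (qf ^f m)) *f sumTo m rhsTerm

modulus : ℕ → Poly
modulus n = Φ n *ₚ (1ₚ -ₚ aₚ *ₚ (qₚ ^ₚ n)) *ₚ (aₚ -ₚ (qₚ ^ₚ n))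

{-# OPTIONS --safe #-}
module Submission where

-- Put Q = q² and n = 2m+1. The q-Saalschütz sum expands the b-dependent part of the k-th term on the left as
-- Σ_j P_j(k) w_j with P_j(k) = (q^{-2k}, q^{1+2k}; Q)_j and w_j = (q/b; Q)_j Q^j / ((Q; Q)_j² (Q/b; Q)_j), so the left
-- side is Σ_j w_j S_j with inner sums S_j = Σ_k [4k+1] u_k P_j(k). For generic a, the difference
-- (1-q^{2j+2}) S_{j+1} - (1-aq^{1+2j})(1-q^{1+2j}/a)(1-q^{1+2j}) S_j telescopes in k, and its boundary term at k = m
-- contains (1-aq^n)(1-q^n/a)(1-q^n). Hence S_j satisfies a first-order recurrence as soon as a = q^n, a = q^{-n} or
-- q^n = 1, and it is determined by the single term S_m. This proves the identity in each of the three localised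
-- quotients of ℤ[q,a,b] by a - q^n, 1 - aq^n and Φ_n(q).
--
-- All denominators are non-zero-divisors modulo these three polynomials: by Gauss' lemma a primitive polynomial is
-- regular modulo a constant, and 1 - q^i with i < n is regular modulo Φ_n because, for a proper divisor d of n,
-- (q^n - 1)/(q^d - 1) is a multiple of Φ_n congruent to n/d modulo q^d - 1. The reduced form of the difference exists
-- because ℤ[q][a][b] is a GCD domain.

-- With `b` generic neither side has a closed form, so the two can only be compared after both are
-- expanded in the same functions of `b`. The weights w_j are chosen so that the right-hand side
-- already is such an expansion; what remains is an evaluation of each S_j, which is free of `b`.
-- Both telescoping arguments are of Zeilberger type: an explicit antidifference is given, and its
-- defining relation becomes a polynomial identity for the ring solver once inverses are
-- homogenised.
--
-- Nothing is known about the quotient modulo Φ_n being a domain. It is therefore localised at all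
-- its non-zero-divisors, and the burden is to show that every factor divided by is regular. As Φ_n
-- is defined by a list algorithm, the exactness of that long division must be proved too, by the
-- same induction on n that gives regularity.
--
-- The power q^((1-n)/2) arises from reversing Pochhammer symbols in the evaluation of S_m. The
-- q-integers enter through (1-q)[k] = 1-q^k, so 1-q has to be cancelled at the end; for n = 1 it
-- vanishes modulo Φ_1, and that case is computed directly.

open import Defs
open import Level using (0ℓ)
open import Algebra using (CommutativeRing; AbelianGroup)
open import Data.Nat as ℕ using (ℕ; zero; suc; s≤s; z≤n; _<_; _≤_)
import Data.Nat.Properties as ℕ
open import Data.Integer as ℤ using (ℤ; +_; -[1+_]; 0ℤ; 1ℤ; -1ℤ)
import Data.Integer.Properties as ℤ
open import Data.List using (List; []; _∷_; [_]; _++_; map; foldr; length)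
open import Data.Product using (Σ; _,_; _×_; proj₁; proj₂)
open import Data.Sum using (_⊎_; inj₁; inj₂; map₁)
open import Relation.Nullary using (¬_; Dec; yes; no; contradiction)
open import Relation.Binary.PropositionalEquality as ≡ using (_≡_)

-- Ring solver with integer coefficients over an arbitrary commutative ring.

module IntSolver (R : CommutativeRing 0ℓ 0ℓ) where
  open CommutativeRing R
  open import Data.Maybe using (Maybe; just; nothing)
  open import Algebra.Properties.Ring ring using (-0#≈0#; -‿distribˡ-*; -‿distribʳ-*; -‿involutive; -‿+-comm)
  open import Algebra.Properties.Semiring.Mult.TCOptimised semiring using (×-homo-+; ×1-homo-*; 1+×) renaming (_×_ to _×ᵣ_)
  open import Algebra.Solver.Ring.AlmostCommutativeRing
  open import Relation.Binary.Reasoning.Setoid setoid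

  ofℤ : ℤ → Carrier
  ofℤ (+ n) = n ×ᵣ 1#
  ofℤ -[1+ n ] = - (suc n ×ᵣ 1#)

  ofℤ-⊖ : ∀ m n → ofℤ (m ℤ.⊖ n) ≈ m ×ᵣ 1# - n ×ᵣ 1#
  ofℤ-⊖ m zero = sym (trans (+-congˡ -0#≈0#) (+-identityʳ _))
  ofℤ-⊖ zero (suc n) = sym (+-identityˡ _)
  ofℤ-⊖ (suc m) (suc n) = begin
    ofℤ (suc m ℤ.⊖ suc n) ≡⟨ ≡.cong ofℤ (ℤ.[1+m]⊖[1+n]≡m⊖n m n) ⟩
    ofℤ (m ℤ.⊖ n) ≈⟨ ofℤ-⊖ m n ⟩
    x - y ≈⟨ +-congʳ (+-identityˡ x) ⟨
    (0# + x) - y ≈⟨ +-congʳ (+-congʳ (-‿inverseʳ 1#)) ⟨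
    ((1# - 1#) + x) - y ≈⟨ +-congʳ (trans (+-assoc _ _ _) (trans (+-congˡ (+-comm _ _)) (sym (+-assoc _ _ _)))) ⟩
    ((1# + x) - 1#) - y ≈⟨ +-assoc _ _ _ ⟩
    (1# + x) + (- 1# - y) ≈⟨ +-congˡ (-‿+-comm 1# y) ⟩
    (1# + x) - (1# + y) ≈⟨ +-cong (1+× m 1#) (-‿cong (1+× n 1#)) ⟨
    suc m ×ᵣ 1# - suc n ×ᵣ 1# ∎
    where x = m ×ᵣ 1#
          y = n ×ᵣ 1#

  ofℤ-+ : ∀ i j → ofℤ (i ℤ.+ j) ≈ ofℤ i + ofℤ j
  ofℤ-+ (+ m) (+ n) = ×-homo-+ 1# m n
  ofℤ-+ (+ m) -[1+ n ] = ofℤ-⊖ m (suc n)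
  ofℤ-+ -[1+ m ] (+ n) = trans (ofℤ-⊖ n (suc m)) (+-comm _ _)
  ofℤ-+ -[1+ m ] -[1+ n ] = begin
    - (suc (suc (m ℕ.+ n)) ×ᵣ 1#) ≡⟨ ≡.cong (λ k → - (suc k ×ᵣ 1#)) (Data.Nat.Properties.+-suc m n) ⟨
    - ((suc m ℕ.+ suc n) ×ᵣ 1#) ≈⟨ -‿cong (×-homo-+ 1# (suc m) (suc n)) ⟩
    - (suc m ×ᵣ 1# + suc n ×ᵣ 1#) ≈⟨ -‿+-comm _ _ ⟨
    ofℤ -[1+ m ] + ofℤ -[1+ n ] ∎
    where import Data.Nat.Properties

  ofℤ-neg : ∀ i → ofℤ (ℤ.- i) ≈ - ofℤ i
  ofℤ-neg (+ zero) = sym -0#≈0#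
  ofℤ-neg (+ suc n) = refl
  ofℤ-neg -[1+ n ] = sym (-‿involutive _)

  ofℤ-* : ∀ i j → ofℤ (i ℤ.* j) ≈ ofℤ i * ofℤ j
  ofℤ-* (+ m) (+ n) = trans (reflexive (≡.cong ofℤ (≡.sym (ℤ.pos-* m n)))) (×1-homo-* m n)
  ofℤ-* (+ m) -[1+ n ] = begin
    ofℤ (+ m ℤ.* -[1+ n ]) ≡⟨ ≡.cong ofℤ (ℤ.neg-distribʳ-* (+ m) (+ suc n)) ⟨
    ofℤ (ℤ.- (+ m ℤ.* + suc n)) ≈⟨ ofℤ-neg (+ m ℤ.* + suc n) ⟩
    - ofℤ (+ m ℤ.* + suc n) ≈⟨ -‿cong (ofℤ-* (+ m) (+ suc n)) ⟩
    - (ofℤ (+ m) * ofℤ (+ suc n)) ≈⟨ -‿distribʳ-* _ _ ⟩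
    _ ∎
  ofℤ-* -[1+ m ] (+ n) = begin
    ofℤ (-[1+ m ] ℤ.* + n) ≡⟨ ≡.cong ofℤ (ℤ.neg-distribˡ-* (+ suc m) (+ n)) ⟨
    ofℤ (ℤ.- (+ suc m ℤ.* + n)) ≈⟨ ofℤ-neg (+ suc m ℤ.* + n) ⟩
    - ofℤ (+ suc m ℤ.* + n) ≈⟨ -‿cong (ofℤ-* (+ suc m) (+ n)) ⟩
    - (ofℤ (+ suc m) * ofℤ (+ n)) ≈⟨ -‿distribˡ-* _ _ ⟩
    _ ∎
  ofℤ-* -[1+ m ] -[1+ n ] = begin
    ofℤ (+ suc m ℤ.* + suc n) ≈⟨ ofℤ-* (+ suc m) (+ suc n) ⟩
    x * y ≈⟨ -‿involutive _ ⟨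
    - (- (x * y)) ≈⟨ -‿cong (-‿distribˡ-* x y) ⟩
    - (- x * y) ≈⟨ -‿distribʳ-* (- x) y ⟩
    - x * - y ∎
    where x = suc m ×ᵣ 1#
          y = suc n ×ᵣ 1#

  private
    homℤ : ℤ.+-*-rawRing -Raw-AlmostCommutative⟶ fromCommutativeRing R
    homℤ = record { ⟦_⟧ = ofℤ ; +-homo = ofℤ-+ ; *-homo = ofℤ-* ; -‿homo = ofℤ-neg ; 0-homo = refl ; 1-homo = refl }

    dec : ∀ i j → Maybe (ofℤ i ≈ ofℤ j)
    dec i j with i ℤ.≟ j
    ... | yes eq = just (reflexive (≡.cong ofℤ eq))
    ... | no _ = nothing

  open import Algebra.Solver.Ring ℤ.+-*-rawRing (fromCommutativeRing R) homℤ dec public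
    using (solve; _:=_; con; _:+_; _:*_; _:-_; :-_; Polynomial)

  :1 : ∀ {n} → Polynomial n
  :1 = con (+ 1)

-- Univariate polynomials as coefficient lists, lowest degree first.

module Polynomials (R : CommutativeRing 0ℓ 0ℓ) where
  open CommutativeRing R
  open import Algebra.Properties.Ring ring using (-0#≈0#)
  import Algebra.Properties.CommutativeSemigroup

  infix 8 _at_
  _at_ : List Carrier → ℕ → Carrier
  [] at i = 0#
  (c ∷ cs) at zero = c
  (c ∷ cs) at suc i = cs at i

  infix 4 _≋_
  -- Lists are not normalised, so equality must not see trailing zeros. The record keeps both lists
  -- recoverable by unification, which a bare function type would not.
  record _≋_ (p r : List Carrier) : Set where
    constructor mk≋
    field at≈ : ∀ i → p at i ≈ r at i
  open _≋_ public

  ≋-refl : ∀ {p} → p ≋ p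
  ≋-refl = mk≋ λ i → refl

  ≋-sym : ∀ {p r} → p ≋ r → r ≋ p
  ≋-sym e = mk≋ λ i → sym (at≈ e i)

  ≋-trans : ∀ {p r s} → p ≋ r → r ≋ s → p ≋ s
  ≋-trans e f = mk≋ λ i → trans (at≈ e i) (at≈ f i)

  ∷-cong : ∀ {c d p r} → c ≈ d → p ≋ r → c ∷ p ≋ d ∷ r
  ∷-cong c≈d e = mk≋ λ { zero → c≈d ; (suc i) → at≈ e i }

  ∷-zero : ∀ {c p} → c ≈ 0# → p ≋ [] → c ∷ p ≋ []
  ∷-zero c≈0 e = mk≋ λ { zero → c≈0 ; (suc i) → at≈ e i }

  ≋-head : ∀ {c d p r} → c ∷ p ≋ d ∷ r → c ≈ d
  ≋-head e = at≈ e 0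

  ≋-tail : ∀ {c d p r} → c ∷ p ≋ d ∷ r → p ≋ r
  ≋-tail e = mk≋ λ i → at≈ e (suc i)

  head≈0 : ∀ {c p} → c ∷ p ≋ [] → c ≈ 0#
  head≈0 e = at≈ e 0

  tail≋[] : ∀ {c p} → c ∷ p ≋ [] → p ≋ []
  tail≋[] e = mk≋ λ i → at≈ e (suc i)

  add : List Carrier → List Carrier → List Carrier
  add [] ys = ys
  add xs [] = xs
  add (x ∷ xs) (y ∷ ys) = (x + y) ∷ add xs ys

  scale : Carrier → List Carrier → List Carrier
  scale c = map (c *_)

  neg : List Carrier → List Carrier
  neg = map (λ c → - c)

  mul : List Carrier → List Carrier → List Carrier
  mul [] ds = []
  mul (c ∷ cs) ds = add (scale c ds) (0# ∷ mul cs ds)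

  add-at : ∀ p r i → add p r at i ≈ p at i + r at i
  add-at [] r i = sym (+-identityˡ _)
  add-at (x ∷ p) [] i = sym (+-identityʳ _)
  add-at (x ∷ p) (y ∷ r) zero = refl
  add-at (x ∷ p) (y ∷ r) (suc i) = add-at p r i

  scale-at : ∀ c p i → scale c p at i ≈ c * (p at i)
  scale-at c [] i = sym (zeroʳ c)
  scale-at c (x ∷ p) zero = refl
  scale-at c (x ∷ p) (suc i) = scale-at c p i

  neg-at : ∀ p i → neg p at i ≈ - (p at i)
  neg-at [] i = sym -0#≈0#
  neg-at (x ∷ p) zero = refl
  neg-at (x ∷ p) (suc i) = neg-at p i

  add-cong : ∀ {p p′ r r′} → p ≋ p′ → r ≋ r′ → add p r ≋ add p′ r′
  add-cong {p} {p′} {r} {r′} e f = mk≋ λ i →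
    trans (add-at p r i) (trans (+-cong (at≈ e i) (at≈ f i)) (sym (add-at p′ r′ i)))

  add-assoc : ∀ p r s → add (add p r) s ≋ add p (add r s)
  add-assoc p r s = mk≋ λ i →
    trans (add-at (add p r) s i) (trans (+-congʳ (add-at p r i)) (trans (+-assoc _ _ _)
      (sym (trans (add-at p (add r s) i) (+-congˡ (add-at r s i))))))

  add-comm : ∀ p r → add p r ≋ add r p
  add-comm p r = mk≋ λ i → trans (add-at p r i) (trans (+-comm _ _) (sym (add-at r p i)))

  add-[] : ∀ p → add p [] ≋ p
  add-[] [] = ≋-refl
  add-[] (x ∷ p) = ≋-refl

  neg-cong : ∀ {p r} → p ≋ r → neg p ≋ neg r
  neg-cong {p} {r} e = mk≋ λ i → trans (neg-at p i) (trans (-‿cong (at≈ e i)) (sym (neg-at r i)))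

  add-neg : ∀ p → add p (neg p) ≋ []
  add-neg p = mk≋ λ i → trans (add-at p (neg p) i) (trans (+-congˡ (neg-at p i)) (-‿inverseʳ _))

  polyAbelianGroup : AbelianGroup 0ℓ 0ℓ
  polyAbelianGroup = record
    { Carrier = List Carrier ; _≈_ = _≋_ ; _∙_ = add ; ε = [] ; _⁻¹ = neg
    ; isAbelianGroup = record
      { isGroup = record
        { isMonoid = record
          { isSemigroup = record
            { isMagma = record
              { isEquivalence = record { refl = ≋-refl ; sym = ≋-sym ; trans = ≋-trans }
              ; ∙-cong = add-cong }
            ; assoc = add-assoc }
          ; identity = (λ p → ≋-refl) , add-[] }
        ; inverse = (λ p → ≋-trans (add-comm (neg p) p) (add-neg p)) , add-neg
        ; ⁻¹-cong = neg-cong }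
      ; comm = add-comm } }

  private
    module Add = AbelianGroup polyAbelianGroup
    module AddSG = Algebra.Properties.CommutativeSemigroup Add.commutativeSemigroup
  open import Relation.Binary.Reasoning.Setoid Add.setoid

  addʳ : ∀ p {r s} → r ≋ s → add p r ≋ add p s
  addʳ p = add-cong (≋-refl {p})

  scale-cong : ∀ {c d p r} → c ≈ d → p ≋ r → scale c p ≋ scale d r
  scale-cong {c} {d} {p} {r} c≈d e = mk≋ λ i →
    trans (scale-at c p i) (trans (*-cong c≈d (at≈ e i)) (sym (scale-at d r i)))

  scale-add : ∀ c p r → scale c (add p r) ≋ add (scale c p) (scale c r)
  scale-add c p r = mk≋ λ i →
    trans (scale-at c (add p r) i) (trans (*-congˡ (add-at p r i)) (trans (distribˡ _ _ _)
      (sym (trans (add-at (scale c p) (scale c r) i) (+-cong (scale-at c p i) (scale-at c r i))))))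

  scale-+ : ∀ c d p → scale (c + d) p ≋ add (scale c p) (scale d p)
  scale-+ c d p = mk≋ λ i →
    trans (scale-at (c + d) p i) (trans (distribʳ _ _ _)
      (sym (trans (add-at (scale c p) (scale d p) i) (+-cong (scale-at c p i) (scale-at d p i)))))

  scale-* : ∀ c d p → scale (c * d) p ≋ scale c (scale d p)
  scale-* c d p = mk≋ λ i →
    trans (scale-at (c * d) p i) (trans (*-assoc _ _ _)
      (sym (trans (scale-at c (scale d p) i) (*-congˡ (scale-at d p i)))))

  scale-1 : ∀ p → scale 1# p ≋ p
  scale-1 p = mk≋ λ i → trans (scale-at 1# p i) (*-identityˡ _)

  scale-0 : ∀ p → scale 0# p ≋ []
  scale-0 p = mk≋ λ i → trans (scale-at 0# p i) (zeroˡ _)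

  scale-∷0 : ∀ c p → scale c (0# ∷ p) ≋ 0# ∷ scale c p
  scale-∷0 c p = ∷-cong (zeroʳ c) ≋-refl

  add-∷0 : ∀ p r → add (0# ∷ p) (0# ∷ r) ≋ 0# ∷ add p r
  add-∷0 p r = ∷-cong (+-identityˡ 0#) ≋-refl

  mul-zeroʳ : ∀ p → mul p [] ≋ []
  mul-zeroʳ [] = ≋-refl
  mul-zeroʳ (c ∷ p) = ∷-zero {0#} refl (mul-zeroʳ p)

  mul-congˡ : ∀ p {r s} → r ≋ s → mul p r ≋ mul p s
  mul-congˡ [] e = ≋-refl
  mul-congˡ (c ∷ p) e = add-cong (scale-cong {c} refl e) (∷-cong {0#} refl (mul-congˡ p e))

  mul-[] : ∀ {p} r → p ≋ [] → mul p r ≋ []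
  mul-[] {[]} r e = ≋-refl
  mul-[] {c ∷ p} r e =
    add-cong (≋-trans (scale-cong (head≈0 e) (≋-refl {r})) (scale-0 r)) (∷-zero {0#} refl (mul-[] {p} r (tail≋[] e)))

  mul-congʳ : ∀ {p s} r → p ≋ s → mul p r ≋ mul s r
  mul-congʳ {[]} {s} r e = ≋-sym (mul-[] {s} r (≋-sym e))
  mul-congʳ {c ∷ p} {[]} r e = mul-[] r e
  mul-congʳ {c ∷ p} {d ∷ s} r e =
    add-cong (scale-cong (≋-head e) (≋-refl {r})) (∷-cong {0#} refl (mul-congʳ {p} {s} r (≋-tail e)))

  mul-cong : ∀ {p p′ r r′} → p ≋ p′ → r ≋ r′ → mul p r ≋ mul p′ r′
  mul-cong {p} {p′} {r} {r′} e f = ≋-trans (mul-congʳ r e) (mul-congˡ p′ f)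

  mul-distribʳ : ∀ r p s → mul (add p s) r ≋ add (mul p r) (mul s r)
  mul-distribʳ r [] s = ≋-refl
  mul-distribʳ r (c ∷ p) [] = ≋-sym (add-[] (mul (c ∷ p) r))
  mul-distribʳ r (c ∷ p) (d ∷ s) = begin
    add (scale (c + d) r) (0# ∷ mul (add p s) r) ≈⟨ add-cong (scale-+ c d r) (∷-cong {0#} refl (mul-distribʳ r p s)) ⟩
    add (add (scale c r) (scale d r)) (0# ∷ add (mul p r) (mul s r)) ≈⟨ addʳ (add (scale c r) (scale d r)) (add-∷0 (mul p r) (mul s r)) ⟨
    add (add (scale c r) (scale d r)) (add (0# ∷ mul p r) (0# ∷ mul s r)) ≈⟨ AddSG.interchange (scale c r) (scale d r) (0# ∷ mul p r) (0# ∷ mul s r) ⟩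
    _ ∎

  -- Multiplication recurses on its left argument; this is the mirror-image recursion on the right
  -- one, from which commutativity follows by induction.
  mul-∷ : ∀ p d r → mul p (d ∷ r) ≋ add (scale d p) (0# ∷ mul p r)
  mul-∷ [] d r = ≋-sym (∷-zero {0#} refl ≋-refl)
  mul-∷ (c ∷ p) d r = ∷-cong {c * d + 0#} {d * c + 0#} (+-congʳ (*-comm c d))
    (≋-trans (addʳ (scale c r) (mul-∷ p d r)) (AddSG.x∙yz≈y∙xz (scale c r) (scale d p) (0# ∷ mul p r)))

  mul-comm : ∀ p r → mul p r ≋ mul r p
  mul-comm [] r = ≋-sym (mul-zeroʳ r)
  mul-comm (c ∷ p) r = ≋-trans (addʳ (scale c r) (∷-cong {0#} refl (mul-comm p r))) (≋-sym (mul-∷ r c p))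

  mul-scaleˡ : ∀ c p r → mul (scale c p) r ≋ scale c (mul p r)
  mul-scaleˡ c [] r = ≋-refl
  mul-scaleˡ c (d ∷ p) r = begin
    add (scale (c * d) r) (0# ∷ mul (scale c p) r) ≈⟨ add-cong (scale-* c d r) (∷-cong {0#} refl (mul-scaleˡ c p r)) ⟩
    add (scale c (scale d r)) (0# ∷ scale c (mul p r)) ≈⟨ addʳ (scale c (scale d r)) (scale-∷0 c (mul p r)) ⟨
    add (scale c (scale d r)) (scale c (0# ∷ mul p r)) ≈⟨ scale-add c (scale d r) (0# ∷ mul p r) ⟨
    _ ∎

  mul-∷0 : ∀ p r → mul (0# ∷ p) r ≋ 0# ∷ mul p r
  mul-∷0 p r = add-cong (scale-0 r) (≋-refl {0# ∷ mul p r})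

  mul-assoc : ∀ p r s → mul (mul p r) s ≋ mul p (mul r s)
  mul-assoc [] r s = ≋-refl
  mul-assoc (c ∷ p) r s = begin
    mul (add (scale c r) (0# ∷ mul p r)) s ≈⟨ mul-distribʳ s (scale c r) (0# ∷ mul p r) ⟩
    add (mul (scale c r) s) (mul (0# ∷ mul p r) s) ≈⟨ add-cong (mul-scaleˡ c r s) (mul-∷0 (mul p r) s) ⟩
    add (scale c (mul r s)) (0# ∷ mul (mul p r) s) ≈⟨ addʳ (scale c (mul r s)) (∷-cong {0#} refl (mul-assoc p r s)) ⟩
    _ ∎

  const : Carrier → List Carrier
  const c = [ c ]

  mul-const : ∀ c p → mul (const c) p ≋ scale c p
  mul-const c p = ≋-trans (addʳ (scale c p) (∷-zero {0#} refl ≋-refl)) (add-[] (scale c p))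

  mul-identityˡ : ∀ p → mul [ 1# ] p ≋ p
  mul-identityˡ p = ≋-trans (mul-const 1# p) (scale-1 p)

  polyRing : CommutativeRing 0ℓ 0ℓ
  polyRing = record
    { Carrier = List Carrier ; _≈_ = _≋_ ; _+_ = add ; _*_ = mul ; -_ = neg ; 0# = [] ; 1# = [ 1# ]
    ; isCommutativeRing = record
      { isRing = record
        { +-isAbelianGroup = Add.isAbelianGroup
        ; *-cong = mul-cong
        ; *-assoc = mul-assoc
        ; *-identity = mul-identityˡ , λ p → ≋-trans (mul-comm p [ 1# ]) (mul-identityˡ p)
        ; distrib = (λ r p s → ≋-trans (mul-comm r (add p s)) (≋-trans (mul-distribʳ r p s) (add-cong (mul-comm p r) (mul-comm s r)))) , mul-distribʳ }
      ; *-comm = mul-comm } }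

-- Divisibility and regularity modulo an element.

module Divisibility (R : CommutativeRing 0ℓ 0ℓ) where
  open CommutativeRing R
  open IntSolver R
  open import Algebra.Properties.Ring ring using (-‿distribʳ-*)

  infix 4 _∣_
  record _∣_ (x y : Carrier) : Set where
    constructor divides
    field
      quotient : Carrier
      equality : x * quotient ≈ y
  open _∣_ public

  ∣-refl : ∀ {x} → x ∣ x
  ∣-refl = divides 1# (*-identityʳ _)

  ∣-reflexive : ∀ {x y} → x ≈ y → x ∣ y
  ∣-reflexive e = divides 1# (trans (*-identityʳ _) e)

  ∣-trans : ∀ {x y z} → x ∣ y → y ∣ z → x ∣ z
  ∣-trans (divides c e) (divides d f) = divides (c * d) (trans (sym (*-assoc _ _ _)) (trans (*-congʳ e) f))

  ∣-resp : ∀ {x y z} → y ≈ z → x ∣ y → x ∣ z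
  ∣-resp e (divides c f) = divides c (trans f e)

  ∣0 : ∀ {x} → x ∣ 0#
  ∣0 = divides 0# (zeroʳ _)

  1∣ : ∀ {x} → 1# ∣ x
  1∣ {x} = divides x (*-identityˡ x)

  ∣-+ : ∀ {d x y} → d ∣ x → d ∣ y → d ∣ x + y
  ∣-+ (divides a e) (divides b f) = divides (a + b) (trans (distribˡ _ _ _) (+-cong e f))

  ∣-neg : ∀ {d x} → d ∣ x → d ∣ - x
  ∣-neg (divides a e) = divides (- a) (trans (sym (-‿distribʳ-* _ _)) (-‿cong e))

  x∣xy : ∀ x y → x ∣ x * y
  x∣xy x y = divides y refl

  y∣xy : ∀ x y → y ∣ x * y
  y∣xy x y = divides x (*-comm y x)

  ∣-*ˡ : ∀ z {x y} → x ∣ y → x ∣ z * y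
  ∣-*ˡ z {x} {y} d = ∣-trans d (y∣xy z y)

  ∣-*ʳ : ∀ z {x y} → x ∣ y → x ∣ y * z
  ∣-*ʳ z {x} {y} d = ∣-trans d (x∣xy y z)

  *-mono-∣ : ∀ {x y z w} → x ∣ y → z ∣ w → x * z ∣ y * w
  *-mono-∣ {x} {y} {z} {w} (divides a e) (divides b f) = divides (a * b)
    (trans (solve 4 (λ x z a b → (x :* z) :* (a :* b) := (x :* a) :* (z :* b)) refl x z a b) (*-cong e f))

  ∣-cancel-+ : ∀ {d x y} → d ∣ x + y → d ∣ x → d ∣ y
  ∣-cancel-+ {d} {x} {y} p r = ∣-resp (solve 2 (λ x y → (x :+ y) :+ (:- x) := y) refl x y) (∣-+ p (∣-neg r))

  -- That is, `h` is a non-zero-divisor in the quotient by `g`, phrased through divisibility so that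
  -- no quotient ring has to be formed yet.
  RegularMod : Carrier → Carrier → Set
  RegularMod h g = ∀ {y} → g ∣ h * y → g ∣ y

  regularMod-resp : ∀ {h k g} → h ≈ k → RegularMod k g → RegularMod h g
  regularMod-resp e r d = r (∣-resp (*-congʳ e) d)

  regularMod-neg : ∀ {h k g} → k ≈ - h → RegularMod h g → RegularMod k g
  regularMod-neg {h} {k} e r {y} d = r (∣-resp (trans (-‿cong (*-congʳ e)) (solve 2 (λ h y → :- ((:- h) :* y) := h :* y) refl h y)) (∣-neg d))

-- GCD domains.

module GCDDomain where
  -- Greatest common divisors without a Bézout identity: this structure passes from a ring to its
  -- polynomial ring, whereas ℤ[q] already fails to be a Bézout domain. Decidable equality with zero
  -- drives the case distinctions of the Euclidean algorithm.
  record IsGCDDomain (R : CommutativeRing 0ℓ 0ℓ) : Set where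
    open CommutativeRing R
    open Divisibility R
    field
      ≈0? : ∀ x → Dec (x ≈ 0#)
      1≉0 : ¬ 1# ≈ 0#
      integral : ∀ x y → x * y ≈ 0# → x ≈ 0# ⊎ y ≈ 0#
      gcd : Carrier → Carrier → Carrier
      gcd∣ˡ : ∀ x y → gcd x y ∣ x
      gcd∣ʳ : ∀ x y → gcd x y ∣ y
      gcd-greatest : ∀ {d x y} → d ∣ x → d ∣ y → d ∣ gcd x y

  module GCDProperties (R : CommutativeRing 0ℓ 0ℓ) (D : IsGCDDomain R) where
    open CommutativeRing R
    open Divisibility R
    open IntSolver R
    open IsGCDDomain D

    *-cancel : ∀ {x y z} → ¬ x ≈ 0# → x * y ≈ x * z → y ≈ z
    *-cancel {x} {y} {z} x≉0 e with integral x (y - z) lem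
      where
      lem : x * (y - z) ≈ 0#
      lem = trans (solve 3 (λ x y z → x :* (y :- z) := x :* y :- x :* z) refl x y z) (trans (+-congʳ e) (-‿inverseʳ _))
    ... | inj₁ x≈0 = contradiction x≈0 x≉0
    ... | inj₂ y-z≈0 = trans (solve 2 (λ y z → y := (y :- z) :+ z) refl y z) (trans (+-congʳ y-z≈0) (+-identityˡ z))

    *-cancel-∣ : ∀ {x y z} → ¬ x ≈ 0# → x * y ∣ x * z → y ∣ z
    *-cancel-∣ x≉0 (divides c e) = divides c (*-cancel x≉0 (trans (sym (*-assoc _ _ _)) e))

    -- For nonzero `e`, the gcd of `e * x` and `e * y` is a multiple `e * t`; cancelling `e` shows
    -- that `t` divides both `x` and `y`, hence their gcd.
    gcd-scale : ∀ {d x y} e → d ∣ e * x → d ∣ e * y → d ∣ e * gcd x y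
    gcd-scale {d} {x} {y} e d∣ex d∣ey with ≈0? e
    ... | yes e≈0 = ∣-resp (sym (trans (*-congʳ e≈0) (zeroˡ _))) ∣0
    ... | no e≉0 = ∣-trans (gcd-greatest d∣ex d∣ey) (∣-trans (∣-reflexive (sym et≈g)) (*-mono-∣ (∣-refl {e}) t∣gcd))
      where
      g = gcd (e * x) (e * y)
      e∣g : e ∣ g
      e∣g = gcd-greatest (x∣xy e x) (x∣xy e y)
      t = quotient e∣g
      et≈g : e * t ≈ g
      et≈g = equality e∣g
      t∣gcd : t ∣ gcd x y
      t∣gcd = gcd-greatest (*-cancel-∣ e≉0 (∣-trans (∣-reflexive et≈g) (gcd∣ˡ _ _)))
                           (*-cancel-∣ e≉0 (∣-trans (∣-reflexive et≈g) (gcd∣ʳ _ _)))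

    -- Euclid's lemma from `gcd-scale`: `x` divides `z * x` and `z * y`, hence `z * gcd x y`, and
    -- the gcd divides 1.
    coprime-∣ : ∀ {x y z} → (∀ {c} → c ∣ x → c ∣ y → c ∣ 1#) → x ∣ y * z → x ∣ z
    coprime-∣ {x} {y} {z} coprime x∣yz = ∣-resp (*-identityʳ z) (∣-trans
      (gcd-scale z (y∣xy z x) (∣-resp (*-comm y z) x∣yz))
      (*-mono-∣ (∣-refl {z}) (coprime (gcd∣ˡ x y) (gcd∣ʳ x y))))

    -- From `h * c ≈ g * y` regularity gives `c ≈ g * w`, and cancelling `g` leaves `h * w ≈ y`. In
    -- a domain regularity is thus a symmetric relation between nonzero elements, so only the easier
    -- direction has to be proved each time.
    regularMod-sym : ∀ {g h} → ¬ g ≈ 0# → RegularMod h g → RegularMod g h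
    regularMod-sym {g} {h} g≉0 r {y} (divides c e) with r (divides y (sym e))
    ... | divides w gw≈c = divides w (*-cancel g≉0 (trans
      (solve 3 (λ g h w → g :* (h :* w) := h :* (g :* w)) refl g h w) (trans (*-congˡ gw≈c) e)))

open GCDDomain

-- Gauss' lemma and gcds in a polynomial ring over a GCD domain.

module PolyGCD (R : CommutativeRing 0ℓ 0ℓ) (D : IsGCDDomain R) where
  open CommutativeRing R
  open Divisibility R
  open Polynomials R
  open IntSolver R
  open IsGCDDomain D
  open GCDProperties R D
  open import Data.List.Properties using (length-map)
  private
    module P = CommutativeRing polyRing
    module PD = Divisibility polyRing
    module PS = IntSolver polyRing

  mul-head : ∀ p r → mul p r at 0 ≈ p at 0 * r at 0
  mul-head [] r = sym (zeroˡ _)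
  mul-head (c ∷ p) r = trans (add-at (scale c r) (0# ∷ mul p r) 0) (trans (+-identityʳ _) (scale-at c r 0))

  ≋[]? : ∀ p → Dec (p ≋ [])
  ≋[]? [] = yes ≋-refl
  ≋[]? (c ∷ p) with ≈0? c | ≋[]? p
  ... | no c≉0 | _ = no λ e → c≉0 (head≈0 e)
  ... | yes _ | no p≉ = no λ e → p≉ (tail≋[] e)
  ... | yes c≈0 | yes p≈ = yes (∷-zero c≈0 p≈)

  mul-∷0ʳ : ∀ p r → mul p (0# ∷ r) ≋ 0# ∷ mul p r
  mul-∷0ʳ p r = ≋-trans (mul-comm p (0# ∷ r)) (≋-trans (mul-∷0 r p) (∷-cong refl (mul-comm r p)))

  -- The lowest coefficients decide: the constant term of the product kills that of `r`, and then
  -- the variable can be divided out. Leading coefficients are not accessible in lists with trailing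
  -- zeros.
  cancel-head≉0 : ∀ p r → ¬ p at 0 ≈ 0# → mul p r ≋ [] → r ≋ []
  cancel-head≉0 p [] _ _ = ≋-refl
  cancel-head≉0 p (d ∷ r) p₀≉0 e with integral _ _ (trans (sym (mul-head p (d ∷ r))) (at≈ e 0))
  ... | inj₁ p₀≈0 = contradiction p₀≈0 p₀≉0
  ... | inj₂ d≈0 = ∷-zero d≈0 (cancel-head≉0 p r p₀≉0 (tail≋[] {0#}
          (≋-trans (≋-sym (≋-trans (mul-congˡ p (∷-cong d≈0 (≋-refl {r}))) (mul-∷0ʳ p r))) e)))

  poly-integral : ∀ p r → mul p r ≋ [] → p ≋ [] ⊎ r ≋ []
  poly-integral [] r e = inj₁ ≋-refl
  poly-integral (c ∷ p) r e with ≈0? c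
  ... | no c≉0 = inj₂ (cancel-head≉0 (c ∷ p) r c≉0 e)
  ... | yes c≈0 = map₁ (∷-zero c≈0) (poly-integral p r (tail≋[] {0#}
          (≋-trans (≋-sym (≋-trans (mul-congʳ r (∷-cong c≈0 (≋-refl {p}))) (mul-∷0 p r))) e)))

  infix 4 _∣ₗ_
  _∣ₗ_ : Carrier → List Carrier → Set
  c ∣ₗ p = ∀ i → c ∣ p at i

  ∣ₗ-resp : ∀ {c p r} → p ≋ r → c ∣ₗ p → c ∣ₗ r
  ∣ₗ-resp e d i = ∣-resp (at≈ e i) (d i)

  ∣ₗ-scale : ∀ {c d} p → c ∣ d → c ∣ₗ scale d p
  ∣ₗ-scale {c} {d} p c∣d i = ∣-resp (sym (scale-at d p i)) (∣-*ʳ (p at i) c∣d)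

  ∣ₗ-mul : ∀ {c} p r → c ∣ₗ p → c ∣ₗ mul p r
  ∣ₗ-mul [] r d i = ∣0
  ∣ₗ-mul {c} (x ∷ p) r d = λ i → ∣-resp (sym (add-at (scale x r) (0# ∷ mul p r) i)) (∣-+ (∣ₗ-scale r (d 0) i) (shifted i))
    where
    shifted : c ∣ₗ 0# ∷ mul p r
    shifted zero = ∣0
    shifted (suc i) = ∣ₗ-mul p r (λ j → d (suc j)) i

  divideBy : ∀ c p → c ∣ₗ p → Σ (List Carrier) λ r → scale c r ≋ p × length r ≡ length p
  divideBy c [] d = [] , ≋-refl , ≡.refl
  divideBy c (x ∷ p) d with divideBy c p (λ i → d (suc i))
  ... | r , e , l = quotient (d 0) ∷ r , ∷-cong (equality (d 0)) e , ≡.cong suc l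

  -- The last condition is the universal property of the gcd of all coefficients in a form
  -- stable under scaling.
  content : ∀ p → Σ Carrier λ c → c ∣ₗ p × (∀ e d → (∀ i → d ∣ e * (p at i)) → d ∣ e * c)
  content [] = 0# , (λ i → ∣0) , λ e d f → f 0
  content (x ∷ p) with content p
  ... | c , c∣p , greatest = gcd x c ,
        (λ { zero → gcd∣ˡ x c ; (suc i) → ∣-trans (gcd∣ʳ x c) (c∣p i) }) ,
        λ e d f → gcd-scale e (f 0) (greatest e d (λ i → f (suc i)))

  -- In a GCD domain this says that the common divisors of the coefficients are units. The factor
  -- `e` builds scaling into the definition, so contents of multiples can be compared without
  -- dividing.
  Primitive : List Carrier → Set
  Primitive p = ∀ e d → (∀ i → d ∣ e * (p at i)) → d ∣ e

  unit-coefficient⇒primitive : ∀ p i → p at i ≈ 1# → Primitive p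
  unit-coefficient⇒primitive p i u e d f = ∣-resp (trans (*-congˡ u) (*-identityʳ e)) (f i)

  primitive⇒∣1 : ∀ {c p} → Primitive p → c ∣ₗ p → c ∣ 1#
  primitive⇒∣1 prim d = prim 1# _ λ i → ∣-resp (sym (*-identityˡ _)) (d i)

  primitive⇒≉[] : ∀ {p} → Primitive p → ¬ p ≋ []
  primitive⇒≉[] {p} prim e with primitive⇒∣1 {0#} {p} prim (λ i → ∣-reflexive (sym (at≈ e i)))
  ... | divides c f = 1≉0 (trans (sym f) (zeroˡ c))

  record PrimitivePart (p : List Carrier) : Set where
    field
      cont : Carrier
      part : List Carrier
      factored : scale cont part ≋ p
      cont≉0 : ¬ cont ≈ 0#
      part-primitive : Primitive part
      lengths : length part ≡ length p

  primitivePart : ∀ p → ¬ p ≋ [] → PrimitivePart p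
  primitivePart p p≉[] with content p
  ... | c , c∣p , greatest with divideBy c p c∣p
  ... | r , e , l = record { cont = c ; part = r ; factored = e ; cont≉0 = c≉0 ; part-primitive = prim ; lengths = l }
    where
    c≉0 : ¬ c ≈ 0#
    c≉0 c≈0 = p≉[] (≋-trans (≋-sym e) (≋-trans (scale-cong c≈0 (≋-refl {r})) (scale-0 r)))
    prim : Primitive r
    prim f d h = *-cancel-∣ c≉0 (∣-resp (*-comm f c) (greatest f (c * d) λ i →
      ∣-resp (trans (solve 3 (λ c f x → c :* (f :* x) := f :* (c :* x)) refl c f (r at i))
                    (*-congˡ (trans (sym (scale-at c r i)) (at≈ e i))))
             (*-mono-∣ (∣-refl {c}) (h i))))

  scale-cancel : ∀ {c p r} → ¬ c ≈ 0# → scale c p ≋ scale c r → p ≋ r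
  scale-cancel {c} {p} {r} c≉0 e = mk≋ λ i →
    *-cancel c≉0 (trans (sym (scale-at c p i)) (trans (at≈ e i) (scale-at c r i)))

  mul-scaleʳ : ∀ c p r → mul p (scale c r) ≋ scale c (mul p r)
  mul-scaleʳ c p r = ≋-trans (mul-comm p (scale c r)) (≋-trans (mul-scaleˡ c r p) (scale-cong refl (mul-comm r p)))

  private
    -- Since `c` divides `z`, it divides the product of the tail `h` with `y`. After the content of
    -- `h` is split off, the remaining product is primitive by induction, so `c` divides that
    -- content; being a divisor of all of `z ∷ h`, it is a unit.
    head-step : ∀ {c h y} z →
      (∀ h′ → length h′ ≡ length h → Primitive h′ → Primitive (mul h′ y)) → Primitive (z ∷ h) →
      c ∣ₗ mul (z ∷ h) y → c ∣ z → c ∣ 1#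
    head-step {c} {h} {y} z ih prim c∣zhy c∣z with ≋[]? h
    ... | yes h≋[] = primitive⇒∣1 {p = z ∷ h} prim λ { zero → c∣z ; (suc i) → ∣-resp (sym (at≈ h≋[] i)) ∣0 }
    ... | no h≉[] = primitive⇒∣1 {p = z ∷ h} prim λ { zero → c∣z ; (suc i) → ∣-resp (at≈ factored i) (∣ₗ-scale part c∣cont i) }
      where
      open PrimitivePart (primitivePart h h≉[])
      c∣hy : c ∣ₗ mul h y
      c∣hy i = ∣-cancel-+ (∣-resp (add-at (scale z y) (0# ∷ mul h y) (suc i)) (c∣zhy (suc i))) (∣ₗ-scale y c∣z (suc i))
      c∣cont : c ∣ cont
      c∣cont = ih part lengths part-primitive cont c λ i → ∣-resp
        (trans (at≈ (≋-trans (mul-congʳ y (≋-sym factored)) (mul-scaleˡ cont part y)) i) (scale-at cont (mul part y) i)) (c∣hy i)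

    -- Gauss' lemma in the absence of prime factorisations. The content `c` of the product divides
    -- `h₀ * y₀`. Any common divisor of `c` and `h₀` is a unit by `head-step`, so `c` divides `y₀`,
    -- and then `head-step` for the other factor makes `c` itself a unit. The induction is on the
    -- total length, as `head-step` replaces one factor by the primitive part of its tail.
    gauss′ : ∀ n h y → length h ℕ.+ length y ℕ.≤ n → Primitive h → Primitive y → Primitive (mul h y)
    gauss′ n [] y _ ph py = contradiction ≋-refl (primitive⇒≉[] ph)
    gauss′ n h@(_ ∷ _) [] _ ph py = contradiction ≋-refl (primitive⇒≉[] py)
    gauss′ (suc n) (h₀ ∷ h) (y₀ ∷ y) (s≤s le) ph py e d f with content (mul (h₀ ∷ h) (y₀ ∷ y))
    ... | c , c∣hy , greatest = ∣-resp (*-identityʳ e) (∣-trans (greatest e d f) (*-mono-∣ (∣-refl {e}) c∣1))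
      where
      unit-h : ∀ {k} → k ∣ c → k ∣ h₀ → k ∣ 1#
      unit-h k∣c = head-step h₀
        (λ h′ l p → gauss′ n h′ (y₀ ∷ y) (≡.subst (λ m → m ℕ.+ suc (length y) ℕ.≤ n) (≡.sym l) le) p py)
        ph (λ i → ∣-trans k∣c (c∣hy i))
      unit-y : ∀ {k} → k ∣ c → k ∣ y₀ → k ∣ 1#
      unit-y k∣c = head-step y₀
        (λ y′ l p → gauss-resp (mul-comm (h₀ ∷ h) y′)
          (gauss′ n (h₀ ∷ h) y′ (≡.subst₂ ℕ._≤_ (≡.trans (ℕ.+-suc (length h) (length y)) (≡.cong (λ m → suc (length h ℕ.+ m)) (≡.sym l))) ≡.refl le) ph p))
        py (λ i → ∣-trans k∣c (∣ₗ-resp (mul-comm (h₀ ∷ h) (y₀ ∷ y)) c∣hy i))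
        where
        gauss-resp : ∀ {p r} → p ≋ r → Primitive p → Primitive r
        gauss-resp e p f d g = p f d λ i → ∣-resp (*-congˡ (sym (at≈ e i))) (g i)
      c∣1 : c ∣ 1#
      c∣1 = unit-y ∣-refl (coprime-∣ unit-h (∣-resp (mul-head (h₀ ∷ h) (y₀ ∷ y)) (c∣hy 0)))

  gauss : ∀ {h y} → Primitive h → Primitive y → Primitive (mul h y)
  gauss {h} {y} = gauss′ _ h y ℕ.≤-refl

  -- Write `y` as content times primitive part: the product of `h` with that part is primitive, so
  -- `c` must divide the content.
  primitive-∣ₗ : ∀ {c h} y → Primitive h → c ∣ₗ mul h y → c ∣ₗ y
  primitive-∣ₗ {c} {h} y ph c∣hy with ≋[]? y
  ... | yes y≋[] = λ i → ∣-resp (sym (at≈ y≋[] i)) ∣0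
  ... | no y≉[] = ∣ₗ-resp factored (∣ₗ-scale part (gauss {h} {part} ph part-primitive cont c λ i → ∣-resp
          (trans (at≈ (≋-trans (mul-congˡ h (≋-sym factored)) (mul-scaleʳ cont h part)) i) (scale-at cont (mul h part) i)) (c∣hy i)))
    where open PrimitivePart (primitivePart y y≉[])

  ∣ₗ⇒∣ : ∀ {c p} → c ∣ₗ p → const c PD.∣ p
  ∣ₗ⇒∣ {c} {p} d with divideBy c p d
  ... | r , e , _ = PD.divides r (≋-trans (mul-const c r) e)

  ∣⇒∣ₗ : ∀ {c p} → const c PD.∣ p → c ∣ₗ p
  ∣⇒∣ₗ {c} (PD.divides r e) i = divides (r at i) (trans (sym (scale-at c r i)) (at≈ (≋-trans (≋-sym (mul-const c r)) e) i))

  primitive⇒regular : ∀ {h} c → Primitive h → PD.RegularMod h (const c)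
  primitive⇒regular {h} c ph {y} d = ∣ₗ⇒∣ (primitive-∣ₗ {h = h} y ph (∣⇒∣ₗ d))

  const-regular : ∀ {h g} → RegularMod h g → PD.RegularMod (const h) (const g)
  const-regular {h} {g} r {y} d = ∣ₗ⇒∣ λ i →
    r (∣-resp (trans (at≈ (mul-const h y) i) (scale-at h y i)) (∣⇒∣ₗ d i))

  -- The cofactor of `d` in `scale e f` is divisible by `e` because `d` is primitive. This is what
  -- allows elimination to multiply by constants freely.
  primitive-∣-scale : ∀ {d e} f → Primitive d → ¬ e ≈ 0# → d PD.∣ scale e f → d PD.∣ f
  primitive-∣-scale {d} {e} f pd e≉0 (PD.divides y eq) with divideBy e y e∣y
    where
    e∣y : e ∣ₗ y
    e∣y = primitive-∣ₗ {h = d} y pd (∣ₗ-resp (≋-sym eq) (∣ₗ-scale f ∣-refl))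
  ... | y′ , eq′ , _ = PD.divides y′ (scale-cancel {e} e≉0
          (≋-trans (≋-sym (mul-scaleʳ e d y′)) (≋-trans (mul-congˡ d eq′) eq)))

  -- The gcd over the field of fractions, normalised to be primitive; constant factors are accounted
  -- for separately by the gcd of the contents.
  record PrimitiveGCD (f g : List Carrier) : Set where
    field
      pgcd : List Carrier
      prim-pgcd : Primitive pgcd
      ∣ˡ : pgcd PD.∣ f
      ∣ʳ : pgcd PD.∣ g
      greatest : ∀ {c} → Primitive c → c PD.∣ f → c PD.∣ g → c PD.∣ pgcd
  open PrimitiveGCD

  private
    swapPG : ∀ {f g} → PrimitiveGCD f g → PrimitiveGCD g f
    swapPG G = record { pgcd = pgcd G ; prim-pgcd = prim-pgcd G ; ∣ˡ = ∣ʳ G ; ∣ʳ = ∣ˡ G ; greatest = λ p a b → greatest G p b a }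

    ∣-∷ : ∀ {d z f} → z ≈ 0# → d PD.∣ f → d PD.∣ z ∷ f
    ∣-∷ {d} {z} {f} z≈0 (PD.divides e eq) = PD.divides (0# ∷ e) (≋-trans (mul-∷0ʳ d e) (∷-cong (sym z≈0) eq))

    -- A polynomial with nonzero constant term has no factor in common with the variable.
    ∣-∷⁻ : ∀ {c z f} → ¬ c at 0 ≈ 0# → z ≈ 0# → c PD.∣ z ∷ f → c PD.∣ f
    ∣-∷⁻ {c} {z} {f} c₀≉0 z≈0 (PD.divides [] eq) = PD.divides [] (≋-trans (mul-zeroʳ c)
      (≋-sym (tail≋[] (≋-trans (≋-sym eq) (mul-zeroʳ c)))))
    ∣-∷⁻ {c} {z} {f} c₀≉0 z≈0 (PD.divides (e₀ ∷ e) eq) with integral _ _ (trans (sym (mul-head c (e₀ ∷ e))) (trans (at≈ eq 0) z≈0))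
    ... | inj₁ c₀≈0 = contradiction c₀≈0 c₀≉0
    ... | inj₂ e₀≈0 = PD.divides e (≋-tail {0#} {z} (≋-trans (≋-sym
            (≋-trans (mul-congˡ c (∷-cong e₀≈0 (≋-refl {e}))) (mul-∷0ʳ c e))) eq))

    head≉0-∣ : ∀ {c g} → ¬ g at 0 ≈ 0# → c PD.∣ g → ¬ c at 0 ≈ 0#
    head≉0-∣ {c} g₀≉0 (PD.divides e eq) c₀≈0 = g₀≉0 (trans (sym (at≈ eq 0)) (trans (mul-head c e) (trans (*-congʳ c₀≈0) (zeroˡ _))))

    stripʳ : ∀ {g z f} → ¬ g at 0 ≈ 0# → z ≈ 0# → PrimitiveGCD g f → PrimitiveGCD g (z ∷ f)
    stripʳ g₀≉0 z≈0 G = record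
      { pgcd = pgcd G ; prim-pgcd = prim-pgcd G ; ∣ˡ = ∣ˡ G ; ∣ʳ = ∣-∷ z≈0 (∣ʳ G)
      ; greatest = λ p c∣g c∣f → greatest G p c∣g (∣-∷⁻ (head≉0-∣ g₀≉0 c∣g) z≈0 c∣f) }

    primitive-tail : ∀ {z p} → z ≈ 0# → Primitive (z ∷ p) → Primitive p
    primitive-tail z≈0 pr e d f = pr e d λ { zero → ∣-resp (sym (trans (*-congˡ z≈0) (zeroʳ e))) ∣0 ; (suc i) → f i }

    stripBoth : ∀ {z f w g} → z ≈ 0# → w ≈ 0# → PrimitiveGCD f g → PrimitiveGCD (z ∷ f) (w ∷ g)
    stripBoth {z} {f} {w} {g} z≈0 w≈0 G = record
      { pgcd = 0# ∷ pgcd G ; prim-pgcd = λ e d h → prim-pgcd G e d (λ i → h (suc i))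
      ; ∣ˡ = shift z≈0 (∣ˡ G) ; ∣ʳ = shift w≈0 (∣ʳ G) ; greatest = λ {c} → great c }
      where
      shift : ∀ {v d h} → v ≈ 0# → d PD.∣ h → 0# ∷ d PD.∣ v ∷ h
      shift {v} {d} v≈0 (PD.divides e eq) = PD.divides e (≋-trans (mul-∷0 d e) (∷-cong (sym v≈0) eq))
      unshift : ∀ {u v d h} → u ≈ 0# → u ∷ d PD.∣ v ∷ h → d PD.∣ h
      unshift {u} {v} {d} u≈0 (PD.divides e eq) = PD.divides e (≋-tail {0#} {v}
        (≋-trans (≋-sym (≋-trans (mul-congʳ e (∷-cong u≈0 (≋-refl {d}))) (mul-∷0 d e))) eq))
      great : ∀ c → Primitive c → c PD.∣ z ∷ f → c PD.∣ w ∷ g → c PD.∣ 0# ∷ pgcd G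
      great [] p a b = contradiction ≋-refl (primitive⇒≉[] p)
      great (c₀ ∷ c) p a b with ≈0? c₀
      ... | yes c₀≈0 = PD.∣-trans (PD.∣-reflexive (∷-cong c₀≈0 (≋-refl {c})))
             (shift refl (greatest G (primitive-tail c₀≈0 p) (unshift c₀≈0 a) (unshift c₀≈0 b)))
      ... | no c₀≉0 = ∣-∷ refl (greatest G p (∣-∷⁻ c₀≉0 z≈0 a) (∣-∷⁻ c₀≉0 w≈0 b))

    -- Eliminating the lowest instead of the highest coefficient needs no normalisation of trailing zeros.
    reduceTail : Carrier → List Carrier → Carrier → List Carrier → List Carrier
    reduceTail g₀ g f₀ f = add (scale g₀ f) (neg (scale f₀ g))

    -- `g₀` times the second polynomial minus `f₀` times the first has constant term zero, and
    -- `reduceTail` is what remains after dividing by the variable. Going back costs the factor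
    -- `g₀`, which `primitive-∣-scale` removes.
    reduce : ∀ {g₀ g f₀ f} → ¬ g₀ ≈ 0# → PrimitiveGCD (g₀ ∷ g) (reduceTail g₀ g f₀ f) → PrimitiveGCD (g₀ ∷ g) (f₀ ∷ f)
    reduce {g₀} {g} {f₀} {f} g₀≉0 G = record
      { pgcd = pgcd G ; prim-pgcd = prim-pgcd G ; ∣ˡ = ∣ˡ G
      ; ∣ʳ = primitive-∣-scale (f₀ ∷ f) (prim-pgcd G) g₀≉0 (PD.∣-resp back
               (PD.∣-+ (∣-∷ z≈0 (∣ʳ G)) (PD.∣-trans (∣ˡ G) (∣-scale f₀))))
      ; greatest = λ p c∣g c∣f → greatest G p c∣g (∣-∷⁻ (head≉0-∣ g₀≉0 c∣g) z≈0
          (PD.∣-+ (PD.∣-trans c∣f (∣-scale g₀)) (PD.∣-neg (PD.∣-trans c∣g (∣-scale f₀))))) }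
      where
      z = g₀ * f₀ + - (f₀ * g₀)
      z≈0 : z ≈ 0#
      z≈0 = trans (+-congˡ (-‿cong (*-comm f₀ g₀))) (-‿inverseʳ _)
      ∣-scale : ∀ k {p} → p PD.∣ scale k p
      ∣-scale k {p} = PD.divides (const k) (≋-trans (mul-comm p (const k)) (mul-const k p))
      back : add (z ∷ reduceTail g₀ g f₀ f) (scale f₀ (g₀ ∷ g)) ≋ scale g₀ (f₀ ∷ f)
      back = PS.solve 2 (λ x y → (x PS.:+ (PS.:- y)) PS.:+ y PS.:= x) ≋-refl (scale g₀ (f₀ ∷ f)) (scale f₀ (g₀ ∷ g))

    length-add : ∀ {n} p r → length p ℕ.≤ n → length r ℕ.≤ n → length (add p r) ℕ.≤ n
    length-add [] r a b = b
    length-add (x ∷ p) [] a b = a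
    length-add (x ∷ p) (y ∷ r) (s≤s a) (s≤s b) = s≤s (length-add p r a b)

    length-reduceTail : ∀ g₀ g f₀ f → length g ℕ.≤ length f → length (reduceTail g₀ g f₀ f) ℕ.≤ length f
    length-reduceTail g₀ g f₀ f le = length-add (scale g₀ f) (neg (scale f₀ g))
      (ℕ.≤-reflexive (length-map _ f)) (ℕ.≤-trans (ℕ.≤-reflexive (≡.trans (length-map _ (scale f₀ g)) (length-map _ g))) le)

    primitiveGCD′ : ∀ n f g → length f ℕ.+ length g ℕ.≤ n → ¬ f ≋ [] → PrimitiveGCD f g
    primitiveGCD′ n f g le f≉[] with ≋[]? g
    ... | yes g≋[] = record
      { pgcd = part ; prim-pgcd = part-primitive
      ; ∣ˡ = PD.divides (const cont) (≋-trans (mul-comm part (const cont)) (≋-trans (mul-const cont part) factored))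
      ; ∣ʳ = PD.∣-resp (≋-sym g≋[]) PD.∣0
      ; greatest = λ p c∣f _ → primitive-∣-scale part p cont≉0 (PD.∣-resp (≋-sym factored) c∣f) }
      where open PrimitivePart (primitivePart f f≉[])
    primitiveGCD′ n [] g le f≉[] | no _ = contradiction ≋-refl f≉[]
    primitiveGCD′ n (_ ∷ _) [] le f≉[] | no g≉[] = contradiction ≋-refl g≉[]
    primitiveGCD′ (suc n) (f₀ ∷ f) (g₀ ∷ g) (s≤s le) f≉[] | no g≉[] with ≈0? f₀ | ≈0? g₀
    ... | yes f₀≈0 | yes g₀≈0 = stripBoth f₀≈0 g₀≈0 (primitiveGCD′ n f g
            (ℕ.≤-trans (ℕ.+-monoʳ-≤ (length f) (ℕ.n≤1+n _)) le) (λ e → f≉[] (∷-zero f₀≈0 e)))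
    ... | yes f₀≈0 | no g₀≉0 = swapPG (stripʳ g₀≉0 f₀≈0 (primitiveGCD′ n (g₀ ∷ g) f
            (≡.subst (ℕ._≤ n) (ℕ.+-comm (length f) _) le) g≉[]))
    ... | no f₀≉0 | yes g₀≈0 = stripʳ f₀≉0 g₀≈0 (primitiveGCD′ n (f₀ ∷ f) g
            (≡.subst (ℕ._≤ n) (ℕ.+-suc (length f) _) le) f≉[])
    -- The longer list is the one reduced, so that its replacement is no longer than its tail and
    -- the total length drops.
    ... | no f₀≉0 | no g₀≉0 with ℕ.≤-total (length g) (length f)
    ... | inj₁ g≤f = swapPG (reduce g₀≉0 (primitiveGCD′ n (g₀ ∷ g) (reduceTail g₀ g f₀ f)
            (≡.subst (ℕ._≤ n) (≡.sym (ℕ.+-comm (suc (length g)) _))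
              (ℕ.≤-trans (ℕ.+-monoˡ-≤ _ (length-reduceTail g₀ g f₀ f g≤f)) le)) g≉[]))
    ... | inj₂ f≤g = reduce f₀≉0 (primitiveGCD′ n (f₀ ∷ f) (reduceTail f₀ f g₀ g)
            (ℕ.≤-trans (s≤s (ℕ.+-monoʳ-≤ (length f) (length-reduceTail f₀ f g₀ g f≤g)))
              (≡.subst (ℕ._≤ n) (ℕ.+-suc (length f) _) le)) f≉[])

  primitiveGCD : ∀ f g → ¬ f ≋ [] → PrimitiveGCD f g
  primitiveGCD f g = primitiveGCD′ _ f g ℕ.≤-refl

  private
    record PolyGCD (f g : List Carrier) : Set where
      field
        d : List Carrier
        d∣f : d PD.∣ f
        d∣g : d PD.∣ g
        d-greatest : ∀ {c} → c PD.∣ f → c PD.∣ g → c PD.∣ d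

    -- The gcd of the contents times the primitive gcd. A common divisor is split in the same way
    -- and its two parts are compared separately.
    polyGCD : ∀ f g → PolyGCD f g
    polyGCD f g with ≋[]? f | ≋[]? g
    ... | yes f≋[] | _ = record { d = g ; d∣f = PD.∣-resp (≋-sym f≋[]) PD.∣0 ; d∣g = PD.∣-refl ; d-greatest = λ _ b → b }
    ... | no _ | yes g≋[] = record { d = f ; d∣f = PD.∣-refl ; d∣g = PD.∣-resp (≋-sym g≋[]) PD.∣0 ; d-greatest = λ a _ → a }
    ... | no f≉[] | no g≉[] = record
      { d = scale k (pgcd G)
      ; d∣f = divides-part F (gcd∣ˡ _ _) (∣ˡ G) ; d∣g = divides-part H (gcd∣ʳ _ _) (∣ʳ G)
      ; d-greatest = λ {c} → great c }
      where
      module F′ = PrimitivePart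
      F = primitivePart f f≉[]
      H = primitivePart g g≉[]
      G = primitiveGCD f g f≉[]
      k = gcd (F′.cont F) (F′.cont H)
      scale-∣ : ∀ {a b p r} → a ∣ b → p PD.∣ r → scale a p PD.∣ scale b r
      scale-∣ {a} {b} {p} {r} (divides c e) (PD.divides s e′) = PD.divides (scale c s)
        (≋-trans (mul-scaleˡ a p (scale c s)) (≋-trans (scale-cong {a} refl (mul-scaleʳ c p s))
          (≋-trans (≋-sym (scale-* a c (mul p s))) (scale-cong e e′))))
      divides-part : ∀ {h} (P : PrimitivePart h) → k ∣ F′.cont P → pgcd G PD.∣ h → scale k (pgcd G) PD.∣ h
      divides-part P k∣ d∣h = PD.∣-resp (F′.factored P) (scale-∣ k∣
        (primitive-∣-scale (F′.part P) (prim-pgcd G) (F′.cont≉0 P) (PD.∣-resp (≋-sym (F′.factored P)) d∣h)))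
      great : ∀ c → c PD.∣ f → c PD.∣ g → c PD.∣ scale k (pgcd G)
      great c c∣f c∣g = PD.∣-trans (PD.∣-reflexive (≋-sym (F′.factored C)))
        (scale-∣ (gcd-greatest (cont∣ F c∣f) (cont∣ H c∣g)) (greatest G (F′.part-primitive C) (PD.∣-trans part∣c c∣f) (PD.∣-trans part∣c c∣g)))
        where
        c≉[] : ¬ c ≋ []
        c≉[] c≋[] with PD.∣-trans (PD.∣-reflexive (≋-sym c≋[])) c∣f
        ... | PD.divides e eq = f≉[] (≋-sym eq)
        C = primitivePart c c≉[]
        part∣c : F′.part C PD.∣ c
        part∣c = PD.divides (const (F′.cont C)) (≋-trans (mul-comm (F′.part C) (const _))
          (≋-trans (mul-const _ (F′.part C)) (F′.factored C)))
        -- The content of `c` divides every coefficient of `h`, which is a constant times a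
        -- primitive polynomial, and primitivity transfers the divisibility to the constant.
        cont∣ : ∀ {h} (P : PrimitivePart h) → c PD.∣ h → F′.cont C ∣ F′.cont P
        cont∣ {h} P (PD.divides s eq) = F′.part-primitive P _ _ λ i → ∣-resp (scale-at (F′.cont P) (F′.part P) i)
          (∣ₗ-resp (≋-sym (F′.factored P)) (∣ₗ-resp eq (∣ₗ-mul c s (∣ₗ-resp (F′.factored C) (∣ₗ-scale (F′.part C) ∣-refl)))) i)

  polyIsGCDDomain : IsGCDDomain polyRing
  polyIsGCDDomain = record
    { ≈0? = ≋[]? ; 1≉0 = λ e → 1≉0 (head≈0 e) ; integral = poly-integral
    ; gcd = λ f g → PolyGCD.d (polyGCD f g)
    ; gcd∣ˡ = λ f g → PolyGCD.d∣f (polyGCD f g)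
    ; gcd∣ʳ = λ f g → PolyGCD.d∣g (polyGCD f g)
    ; gcd-greatest = λ {_} {f} {g} → PolyGCD.d-greatest (polyGCD f g) }

-- Powers and evaluation of formal polynomials in a ring.

module Eval where
  module Power (R : CommutativeRing 0ℓ 0ℓ) where
    open CommutativeRing R
    open IntSolver R

    infixr 8 _^_
    _^_ : Carrier → ℕ → Carrier
    x ^ zero = 1#
    x ^ suc k = x * x ^ k

    ^-+ : ∀ x m n → x ^ (m ℕ.+ n) ≈ x ^ m * x ^ n
    ^-+ x zero n = sym (*-identityˡ _)
    ^-+ x (suc m) n = trans (*-congˡ (^-+ x m n)) (sym (*-assoc _ _ _))

    ^-cong : ∀ {x y} n → x ≈ y → x ^ n ≈ y ^ n
    ^-cong zero e = refl
    ^-cong (suc n) e = *-cong e (^-cong n e)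

    ^-*-distrib : ∀ x y n → (x * y) ^ n ≈ x ^ n * y ^ n
    ^-*-distrib x y zero = sym (*-identityˡ _)
    ^-*-distrib x y (suc n) = trans (*-congˡ (^-*-distrib x y n))
      (solve 4 (λ x y u v → (x :* y) :* (u :* v) := (x :* u) :* (y :* v)) refl x y (x ^ n) (y ^ n))

    ^-* : ∀ x m n → x ^ (m ℕ.* n) ≈ (x ^ n) ^ m
    ^-* x zero n = refl
    ^-* x (suc m) n = trans (^-+ x n (m ℕ.* n)) (*-congˡ (^-* x m n))

    1^ : ∀ n → 1# ^ n ≈ 1#
    1^ zero = refl
    1^ (suc n) = trans (*-identityˡ _) (1^ n)

  record ℤHom (R : CommutativeRing 0ℓ 0ℓ) : Set where
    open CommutativeRing R
    field
      ι : ℤ → Carrier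
      ι-* : ∀ c d → ι (c ℤ.* d) ≈ ι c * ι d
      ι-neg : ∀ c → ι (ℤ.- c) ≈ - ι c
      ι-1 : ι 1ℤ ≈ 1#

  module Evaluation (R : CommutativeRing 0ℓ 0ℓ) (hom : ℤHom R) (q a b : CommutativeRing.Carrier R) where
    open CommutativeRing R
    open ℤHom hom
    open Power R
    open IntSolver R
    open import Algebra.Properties.Ring ring using (-0#≈0#; -‿distribˡ-*; -‿+-comm)

    mon : Mono → Carrier
    mon (mono c i j k) = ι c * (q ^ i * (a ^ j * b ^ k))

    eval : Poly → Carrier
    eval [] = 0#
    eval (m ∷ p) = mon m + eval p

    eval-+ : ∀ p r → eval (p +ₚ r) ≈ eval p + eval r
    eval-+ [] r = sym (+-identityˡ _)
    eval-+ (m ∷ p) r = trans (+-congˡ (eval-+ p r)) (sym (+-assoc _ _ _))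

    eval-neg : ∀ p → eval (-ₚ p) ≈ - eval p
    eval-neg [] = sym -0#≈0#
    eval-neg (mono c i j k ∷ p) =
      trans (+-cong (trans (*-congʳ (ι-neg c)) (sym (-‿distribˡ-* _ _))) (eval-neg p)) (-‿+-comm _ _)

    eval-minus : ∀ p r → eval (p -ₚ r) ≈ eval p - eval r
    eval-minus p r = trans (eval-+ p (-ₚ r)) (+-congˡ (eval-neg r))

    mon-* : ∀ m n → mon (mulMono m n) ≈ mon m * mon n
    mon-* (mono c i j k) (mono d i′ j′ k′) =
      trans (*-cong (ι-* c d) (*-cong (^-+ q i i′) (*-cong (^-+ a j j′) (^-+ b k k′))))
        (solve 8 (λ c d x x′ y y′ z z′ → (c :* d) :* ((x :* x′) :* ((y :* y′) :* (z :* z′)))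
            := (c :* (x :* (y :* z))) :* (d :* (x′ :* (y′ :* z′)))) refl _ _ _ _ _ _ _ _)

    eval-mulMono : ∀ m r → eval (map (mulMono m) r) ≈ mon m * eval r
    eval-mulMono m [] = sym (zeroʳ _)
    eval-mulMono m (n ∷ r) = trans (+-cong (mon-* m n) (eval-mulMono m r)) (sym (distribˡ _ _ _))

    eval-* : ∀ p r → eval (p *ₚ r) ≈ eval p * eval r
    eval-* [] r = sym (zeroˡ _)
    eval-* (m ∷ p) r = trans (eval-+ (map (mulMono m) r) (p *ₚ r))
      (trans (+-cong (eval-mulMono m r) (eval-* p r)) (sym (distribʳ _ _ _)))

    eval-const : ∀ c → eval (constₚ c) ≈ ι c
    eval-const c = solve 1 (λ c → c :* (:1 :* (:1 :* :1)) :+ con 0ℤ := c) refl (ι c)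

    eval-1 : eval 1ₚ ≈ 1#
    eval-1 = trans (eval-const 1ℤ) ι-1

    eval-q : eval qₚ ≈ q
    eval-q = trans (+-congʳ (*-congʳ ι-1)) (solve 1 (λ q → :1 :* ((q :* :1) :* (:1 :* :1)) :+ con 0ℤ := q) refl q)

    eval-a : eval aₚ ≈ a
    eval-a = trans (+-congʳ (*-congʳ ι-1)) (solve 1 (λ q → :1 :* (:1 :* ((q :* :1) :* :1)) :+ con 0ℤ := q) refl a)

    eval-b : eval bₚ ≈ b
    eval-b = trans (+-congʳ (*-congʳ ι-1)) (solve 1 (λ q → :1 :* (:1 :* (:1 :* (q :* :1))) :+ con 0ℤ := q) refl b)

    horner : List ℤ → Carrier
    horner [] = 0#
    horner (c ∷ cs) = ι c + q * horner cs

    private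
      -- A record, so that unification can read `p` off the type; the worker hidden in `fromU` is
      -- found in this way.
      record _⇓_ (p : Poly) (x : Carrier) : Set where
        constructor mk⇓
        field eval≈ : eval p ≈ x
      open _⇓_

      eval-shifted : (go : ℕ → List ℤ → Poly) → (∀ i → go i [] ≡ []) →
        (∀ i c cs → go i (c ∷ cs) ≡ mono c i 0 0 ∷ go (suc i) cs) →
        ∀ i cs → go i cs ⇓ (q ^ i * horner cs)
      eval-shifted go nil cons i [] = mk⇓ (trans (reflexive (≡.cong eval (nil i))) (sym (zeroʳ _)))
      eval-shifted go nil cons i (c ∷ cs) = mk⇓ (trans (reflexive (≡.cong eval (cons i c cs)))
        (trans (+-congˡ (eval≈ (eval-shifted go nil cons (suc i) cs)))
          (solve 4 (λ c x q h → c :* (x :* (:1 :* :1)) :+ (q :* x) :* h := x :* (c :+ q :* h)) refl (ι c) (q ^ i) q (horner cs))))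

      -- The worker of fromU is local to it: abstracting the starting exponent and leaving the worker
      -- to unification makes it available.
      mutual
        eval-worker : ∀ i cs → _ ⇓ (q ^ i * horner cs)
        eval-worker = eval-shifted _ (λ _ → ≡.refl) (λ _ _ _ → ≡.refl)

        eval-fromU′ : ∀ cs k → k ≡ ℕ.zero → fromU cs ⇓ (q ^ k * horner cs)
        eval-fromU′ cs k with ℕ.zero
        ... | i = λ { ≡.refl → eval-worker i cs }

    eval-fromU : ∀ cs → eval (fromU cs) ≈ horner cs
    eval-fromU cs = trans (eval≈ (eval-fromU′ cs 0 ≡.refl)) (*-identityˡ _)

-- The ring ℤ[q][a][b] and its identification with formal polynomials.

module Tower where
  open import Data.Bool using (Bool; true; false; if_then_else_; _∧_)
  open import Data.Nat using (_≡ᵇ_)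
  import Data.Integer.GCD as ℤG
  import Data.Integer.Divisibility.Signed as ℤS
  open Eval

  ℤ-ring : CommutativeRing 0ℓ 0ℓ
  ℤ-ring = ℤ.+-*-commutativeRing

  ℤ-isGCDDomain : IsGCDDomain ℤ-ring
  ℤ-isGCDDomain = record
    { ≈0? = λ x → x ℤ.≟ 0ℤ ; 1≉0 = λ () ; integral = λ x y → ℤ.i*j≡0⇒i≡0∨j≡0 x
    ; gcd = ℤG.gcd
    ; gcd∣ˡ = λ x y → from (ℤG.gcd[i,j]∣i x y)
    ; gcd∣ʳ = λ x y → from (ℤG.gcd[i,j]∣j x y)
    ; gcd-greatest = λ {d} {x} {y} a b → from (ℤG.gcd-greatest {x} {y} {d} (to a) (to b)) }
    where
    open Divisibility ℤ-ring
    import Data.Integer.Divisibility as ℤD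
    from : ∀ {x y} → x ℤD.∣ y → x ∣ y
    from {x} d with ℤS.∣ᵤ⇒∣ d
    ... | ℤS.divides c e = divides c (≡.trans (ℤ.*-comm x c) (≡.sym e))
    to : ∀ {x y} → x ∣ y → x ℤD.∣ y
    to {x} (divides c e) = ℤS.∣⇒∣ᵤ (ℤS.divides c (≡.trans (≡.sym e) (ℤ.*-comm x c)))

  module Variable (R : CommutativeRing 0ℓ 0ℓ) where
    open CommutativeRing R
    open Polynomials R
    private
      module P = CommutativeRing polyRing
      module Pow = Power R
      module PPow = Power polyRing

    X : List Carrier
    X = 0# ∷ 1# ∷ []

    X-mul : ∀ p → mul X p ≋ 0# ∷ p
    X-mul p = ≋-trans (mul-∷0 [ 1# ] p) (∷-cong refl (mul-identityˡ p))

    ∷-split : ∀ c p → c ∷ p ≋ add (const c) (mul X p)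
    ∷-split c p = ≋-sym (≋-trans (add-cong (≋-refl {const c}) (X-mul p)) (∷-cong (+-identityʳ c) ≋-refl))

    1-X-const : ∀ c → add [ 1# ] (neg (mul X (const c))) ≋ 1# ∷ - c ∷ []
    1-X-const c = ≋-trans (add-cong (≋-refl {[ 1# ]}) (neg-cong (X-mul (const c)))) (∷-cong (trans (+-congˡ -0#≈0#) (+-identityʳ 1#)) ≋-refl)
      where open import Algebra.Properties.Ring ring using (-0#≈0#)

    X-minus-const : ∀ c → add X (neg (const c)) ≋ - c ∷ 1# ∷ []
    X-minus-const c = ∷-cong (+-identityˡ (- c)) ≋-refl

    const-cong : ∀ {x y} → x ≈ y → const x ≋ const y
    const-cong e = ∷-cong e ≋-refl

    const-* : ∀ x y → const (x * y) ≋ mul (const x) (const y)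
    const-* x y = ≋-sym (mul-const x (const y))

    const-^ : ∀ x n → PPow._^_ (const x) n ≋ const (Pow._^_ x n)
    const-^ x zero = ≋-refl
    const-^ x (suc n) = ≋-trans (mul-congˡ (const x) (const-^ x n)) (≋-sym (const-* x _))

    shift : ℕ → Carrier → List Carrier
    shift zero c = [ c ]
    shift (suc i) c = 0# ∷ shift i c

    X^-shift : ∀ c i → mul (const c) (PPow._^_ X i) ≋ shift i c
    X^-shift c zero = ≋-trans (mul-const c [ 1# ]) (∷-cong (*-identityʳ c) ≋-refl)
    X^-shift c (suc i) = ≋-trans (P.sym (P.*-assoc (const c) X (PPow._^_ X i)))
      (≋-trans (mul-congʳ (PPow._^_ X i) (mul-comm (const c) X)) (≋-trans (mul-assoc X (const c) (PPow._^_ X i))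
        (≋-trans (X-mul (mul (const c) (PPow._^_ X i))) (∷-cong refl (X^-shift c i)))))

    shift-at : ∀ i c j → shift i c at j ≈ (if i ≡ᵇ j then c else 0#)
    shift-at zero c zero = refl
    shift-at zero c (suc j) = refl
    shift-at (suc i) c zero = refl
    shift-at (suc i) c (suc j) = shift-at i c j

  -- The order of adjunction is chosen for the regularity proofs: Φ_n is a constant with respect to
  -- `a` and `b`, the factors containing `a` have a coefficient 1 as polynomials in `a`, and
  -- `b - q^i` is monic in `b`. Each claim then compares a constant with a primitive polynomial, or
  -- two constants, at some level.
  module V₁ = Variable ℤ-ring
  module U₁ = Polynomials ℤ-ring
  module G₁ = PolyGCD ℤ-ring ℤ-isGCDDomain
  ℤ[q] : CommutativeRing 0ℓ 0ℓ
  ℤ[q] = U₁.polyRing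
  module V₂ = Variable ℤ[q]
  module U₂ = Polynomials ℤ[q]
  module G₂ = PolyGCD ℤ[q] G₁.polyIsGCDDomain
  ℤ[q,a] : CommutativeRing 0ℓ 0ℓ
  ℤ[q,a] = U₂.polyRing
  module V₃ = Variable ℤ[q,a]
  module U₃ = Polynomials ℤ[q,a]
  module G₃ = PolyGCD ℤ[q,a] G₂.polyIsGCDDomain
  ℤ[q,a,b] : CommutativeRing 0ℓ 0ℓ
  ℤ[q,a,b] = U₃.polyRing

  module T = CommutativeRing ℤ[q,a,b]


  cc : List ℤ → T.Carrier
  cc f = U₃.const (U₂.const f)

  cc-cong : ∀ {f g} → f U₁.≋ g → cc f T.≈ cc g
  cc-cong e = V₃.const-cong (V₂.const-cong e)

  cc-* : ∀ f g → cc (U₁.mul f g) T.≈ cc f T.* cc g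
  cc-* f g = T.trans {cc (U₁.mul f g)} (V₃.const-cong (V₂.const-* f g)) (V₃.const-* (U₂.const f) (U₂.const g))

  cc-^ : ∀ f n → Power._^_ ℤ[q,a,b] (cc f) n T.≈ cc (Power._^_ ℤ[q] f n)
  cc-^ f n = T.trans {Power._^_ ℤ[q,a,b] (cc f) n} (V₃.const-^ (U₂.const f) n) (V₃.const-cong (V₂.const-^ f n))

  ιT : ℤ → T.Carrier
  ιT c = cc (U₁.const c)

  homT : ℤHom ℤ[q,a,b]
  homT = record
    { ι = ιT
    ; ι-* = λ c d → T.trans {ιT (c ℤ.* d)} (cc-cong (V₁.const-* c d)) (cc-* (U₁.const c) (U₁.const d))
    ; ι-neg = λ c → T.refl {ιT (ℤ.- c)}
    ; ι-1 = T.refl {ιT 1ℤ} }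

  qT aT bT : T.Carrier
  qT = cc V₁.X
  aT = U₃.const V₂.X
  bT = V₃.X

  module E = Evaluation ℤ[q,a,b] homT qT aT bT
  open E using (eval; mon)

  private
    module Assoc (R : CommutativeRing 0ℓ 0ℓ) where
      open CommutativeRing R
      assoc₄ : ∀ x y z w → x * (y * (z * w)) ≈ ((x * y) * z) * w
      assoc₄ x y z w = trans (sym (*-assoc x y (z * w))) (sym (*-assoc (x * y) z w))

    infixr 8 _^T_
    _^T_ : T.Carrier → ℕ → T.Carrier
    _^T_ = Power._^_ ℤ[q,a,b]

    mon-shift : ∀ c i j k → mon (mono c i j k) T.≈ V₃.shift k (V₂.shift j (V₁.shift i c))
    mon-shift c i j k =
      T.trans {mon (mono c i j k)} {_} {V₃.shift k s₂} (Assoc.assoc₄ ℤ[q,a,b] (ιT c) (qT ^T i) (aT ^T j) (bT ^T k))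
      (T.trans {ιT c T.* qT ^T i T.* aT ^T j T.* bT ^T k} (U₃.mul-congʳ (bT ^T k) step₂) (V₃.X^-shift s₂ k))
      where
      s₁ = V₁.shift i c
      s₂ = V₂.shift j s₁
      step₁ : ιT c T.* qT ^T i T.≈ cc s₁
      step₁ = T.trans {ιT c T.* qT ^T i} (U₃.mul-congˡ (ιT c) (cc-^ V₁.X i))
        (T.trans {ιT c T.* cc (Power._^_ ℤ[q] V₁.X i)} (T.sym {cc (U₁.mul (U₁.const c) (Power._^_ ℤ[q] V₁.X i))} (cc-* (U₁.const c) (Power._^_ ℤ[q] V₁.X i)))
          (cc-cong (V₁.X^-shift c i)))
      step₂ : ιT c T.* qT ^T i T.* aT ^T j T.≈ U₃.const s₂
      step₂ = T.trans {ιT c T.* qT ^T i T.* aT ^T j} (U₃.mul-congʳ (aT ^T j) step₁)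
        (T.trans {cc s₁ T.* aT ^T j} (U₃.mul-congˡ (cc s₁) (V₃.const-^ V₂.X j))
          (T.trans {cc s₁ T.* U₃.const (Power._^_ ℤ[q,a] V₂.X j)}
            (T.sym {U₃.const (U₂.mul (U₂.const s₁) (Power._^_ ℤ[q,a] V₂.X j))} (V₃.const-* (U₂.const s₁) (Power._^_ ℤ[q,a] V₂.X j)))
            (V₃.const-cong (V₂.X^-shift s₁ j))))

  coefficient : T.Carrier → ℕ → ℕ → ℕ → ℤ
  coefficient t i j k = ((t U₃.at k) U₂.at j) U₁.at i

  coefficient-cong : ∀ {t u} → t T.≈ u → ∀ i j k → coefficient t i j k ≡ coefficient u i j k
  coefficient-cong e i j k = U₁.at≈ (U₂.at≈ (U₃.at≈ e k) j) i

  coefficient-+ : ∀ t u i j k → coefficient (t T.+ u) i j k ≡ coefficient t i j k ℤ.+ coefficient u i j k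
  coefficient-+ t u i j k = ≡.trans (U₁.at≈ (U₂.at≈ (U₃.add-at t u k) j) i)
    (≡.trans (U₁.at≈ (U₂.add-at (t U₃.at k) (u U₃.at k) j) i) (U₁.add-at ((t U₃.at k) U₂.at j) ((u U₃.at k) U₂.at j) i))

  -- The tower looks at the exponent of `b` first, `coeff` at that of `q`; hence the Boolean tests
  -- are resolved from the right.
  coefficient-shift : ∀ c e₁ e₂ e₃ i j k → coefficient (V₃.shift e₃ (V₂.shift e₂ (V₁.shift e₁ c))) i j k
    ≡ (if (e₁ ≡ᵇ i) ∧ (e₂ ≡ᵇ j) ∧ (e₃ ≡ᵇ k) then c else 0ℤ)
  coefficient-shift c e₁ e₂ e₃ i j k = ≡.trans (U₁.at≈ (U₂.at≈ (V₃.shift-at e₃ (V₂.shift e₂ s₁) k) j) i) (select₃ (e₃ ≡ᵇ k))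
    where
    s₁ = V₁.shift e₁ c
    select₁ : ∀ β → β ≡ (e₁ ≡ᵇ i) → s₁ U₁.at i ≡ (if β then c else 0ℤ)
    select₁ β ≡.refl = V₁.shift-at e₁ c i
    ∧-false : ∀ β → (if β ∧ false then c else 0ℤ) ≡ 0ℤ
    ∧-false false = ≡.refl
    ∧-false true = ≡.refl
    ∧-true : ∀ β → β ∧ true ≡ β
    ∧-true false = ≡.refl
    ∧-true true = ≡.refl
    select₂ : ∀ β → (if β then s₁ else []) U₁.at i ≡ (if (e₁ ≡ᵇ i) ∧ β then c else 0ℤ)
    select₂ true = select₁ ((e₁ ≡ᵇ i) ∧ true) (∧-true (e₁ ≡ᵇ i))
    select₂ false = ≡.sym (∧-false (e₁ ≡ᵇ i))
    select₃ : ∀ β → ((if β then V₂.shift e₂ s₁ else []) U₂.at j) U₁.at i ≡ (if (e₁ ≡ᵇ i) ∧ (e₂ ≡ᵇ j) ∧ β then c else 0ℤ)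
    select₃ true = ≡.trans (U₁.at≈ (V₂.shift-at e₂ s₁ j) i) (≡.trans (select₂ (e₂ ≡ᵇ j))
      (≡.cong (λ β → if (e₁ ≡ᵇ i) ∧ β then c else 0ℤ) (≡.sym (∧-true (e₂ ≡ᵇ j)))))
    select₃ false = ≡.sym (≡.trans (≡.cong (λ β → if (e₁ ≡ᵇ i) ∧ β then c else 0ℤ) (Data.Bool.Properties.∧-zeroʳ (e₂ ≡ᵇ j))) (∧-false (e₁ ≡ᵇ i)))
      where import Data.Bool.Properties

  -- This makes `eval` faithful in both directions: `≈ₚ` compares exactly the numbers that equality
  -- in the tower compares.
  coefficient-eval : ∀ p i j k → coeff p i j k ≡ coefficient (eval p) i j k
  coefficient-eval [] i j k = ≡.refl
  coefficient-eval (mono c e₁ e₂ e₃ ∷ p) i j k = ≡.sym (≡.trans (coefficient-+ (mon (mono c e₁ e₂ e₃)) (eval p) i j k)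
    (≡.cong₂ ℤ._+_ (≡.trans (coefficient-cong (mon-shift c e₁ e₂ e₃) i j k) (coefficient-shift c e₁ e₂ e₃ i j k))
                   (≡.sym (coefficient-eval p i j k))))

  eval-injective : ∀ {p r} → eval p T.≈ eval r → p ≈ₚ r
  eval-injective {p} {r} e i j k = ≡.trans (coefficient-eval p i j k) (≡.trans (coefficient-cong e i j k) (≡.sym (coefficient-eval r i j k)))

  eval-cong : ∀ {p r} → p ≈ₚ r → eval p T.≈ eval r
  eval-cong {p} {r} e = U₃.mk≋ λ k → U₂.mk≋ λ j → U₁.mk≋ λ i →
    ≡.trans (≡.sym (coefficient-eval p i j k)) (≡.trans (e i j k) (coefficient-eval r i j k))

  encode₁ : List ℤ → Poly
  encode₁ [] = 0ₚ
  encode₁ (c ∷ f) = constₚ c +ₚ qₚ *ₚ encode₁ f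

  encode₂ : List (List ℤ) → Poly
  encode₂ [] = 0ₚ
  encode₂ (c ∷ f) = encode₁ c +ₚ aₚ *ₚ encode₂ f

  -- A section of `eval`. The statement asks for cofactors and reduced fractions of type `Poly`,
  -- while they are constructed in the tower.
  encode : T.Carrier → Poly
  encode [] = 0ₚ
  encode (c ∷ f) = encode₂ c +ₚ bₚ *ₚ encode f

  private
    module Glue (R : CommutativeRing 0ℓ 0ℓ) where
      open CommutativeRing R
      glue : ∀ {x y z y′ z′ w u v} → x ≈ y + z → y ≈ y′ → z ≈ u * v → u ≈ w → v ≈ z′ → x ≈ y′ + w * z′
      glue e f g h i = trans e (+-cong f (trans g (*-cong h i)))
    open Glue ℤ[q,a,b]

  eval-encode₁ : ∀ f → eval (encode₁ f) T.≈ cc f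
  eval-encode₁ [] = T.sym {cc []} (U₃.∷-zero (U₂.∷-zero U₁.≋-refl U₂.≋-refl) U₃.≋-refl)
  eval-encode₁ (c ∷ f) = T.trans {eval (encode₁ (c ∷ f))} {ιT c T.+ qT T.* cc f}
    (glue {y = eval (constₚ c)} {z = eval (qₚ *ₚ encode₁ f)} {u = eval qₚ} {v = eval (encode₁ f)} (E.eval-+ (constₚ c) (qₚ *ₚ encode₁ f)) (E.eval-const c) (E.eval-* qₚ (encode₁ f)) E.eval-q (eval-encode₁ f))
    (T.sym {cc (c ∷ f)} (T.trans {cc (c ∷ f)} (cc-cong (V₁.∷-split c f))
      (U₃.addʳ (ιT c) (cc-* V₁.X f))))

  eval-encode₂ : ∀ f → eval (encode₂ f) T.≈ U₃.const f
  eval-encode₂ [] = T.sym {U₃.const []} (U₃.∷-zero U₂.≋-refl U₃.≋-refl)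
  eval-encode₂ (c ∷ f) = T.trans {eval (encode₂ (c ∷ f))} {cc c T.+ aT T.* U₃.const f}
    (glue {y = eval (encode₁ c)} {z = eval (aₚ *ₚ encode₂ f)} {u = eval aₚ} {v = eval (encode₂ f)} (E.eval-+ (encode₁ c) (aₚ *ₚ encode₂ f)) (eval-encode₁ c) (E.eval-* aₚ (encode₂ f)) E.eval-a (eval-encode₂ f))
    (T.sym {U₃.const (c ∷ f)} (T.trans {U₃.const (c ∷ f)} (V₃.const-cong (V₂.∷-split c f))
      (U₃.addʳ (cc c) (V₃.const-* V₂.X f))))

  eval-encode : ∀ f → eval (encode f) T.≈ f
  eval-encode [] = U₃.≋-refl
  eval-encode (c ∷ f) = T.trans {eval (encode (c ∷ f))} {U₃.const c T.+ bT T.* f}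
    (glue {y = eval (encode₂ c)} {z = eval (bₚ *ₚ encode f)} {u = eval bₚ} {v = eval (encode f)} (E.eval-+ (encode₂ c) (bₚ *ₚ encode f)) (eval-encode₂ c) (E.eval-* bₚ (encode f)) E.eval-b (eval-encode f))
    (T.sym {c ∷ f} (V₃.∷-split c f))

-- Finite sums, Pochhammer symbols and the q-series identity.

module QSeries where
  open Eval using (module Power)

  module Sums (R : CommutativeRing 0ℓ 0ℓ) where
    open CommutativeRing R
    open IntSolver R

    sum : ℕ → (ℕ → Carrier) → Carrier
    sum ℕ.zero f = 0#
    sum (suc n) f = f 0 + sum n (λ i → f (suc i))

    sum-cong : ∀ n {f g} → (∀ i → i ℕ.< n → f i ≈ g i) → sum n f ≈ sum n g
    sum-cong ℕ.zero e = refl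
    sum-cong (suc n) e = +-cong (e 0 (s≤s z≤n)) (sum-cong n (λ i lt → e (suc i) (s≤s lt)))

    sum-snoc : ∀ n f → sum (suc n) f ≈ sum n f + f n
    sum-snoc ℕ.zero f = +-comm _ _
    sum-snoc (suc n) f = trans (+-congˡ (sum-snoc n (λ i → f (suc i)))) (sym (+-assoc _ _ _))

    sum-zero : ∀ n {f} → (∀ i → i ℕ.< n → f i ≈ 0#) → sum n f ≈ 0#
    sum-zero ℕ.zero e = refl
    sum-zero (suc n) e = trans (+-cong (e 0 (s≤s z≤n)) (sum-zero n (λ i lt → e (suc i) (s≤s lt)))) (+-identityˡ 0#)

    sum-+ : ∀ n f g → sum n (λ i → f i + g i) ≈ sum n f + sum n g
    sum-+ ℕ.zero f g = sym (+-identityˡ 0#)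
    sum-+ (suc n) f g = trans (+-congˡ (sum-+ n _ _))
      (solve 4 (λ a b c d → (a :+ b) :+ (c :+ d) := (a :+ c) :+ (b :+ d)) refl _ _ _ _)

    sum-*ˡ : ∀ n c f → sum n (λ i → c * f i) ≈ c * sum n f
    sum-*ˡ ℕ.zero c f = sym (zeroʳ c)
    sum-*ˡ (suc n) c f = trans (+-congˡ (sum-*ˡ n c _)) (sym (distribˡ _ _ _))

    sum-*ʳ : ∀ n c f → sum n (λ i → f i * c) ≈ sum n f * c
    sum-*ʳ n c f = trans (sum-cong n (λ i _ → *-comm (f i) c)) (trans (sum-*ˡ n c f) (*-comm c _))

    sum-swap : ∀ n m f → sum n (λ i → sum m (f i)) ≈ sum m (λ j → sum n (λ i → f i j))
    sum-swap ℕ.zero m f = sym (sum-zero m (λ _ _ → refl))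
    sum-swap (suc n) m f = trans (+-congˡ (sum-swap n m (λ i → f (suc i)))) (sym (sum-+ m _ _))

  module Pochhammer (R : CommutativeRing 0ℓ 0ℓ) where
    open CommutativeRing R
    open Power R
    open IntSolver R

    pochR : Carrier → Carrier → ℕ → Carrier
    pochR x p ℕ.zero = 1#
    pochR x p (suc k) = pochR x p k * (1# - x * p ^ k)

    poch-cong : ∀ {x y} p k → x ≈ y → pochR x p k ≈ pochR y p k
    poch-cong p ℕ.zero e = refl
    poch-cong p (suc k) e = *-cong (poch-cong p k e) (+-congˡ (-‿cong (*-congʳ e)))

    poch-suc : ∀ x p k → pochR x p (suc k) ≈ (1# - x) * pochR (x * p) p k
    poch-suc x p ℕ.zero = solve 1 (λ x → :1 :* (:1 :- x :* :1) := (:1 :- x) :* :1) refl x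
    poch-suc x p (suc k) = trans (*-congʳ (poch-suc x p k))
      (solve 4 (λ x p r y → ((:1 :- x) :* r) :* (:1 :- x :* (p :* y)) := (:1 :- x) :* (r :* (:1 :- (x :* p) :* y)))
        refl x p (pochR (x * p) p k) (p ^ k))

    poch-vanish : ∀ x p k i → i ℕ.< k → x * p ^ i ≈ 1# → pochR x p k ≈ 0#
    poch-vanish x p (suc k) i (s≤s i≤k) e with ℕ.m≤n⇒m<n∨m≡n i≤k
    ... | inj₁ i<k = trans (*-congʳ (poch-vanish x p k i i<k e)) (zeroˡ _)
    ... | inj₂ ≡.refl = trans (*-congˡ (trans (+-congˡ (-‿cong e)) (-‿inverseʳ 1#))) (zeroʳ _)

  Inverse : (R : CommutativeRing 0ℓ 0ℓ) → CommutativeRing.Carrier R → CommutativeRing.Carrier R → Set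
  Inverse R x y = x * y ≈ 1#
    where open CommutativeRing R

  -- The ring will be a localised quotient, possibly with zero divisors, so inverses are supplied as
  -- elements: `q′` here, and further ones for each denominator below.
  module Transformation (R : CommutativeRing 0ℓ 0ℓ) (q q′ : CommutativeRing.Carrier R) (qq′≈1 : Inverse R q q′) where
    open CommutativeRing R
    open Power R
    open Sums R
    open Pochhammer R
    open IntSolver R
    open import Relation.Binary.Reasoning.Setoid setoid

    private
      infixl 7 _⟨*⟩_
      infixl 6 _⟨-⟩_
      _⟨*⟩_ : ∀ {x y u v} → x ≈ y → u ≈ v → x * u ≈ y * v
      _⟨*⟩_ = *-cong
      _⟨-⟩_ : ∀ {x y u v} → x ≈ y → u ≈ v → x - u ≈ y - v
      e ⟨-⟩ f = +-cong e (-‿cong f)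

    cancel-unit : ∀ {x x′ y z} → x * x′ ≈ 1# → x * y ≈ x * z → y ≈ z
    cancel-unit {x} {x′} {y} {z} u e = trans (lem y) (trans (*-congˡ e) (sym (lem z)))
      where
      lem : ∀ y → y ≈ x′ * (x * y)
      lem y = trans (sym (*-identityˡ y)) (trans (*-congʳ (trans (sym u) (*-comm x x′))) (*-assoc _ _ _))

    Q Q′ : Carrier
    Q = q * q
    Q′ = q′ * q′

    QQ′≈1 : Q * Q′ ≈ 1#
    QQ′≈1 = trans (solve 2 (λ q r → (q :* q) :* (r :* r) := (q :* r) :* (q :* r)) refl q q′)
      (trans (qq′≈1 ⟨*⟩ qq′≈1) (*-identityˡ 1#))

    Q^Q′^ : ∀ k → Q ^ k * Q′ ^ k ≈ 1#
    Q^Q′^ k = trans (sym (^-*-distrib Q Q′ k)) (trans (^-cong k QQ′≈1) (1^ k))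

    Q′^Q^ : ∀ k → Q′ ^ k * Q ^ k ≈ 1#
    Q′^Q^ k = trans (*-comm _ _) (Q^Q′^ k)

    Q′^suc-Q : ∀ k → Q′ ^ suc k * Q ≈ Q′ ^ k
    Q′^suc-Q k = trans (solve 3 (λ u y v → (u :* y) :* v := (v :* u) :* y) refl Q′ (Q′ ^ k) Q)
      (trans (*-congʳ QQ′≈1) (*-identityˡ _))

    W-unit : ∀ k → (Q * Q ^ k) * (Q′ * Q′ ^ k) ≈ 1#
    W-unit k = Q^Q′^ (suc k)

    P : ℕ → ℕ → Carrier
    P j k = pochR (Q′ ^ k) Q j * pochR (q * Q ^ k) Q j

    -- The factor of index `k` in the first symbol is 1 - Q^(-k) Q^k. This triangularity is why
    -- `S m` has a single term.
    P-vanish : ∀ j k → k ℕ.< j → P j k ≈ 0#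
    P-vanish j k k<j = trans (*-congʳ (poch-vanish (Q′ ^ k) Q j k k<j (Q′^Q^ k))) (zeroˡ _)

    -- The q-Saalschütz expansion of the b-dependent factor.

    module Saalschütz (b b′ : Carrier) (bb′≈1 : b * b′ ≈ 1#) where

      -- At `y = Q ^ k`, the ratio `β y / α y` is the quotient of consecutive b-dependent factors
      -- `X (suc k) / X k` of the left-hand terms.
      α β : Carrier → Carrier
      α y = (1# - q * (q * y) * b′) * (1# - q * (q * y))
      β y = (1# - b * (q * y)) * (1# - q * y) * (q * b′)

      -- The common factor of `P (suc j) (suc k)` and `P (suc j) k`; only two linear factors of each
      -- remain after taking it out.
      V : ℕ → ℕ → Carrier
      V j k = pochR (Q′ ^ k) Q j * pochR (q * Q ^ k * Q) Q j

      P-k+1 : ∀ j k → P (suc j) (suc k) ≈ V j k * ((1# - Q′ * Q′ ^ k) * (1# - q * Q ^ k * (Q * Q ^ j)))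
      P-k+1 j k = begin
        pochR (Q′ ^ suc k) Q (suc j) * (pochR (q * (Q * Q ^ k)) Q j * (1# - q * (Q * Q ^ k) * Q ^ j))
          ≈⟨ *-cong (poch-suc (Q′ ^ suc k) Q j) (*-congʳ (poch-cong Q j (solve 3 (λ q Q y → q :* (Q :* y) := q :* y :* Q) refl q Q (Q ^ k)))) ⟩
        ((1# - Q′ ^ suc k) * pochR (Q′ ^ suc k * Q) Q j) * (p₂ * (1# - q * (Q * Q ^ k) * Q ^ j))
          ≈⟨ *-congʳ (*-congˡ (poch-cong Q j (Q′^suc-Q k))) ⟩
        ((1# - Q′ ^ suc k) * p₁) * (p₂ * (1# - q * (Q * Q ^ k) * Q ^ j))
          ≈⟨ solve 7 (λ u p r q Q y z → ((:1 :- u) :* p) :* (r :* (:1 :- q :* (Q :* y) :* z)) := (p :* r) :* ((:1 :- u) :* (:1 :- q :* y :* (Q :* z))))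
               refl (Q′ ^ suc k) p₁ p₂ q Q (Q ^ k) (Q ^ j) ⟩
        _ ∎
        where p₁ = pochR (Q′ ^ k) Q j
              p₂ = pochR (q * Q ^ k * Q) Q j

      P-k : ∀ j k → P (suc j) k ≈ V j k * ((1# - Q′ ^ k * Q ^ j) * (1# - q * Q ^ k))
      P-k j k = trans (*-congˡ (poch-suc (q * Q ^ k) Q j))
        (solve 4 (λ p r u v → (p :* u) :* (v :* r) := (p :* r) :* (u :* v)) refl _ _ _ _)

      V-suc : ∀ j k → V (suc j) k ≈ V j k * ((1# - Q′ ^ k * Q ^ j) * (1# - q * Q ^ k * (Q * Q ^ j)))
      V-suc j k = solve 7 (λ p r u s Q y z → (p :* u) :* (r :* (:1 :- s :* y :* Q :* z)) := (p :* r) :* (u :* (:1 :- s :* y :* (Q :* z))))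
        refl (pochR (Q′ ^ k) Q j) (pochR (q * Q ^ k * Q) Q j) (1# - Q′ ^ k * Q ^ j) q Q (Q ^ k) (Q ^ j)

      -- Everything is homogenised with W W′ = Z Z′ = b b′ = 1, which turns it into a polynomial identity.
      certificate-step : ∀ s W′ Z Z′ → (q * s) * W′ ≈ 1# → Z * Z′ ≈ 1# → let W = q * s in
        (1# - q * s * s) * Z′ * ((1# - Z) * (1# - Z) * (1# - Z * b′))
          + ((1# - W′) * (1# - s * Z) * ((1# - W * b′) * (1# - W)) - (1# - W′ * Z) * (1# - s) * ((1# - b * s) * (1# - s) * (q * b′)))
        ≈ (1# - q * s * s) * Z′ * ((1# - W′ * Z) * (1# - s * Z)) * (1# - q * Z * b′)
      certificate-step s W′ Z Z′ w z = begin
        (1# - q * s * s) * Z′ * ((1# - Z) * (1# - Z) * (1# - Z * b′))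
          + ((1# - W′) * (1# - s * Z) * ((1# - W * b′) * (1# - W)) - (1# - W′ * Z) * (1# - s) * ((1# - b * s) * (1# - s) * (q * b′)))
          ≈⟨ +-cong (trans (refl ⟨*⟩ (refl ⟨*⟩ (B ⟨-⟩ refl))) (trans (sym (*-identityʳ _)) (refl ⟨*⟩ Wi)))
                    (trans ((Wi ⟨-⟩ refl) ⟨*⟩ refl ⟨*⟩ ((B ⟨-⟩ refl) ⟨*⟩ refl) ⟨-⟩ (Wi ⟨-⟩ refl) ⟨*⟩ refl ⟨*⟩ refl)
                           (trans (sym (*-identityʳ _)) (refl ⟨*⟩ Zi))) ⟩
        (1# - q * s * s) * Z′ * ((1# - Z) * (1# - Z) * (b * b′ - Z * b′)) * (W * W′)
          + ((W * W′ - W′) * (1# - s * Z) * ((b * b′ - W * b′) * (1# - W)) - (W * W′ - W′ * Z) * (1# - s) * ((1# - b * s) * (1# - s) * (q * b′))) * (Z * Z′)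
          ≈⟨ solve 7 (λ q s v Z z b c → let W = q :* s in
               (:1 :- q :* s :* s) :* z :* ((:1 :- Z) :* (:1 :- Z) :* (b :* c :- Z :* c)) :* (W :* v)
                 :+ ((W :* v :- v) :* (:1 :- s :* Z) :* ((b :* c :- W :* c) :* (:1 :- W)) :- (W :* v :- v :* Z) :* (:1 :- s) :* ((:1 :- b :* s) :* (:1 :- s) :* (q :* c))) :* (Z :* z)
               := (:1 :- q :* s :* s) :* z :* ((W :* v :- v :* Z) :* (:1 :- s :* Z)) :* (b :* c :- q :* Z :* c))
               refl q s W′ Z Z′ b b′ ⟩
        (1# - q * s * s) * Z′ * ((W * W′ - W′ * Z) * (1# - s * Z)) * (b * b′ - q * Z * b′)
          ≈⟨ refl ⟨*⟩ ((sym Wi ⟨-⟩ refl) ⟨*⟩ refl) ⟨*⟩ (sym B ⟨-⟩ refl) ⟩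
        _ ∎
        where
        W = q * s
        B : 1# ≈ b * b′
        B = sym bb′≈1
        Wi : 1# ≈ W * W′
        Wi = sym w
        Zi : 1# ≈ Z * Z′
        Zi = sym z

      module _ (m : ℕ) (w : ℕ → Carrier)
        (w-suc : ∀ j → j ℕ.< m → w (suc j) * ((1# - Q * Q ^ j) * (1# - Q * Q ^ j) * (1# - Q * Q ^ j * b′)) ≈ w j * ((1# - q * Q ^ j * b′) * Q)) where

        difference : ℕ → ℕ → Carrier
        difference k j = (P j (suc k) * α (Q ^ k) - P j k * β (Q ^ k)) * w j

        -- The differences are Gosper-summable in `j`, and the right-hand side is their
        -- antidifference; `certificate-step` is the induction step divided by the common factor
        -- `V J k * w (suc J)`. At `J = m` the factor `V m k` contains (Q^(-k); Q)_m, which is zero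
        -- for `k < m`.
        partial-sum : ∀ k J → J ℕ.≤ m → let s = q * Q ^ k in
          sum (suc J) (difference k) ≈ (1# - q * s * s) * Q′ ^ J * V J k * w J * (1# - q * Q ^ J * b′)
        partial-sum k ℕ.zero _ = begin
          (1# * 1# * α y - 1# * 1# * ((1# - b * s) * (1# - s) * (q * b′))) * w 0 + 0#
            ≈⟨ solve 6 (λ a b s q c w → (:1 :* :1 :* a :- :1 :* :1 :* ((:1 :- b :* s) :* (:1 :- s) :* (q :* c))) :* w :+ con (ℤ.+ 0)
                 := (a :- (c :- (b :* c) :* s) :* (:1 :- s) :* q) :* w) refl (α y) b s q b′ (w 0) ⟩
          (α y - (b′ - (b * b′) * s) * (1# - s) * q) * w 0
            ≈⟨ *-congʳ (+-congˡ (-‿cong (*-congʳ (*-congʳ (+-congˡ (-‿cong (*-congʳ bb′≈1))))))) ⟩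
          (α y - (b′ - 1# * s) * (1# - s) * q) * w 0
            ≈⟨ solve 4 (λ s q c w → ((:1 :- q :* s :* c) :* (:1 :- q :* s) :- (c :- :1 :* s) :* (:1 :- s) :* q) :* w
                 := (:1 :- q :* s :* s) :* :1 :* (:1 :* :1) :* w :* (:1 :- q :* :1 :* c)) refl s q b′ (w 0) ⟩
          _ ∎
          where y = Q ^ k
                s = q * y
        partial-sum k (suc J) J<m = begin
          sum (suc (suc J)) (difference k) ≈⟨ sum-snoc (suc J) (difference k) ⟩
          sum (suc J) (difference k) + difference k (suc J)
            ≈⟨ +-cong (partial-sum k J (ℕ.<⇒≤ J<m))
                 (*-congʳ (+-cong (*-congʳ (P-k+1 J k)) (-‿cong (*-congʳ (trans (P-k J k) (*-congˡ (*-congʳ (+-congˡ (-‿cong yz)))))))))⟩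
          c * Q′ ^ J * v * w J * r + (v * A * α y - v * B * β y) * w (suc J)
            ≈⟨ +-congʳ (trans (*-assoc _ _ _) (*-congˡ w-back)) ⟩
          c * Q′ ^ J * v * (w (suc J) * K * Q′) + (v * A * α y - v * B * β y) * w (suc J)
            ≈⟨ solve 10 (λ c z v w K Q A a B b → c :* z :* v :* (w :* K :* Q) :+ (v :* A :* a :- v :* B :* b) :* w
                 := v :* w :* (c :* (Q :* z) :* K :+ (A :* a :- B :* b))) refl c (Q′ ^ J) v (w (suc J)) K Q′ A (α y) B (β y) ⟩
          v * w (suc J) * (c * (Q′ * Q′ ^ J) * K + (A * α y - B * β y))
            ≈⟨ *-congˡ (certificate-step s (Q′ * Q′ ^ k) (Q * Q ^ J) (Q′ * Q′ ^ J)
                 (trans (*-congʳ (sym (*-assoc q q y))) (W-unit k)) (W-unit J)) ⟩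
          v * w (suc J) * (c * (Q′ * Q′ ^ J) * (B′ * D) * (1# - q * (Q * Q ^ J) * b′))
            ≈⟨ solve 7 (λ v w c z B D e → v :* w :* (c :* z :* (B :* D) :* e) := c :* z :* (v :* (B :* D)) :* w :* e)
                 refl v (w (suc J)) c (Q′ * Q′ ^ J) B′ D (1# - q * (Q * Q ^ J) * b′) ⟩
          c * (Q′ * Q′ ^ J) * (v * (B′ * D)) * w (suc J) * (1# - q * (Q * Q ^ J) * b′)
            ≈⟨ *-congʳ (*-congʳ (*-congˡ (trans (*-congˡ (*-congʳ (+-congˡ (-‿cong (sym yz))))) (sym (V-suc J k))))) ⟩
          _ ∎
          where
          y = Q ^ k
          s = q * y
          c = 1# - q * s * s
          v = V J k
          r = 1# - q * Q ^ J * b′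
          K = (1# - Q * Q ^ J) * (1# - Q * Q ^ J) * (1# - Q * Q ^ J * b′)
          D = 1# - s * (Q * Q ^ J)
          A = (1# - Q′ * Q′ ^ k) * D
          B′ = 1# - (Q′ * Q′ ^ k) * (Q * Q ^ J)
          B = B′ * (1# - s)
          -- Raising both exponents by one brings in the `W′` and `Z` of the certificate.
          yz : Q′ ^ k * Q ^ J ≈ (Q′ * Q′ ^ k) * (Q * Q ^ J)
          yz = sym (trans (solve 4 (λ u y v z → (u :* y) :* (v :* z) := (v :* u) :* (y :* z)) refl Q′ (Q′ ^ k) Q (Q ^ J))
            (trans (*-congʳ QQ′≈1) (*-identityˡ _)))
          w-back : w J * r ≈ w (suc J) * K * Q′
          w-back = trans (sym (*-identityʳ _)) (trans (*-congˡ (sym QQ′≈1))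
            (trans (solve 4 (λ w r Q u → (w :* r) :* (Q :* u) := (w :* (r :* Q)) :* u) refl (w J) r Q Q′) (*-congʳ (sym (w-suc J J<m)))))

        saalschütz-suc : ∀ k → k ℕ.< m →
          sum (suc m) (λ j → P j (suc k) * w j) * α (Q ^ k) ≈ sum (suc m) (λ j → P j k * w j) * β (Q ^ k)
        saalschütz-suc k k<m = begin
          S₁ * a ≈⟨ solve 2 (λ x y → x := y :+ (x :- y)) refl (S₁ * a) (S₀ * c) ⟩
          S₀ * c + (S₁ * a - S₀ * c) ≈⟨ +-congˡ (sym collect) ⟩
          S₀ * c + sum (suc m) (difference k) ≈⟨ +-congˡ (trans (partial-sum k m ℕ.≤-refl) vanish) ⟩
          S₀ * c + 0# ≈⟨ +-identityʳ _ ⟩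
          S₀ * c ∎
          where
          a = α (Q ^ k)
          c = β (Q ^ k)
          f₁ f₀ : ℕ → Carrier
          f₁ j = P j (suc k) * w j
          f₀ j = P j k * w j
          S₁ = sum (suc m) f₁
          S₀ = sum (suc m) f₀
          collect : sum (suc m) (difference k) ≈ S₁ * a - S₀ * c
          collect = trans (sum-cong (suc m) (λ j _ → solve 5 (λ p a r c w → (p :* a :- r :* c) :* w := p :* w :* a :+ r :* w :* (:- c))
              refl (P j (suc k)) a (P j k) c (w j)))
            (trans (sum-+ (suc m) (λ j → f₁ j * a) (λ j → f₀ j * (- c))) (trans (+-cong (sum-*ʳ (suc m) a f₁) (sum-*ʳ (suc m) (- c) f₀))
              (solve 4 (λ x a y c → x :* a :+ y :* (:- c) := x :* a :- y :* c) refl S₁ a S₀ c)))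
          vanish : ∀ {x y z} → x * V m k * y * z ≈ 0#
          vanish {x} {y} {z} = trans (*-congʳ (trans (*-congʳ (trans (*-congˡ (trans (*-congʳ (poch-vanish (Q′ ^ k) Q m k k<m (Q′^Q^ k))) (zeroˡ _))) (zeroʳ x))) (zeroˡ y))) (zeroˡ z)

        -- Both sides satisfy the same first-order recurrence in `k`, which can be solved because
        -- `α (Q ^ k)` is a unit; at `k = 0` only the summand `j = 0` survives.
        saalschütz : ∀ (X : ℕ → Carrier) (units : ℕ → Carrier) → X 0 ≈ w 0 →
          (∀ k → k ℕ.< m → X (suc k) * α (Q ^ k) ≈ X k * β (Q ^ k)) → (∀ k → k ℕ.< m → α (Q ^ k) * units k ≈ 1#) →
          ∀ k → k ℕ.≤ m → X k ≈ sum (suc m) (λ j → P j k * w j)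
        saalschütz X units X-0 X-suc α-unit ℕ.zero _ = sym (trans
          (+-cong (trans (*-congʳ (*-identityˡ 1#)) (*-identityˡ _)) (sum-zero m (λ j _ → trans (*-congʳ (P-vanish (suc j) 0 (s≤s z≤n))) (zeroˡ _))))
          (trans (+-identityʳ _) (sym X-0)))
        saalschütz X units X-0 X-suc α-unit (suc k) k<m = cancel-unit (α-unit k k<m)
          (trans (*-comm _ _) (trans (X-suc k k<m) (trans (*-congʳ (saalschütz X units X-0 X-suc α-unit k (ℕ.<⇒≤ k<m)))
            (trans (sym (saalschütz-suc k k<m)) (*-comm _ _)))))

    -- The telescoping recurrence for the inner sums.

    module InnerSum (a a′ : Carrier) (aa′≈1 : a * a′ ≈ 1#) (m : ℕ) (u : ℕ → Carrier) where

      N : Carrier → Carrier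
      N t = (1# - a * (q * t)) * (1# - a′ * (q * t))

      M : Carrier → Carrier
      M W = (1# - a * W) * (1# - a′ * W)

      -- Only the sum `a + a′` is left of the parameter, so the certificate can be checked as a
      -- polynomial identity with that sum as one variable. The same expansion covers `N`, which is
      -- `M` at `q * t`.
      M-expand : ∀ W → M W ≈ 1# - W * (a + a′) + W * W
      M-expand W = trans (solve 3 (λ a c W → (:1 :- a :* W) :* (:1 :- c :* W) := :1 :- W :* (a :+ c) :+ (a :* c) :* (W :* W)) refl a a′ W)
        (+-congˡ (trans (*-congʳ aa′≈1) (*-identityˡ _)))

      term : ℕ → ℕ → Carrier
      term j k = (1# - q * (Q ^ k * Q ^ k)) * u k * P j k

      S : ℕ → Carrier
      S j = sum (suc m) (term j)

      term-difference : ℕ → ℕ → Carrier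
      term-difference j k = term (suc j) k * (1# - Q * Q ^ j) - term j k * (N (Q ^ j) * (1# - q * Q ^ j))

      -- The antidifference in `k`. At `k = m` its factor `N (Q ^ m) * (1# - q * Q ^ m)` is
      -- (1-aq^n)(1-q^n/a)(1-q^n).
      boundary : ℕ → ℕ → Carrier
      boundary j k = - (Q ^ j * Q′ ^ k * (u k * P j k) * (N (Q ^ k) * (1# - q * Q ^ k)) * (1# - q * Q ^ k * Q ^ j))

      -- With `W = Q ^ k` and `z = Q ^ j` this is boundary(k-1) + difference(k) = boundary(k),
      -- divided by `u k * P j k`; the first summand is the previous boundary in the form given by
      -- `boundary-suc`.
      certificate : ∀ W W′ z → W * W′ ≈ 1# →
        z * Q * M W * (1# - W) * (1# - W′ * z)
          + (1# - q * (W * W)) * ((1# - W′ * z) * (1# - q * W * z) * (1# - Q * z) - N z * (1# - q * z))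
        ≈ - (z * W′ * (N W * (1# - q * W)) * (1# - q * W * z))
      certificate W W′ z w = begin
        z * Q * M W * (1# - W) * (1# - W′ * z)
          + (1# - q * (W * W)) * ((1# - W′ * z) * (1# - q * W * z) * (1# - Q * z) - N z * (1# - q * z))
          ≈⟨ +-cong (refl ⟨*⟩ M-expand W ⟨*⟩ refl ⟨*⟩ (sym w ⟨-⟩ refl))
               (refl ⟨*⟩ ((sym w ⟨-⟩ refl) ⟨*⟩ refl ⟨*⟩ refl ⟨-⟩ trans (*-congʳ (M-expand (q * z))) (trans (sym (*-identityˡ _)) (*-congʳ (sym w))))) ⟩
        z * Q * (1# - W * (a + a′) + W * W) * (1# - W) * (W * W′ - W′ * z)
          + (1# - q * (W * W)) * ((W * W′ - W′ * z) * (1# - q * W * z) * (1# - Q * z) - W * W′ * ((1# - (q * z) * (a + a′) + (q * z) * (q * z)) * (1# - q * z)))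
          ≈⟨ solve 5 (λ q s W v z → let Q = q :* q in
               z :* Q :* (:1 :- W :* s :+ W :* W) :* (:1 :- W) :* (W :* v :- v :* z)
                 :+ (:1 :- q :* (W :* W)) :* ((W :* v :- v :* z) :* (:1 :- q :* W :* z) :* (:1 :- Q :* z) :- W :* v :* ((:1 :- (q :* z) :* s :+ (q :* z) :* (q :* z)) :* (:1 :- q :* z)))
               := :- (z :* v :* ((:1 :- (q :* W) :* s :+ (q :* W) :* (q :* W)) :* (:1 :- q :* W)) :* (:1 :- q :* W :* z)))
               refl q (a + a′) W W′ z ⟩
        - (z * W′ * ((1# - (q * W) * (a + a′) + (q * W) * (q * W)) * (1# - q * W)) * (1# - q * W * z))
          ≈⟨ -‿cong (refl ⟨*⟩ (sym (M-expand (q * W)) ⟨*⟩ refl) ⟨*⟩ refl) ⟩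
        _ ∎

      P-suc-j : ∀ j k → P (suc j) k ≈ P j k * ((1# - Q′ ^ k * Q ^ j) * (1# - q * Q ^ k * Q ^ j))
      P-suc-j j k = solve 4 (λ x y u v → (x :* u) :* (y :* v) := (x :* y) :* (u :* v)) refl _ _ _ _

      P-suc-k : ∀ j k → P j (suc k) * ((1# - Q′ * Q′ ^ k * Q ^ j) * (1# - q * Q ^ k)) ≈ P j k * ((1# - Q′ * Q′ ^ k) * (1# - q * Q ^ k * Q ^ j))
      P-suc-k j k = begin
        pochR x Q j * pochR (q * (Q * Q ^ k)) Q j * ((1# - x * Q ^ j) * (1# - s))
          ≈⟨ solve 4 (λ p r c d → (p :* r) :* (c :* d) := (p :* c) :* (d :* r)) refl _ _ _ _ ⟩
        pochR x Q j * (1# - x * Q ^ j) * ((1# - s) * pochR (q * (Q * Q ^ k)) Q j)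
          ≈⟨ poch-suc x Q j ⟨*⟩ (refl ⟨*⟩ poch-cong Q j (solve 3 (λ q Q y → q :* (Q :* y) := q :* y :* Q) refl q Q (Q ^ k))) ⟩
        (1# - x) * pochR (x * Q) Q j * ((1# - s) * pochR (s * Q) Q j)
          ≈⟨ (refl ⟨*⟩ poch-cong Q j (Q′^suc-Q k)) ⟨*⟩ sym (poch-suc s Q j) ⟩
        (1# - x) * pochR (Q′ ^ k) Q j * (pochR s Q j * (1# - s * Q ^ j))
          ≈⟨ solve 4 (λ c p r d → (c :* p) :* (r :* d) := (p :* r) :* (c :* d)) refl _ _ _ _ ⟩
        _ ∎
        where x = Q′ ^ suc k
              s = q * Q ^ k

      module _ (u-suc : ∀ k → k ℕ.< m → u (suc k) * (M (Q * Q ^ k) * ((1# - Q * Q ^ k) * (1# - Q * Q ^ k))) ≈ u k * (N (Q ^ k) * ((1# - q * Q ^ k) * (1# - q * Q ^ k))))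
               (unit : ℕ → Carrier) (1-Q-unit : ∀ k → k ℕ.< m → (1# - Q * Q ^ k) * unit k ≈ 1#) where

        -- The recurrences of `u` and `P` in `k` bring the boundary to the next index, where it has
        -- the factor `u * P` in common with the term to be added.
        boundary-suc : ∀ j k → k ℕ.< m → let W = Q * Q ^ k in
          boundary j k ≈ u (suc k) * P j (suc k) * (Q ^ j * Q * M W * (1# - W) * (1# - Q′ * Q′ ^ k * Q ^ j))
        -- One factor `1# - W` is spent on producing the `1# - W′` that `P-suc-k` requires; it is a
        -- unit and is cancelled afterwards.
        boundary-suc j k k<m = cancel-unit (1-Q-unit k k<m) (begin
          (1# - W) * boundary j k
            ≈⟨ solve 9 (λ W z v u p n s r t → (:1 :- W) :* (:- (z :* v :* (u :* p) :* (n :* s) :* r)) := (v :* W :- v) :* (z :* (u :* p) :* (n :* s) :* r))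
                 refl W z (Q′ ^ k) (u k) (P j k) (N (Q ^ k)) s′ r z ⟩
          (Q′ ^ k * W - Q′ ^ k) * (z * (u k * P j k) * (N (Q ^ k) * s′) * r)
            ≈⟨ *-congʳ lem ⟩
          (Q * (1# - W′)) * (z * (u k * P j k) * (N (Q ^ k) * s′) * r)
            ≈⟨ solve 8 (λ Q x z u p n s r → (Q :* x) :* (z :* (u :* p) :* (n :* s) :* r) := Q :* z :* u :* n :* s :* (p :* (x :* r)))
                 refl Q (1# - W′) z (u k) (P j k) (N (Q ^ k)) s′ r ⟩
          Q * z * u k * N (Q ^ k) * s′ * (P j k * ((1# - W′) * r))
            ≈⟨ *-congˡ (sym (P-suc-k j k)) ⟩
          Q * z * u k * N (Q ^ k) * s′ * (P j (suc k) * ((1# - W′ * z) * s′))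
            ≈⟨ solve 7 (λ Q z u n s p x → Q :* z :* u :* n :* s :* (p :* (x :* s)) := Q :* z :* p :* x :* (u :* (n :* (s :* s))))
                 refl Q z (u k) (N (Q ^ k)) s′ (P j (suc k)) (1# - W′ * z) ⟩
          Q * z * P j (suc k) * (1# - W′ * z) * (u k * (N (Q ^ k) * (s′ * s′)))
            ≈⟨ *-congˡ (sym (u-suc k k<m)) ⟩
          Q * z * P j (suc k) * (1# - W′ * z) * (u (suc k) * (M W * ((1# - W) * (1# - W))))
            ≈⟨ solve 7 (λ Q z p x u M W → Q :* z :* p :* x :* (u :* (M :* (W :* W))) := W :* (u :* p :* (z :* Q :* M :* W :* x)))
                 refl Q z (P j (suc k)) (1# - W′ * z) (u (suc k)) (M W) (1# - W) ⟩
          _ ∎)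
          where
          W = Q * Q ^ k
          W′ = Q′ * Q′ ^ k
          z = Q ^ j
          s′ = 1# - q * Q ^ k
          r = 1# - q * Q ^ k * Q ^ j
          lem : Q′ ^ k * W - Q′ ^ k ≈ Q * (1# - W′)
          lem = trans (+-cong (solve 3 (λ v Q y → v :* (Q :* y) := Q :* (v :* y)) refl (Q′ ^ k) Q (Q ^ k))
                              (-‿cong (trans (sym (Q′^suc-Q k)) (*-comm _ _))))
                (trans (+-congʳ (*-congˡ (Q′^Q^ k))) (solve 2 (λ Q v → Q :* :1 :- Q :* v := Q :* (:1 :- v)) refl Q W′))

        term-difference-factor : ∀ j k → term-difference j k ≈
          u k * P j k * ((1# - q * (Q ^ k * Q ^ k)) * ((1# - Q′ ^ k * Q ^ j) * (1# - q * Q ^ k * Q ^ j) * (1# - Q * Q ^ j) - N (Q ^ j) * (1# - q * Q ^ j)))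
        term-difference-factor j k = trans (+-congʳ (*-congʳ (*-congˡ (P-suc-j j k))))
          (solve 7 (λ c u p x y d n → c :* u :* (p :* (x :* y)) :* d :- c :* u :* p :* n := u :* p :* (c :* (x :* y :* d :- n)))
            refl _ _ _ _ _ _ _)

        partial-sum : ∀ j K → K ℕ.≤ m → sum (suc K) (term-difference j) ≈ boundary j K
        partial-sum j ℕ.zero _ = begin
          term-difference j 0 + 0# ≈⟨ +-identityʳ _ ⟩
          term-difference j 0 ≈⟨ term-difference-factor j 0 ⟩
          U * ((1# - q * (1# * 1#)) * ((1# - 1# * z) * (1# - q * 1# * z) * (1# - Q * z) - N z * (1# - q * z)))
            -- At `W = 1` the summand standing for the previous boundary contains `1# - 1#`, so the
            -- certificate also starts the summation.
            ≈⟨ *-congˡ (solve 6 (λ q z c n M Q → ((:1 :- q :* (:1 :* :1)) :* c) := z :* Q :* M :* (:1 :- :1) :* (:1 :- :1 :* z) :+ (:1 :- q :* (:1 :* :1)) :* c) refl q z _ (N z) (M 1#) Q) ⟩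
          U * (z * Q * M 1# * (1# - 1#) * (1# - 1# * z) + (1# - q * (1# * 1#)) * ((1# - 1# * z) * (1# - q * 1# * z) * (1# - Q * z) - N z * (1# - q * z)))
            ≈⟨ *-congˡ (certificate 1# 1# z (*-identityˡ 1#)) ⟩
          U * - (z * 1# * (N 1# * (1# - q * 1#)) * (1# - q * 1# * z))
            ≈⟨ solve 5 (λ U z v n r → U :* (:- (z :* v :* n :* r)) := :- (z :* v :* U :* n :* r)) refl U z 1# _ _ ⟩
          _ ∎
          where z = Q ^ j
                U = u 0 * P j 0
        partial-sum j (suc K) K<m = begin
          sum (suc (suc K)) (term-difference j) ≈⟨ sum-snoc (suc K) (term-difference j) ⟩
          sum (suc K) (term-difference j) + term-difference j (suc K)
            ≈⟨ +-cong (trans (partial-sum j K (ℕ.<⇒≤ K<m)) (boundary-suc j K K<m)) (term-difference-factor j (suc K)) ⟩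
          U * g + U * f ≈⟨ distribˡ _ _ _ ⟨
          U * (g + f) ≈⟨ *-congˡ (certificate W W′ z (W-unit K)) ⟩
          U * - (z * W′ * (N W * (1# - q * W)) * (1# - q * W * z))
            ≈⟨ solve 5 (λ U z v n r → U :* (:- (z :* v :* n :* r)) := :- (z :* v :* U :* n :* r)) refl U z W′ _ _ ⟩
          _ ∎
          where
          W = Q * Q ^ K
          W′ = Q′ * Q′ ^ K
          z = Q ^ j
          U = u (suc K) * P j (suc K)
          g = z * Q * M W * (1# - W) * (1# - W′ * z)
          f = (1# - q * (W * W)) * ((1# - W′ * z) * (1# - q * W * z) * (1# - Q * z) - N z * (1# - q * z))

        S-suc : N (Q ^ m) * (1# - q * Q ^ m) ≈ 0# → ∀ j → S (suc j) * (1# - Q * Q ^ j) ≈ S j * (N (Q ^ j) * (1# - q * Q ^ j))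
        S-suc end j = begin
          S (suc j) * x ≈⟨ solve 2 (λ x y → x := y :+ (x :- y)) refl (S (suc j) * x) (S j * y) ⟩
          S j * y + (S (suc j) * x - S j * y) ≈⟨ +-congˡ (sym collect) ⟩
          S j * y + sum (suc m) (term-difference j) ≈⟨ +-congˡ (trans (partial-sum j m ℕ.≤-refl) vanish) ⟩
          S j * y + 0# ≈⟨ +-identityʳ _ ⟩
          _ ∎
          where
          x = 1# - Q * Q ^ j
          y = N (Q ^ j) * (1# - q * Q ^ j)
          collect : sum (suc m) (term-difference j) ≈ S (suc j) * x - S j * y
          collect = trans (sum-cong (suc m) (λ k _ → solve 4 (λ s x t y → s :* x :- t :* y := s :* x :+ t :* (:- y)) refl (term (suc j) k) x (term j k) y))
            (trans (sum-+ (suc m) (λ k → term (suc j) k * x) (λ k → term j k * (- y)))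
              (trans (+-cong (sum-*ʳ (suc m) x (term (suc j))) (sum-*ʳ (suc m) (- y) (term j)))
                (solve 4 (λ s x t y → s :* x :+ t :* (:- y) := s :* x :- t :* y) refl (S (suc j)) x (S j) y)))
          vanish : boundary j m ≈ 0#
          vanish = trans (-‿cong (trans (*-congʳ (trans (*-congˡ end) (zeroʳ _))) (zeroˡ _))) -0#≈0#
            where open import Algebra.Properties.Ring ring using (-0#≈0#)

        -- The recurrence is run downwards from `j = m`, where the sum is explicit, so the factors
        -- divided by are 1-aq^(2j+1), 1-q^(2j+1)/a and 1-q^(2j+1) with `j < m`; the vanishing one
        -- at `j = m` is never reached. The argument `i` counts the distance to `m`.
        S-closed : N (Q ^ m) * (1# - q * Q ^ m) ≈ 0# →
          (v : ℕ → Carrier) (c : Carrier) → (∀ j → j ℕ.< m → v (suc j) * (1# - Q * Q ^ j) ≈ v j * (N (Q ^ j) * (1# - q * Q ^ j))) →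
          (unit′ : ℕ → Carrier) → (∀ j → j ℕ.< m → N (Q ^ j) * (1# - q * Q ^ j) * unit′ j ≈ 1#) →
          S m ≈ c * v m → ∀ i j → i ℕ.+ j ≡ m → S j ≈ c * v j
        S-closed end v c v-suc unit′ N-unit S-m ℕ.zero j ≡.refl = S-m
        S-closed end v c v-suc unit′ N-unit S-m (suc i) j e = cancel-unit (N-unit j j<m) (begin
          y * S j ≈⟨ *-comm _ _ ⟩
          S j * y ≈⟨ S-suc end j ⟨
          S (suc j) * x ≈⟨ *-congʳ (S-closed end v c v-suc unit′ N-unit S-m i (suc j) (≡.trans (ℕ.+-suc i j) e)) ⟩
          c * v (suc j) * x ≈⟨ *-assoc _ _ _ ⟩
          c * (v (suc j) * x) ≈⟨ *-congˡ (v-suc j j<m) ⟩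
          c * (v j * y) ≈⟨ solve 3 (λ c v y → c :* (v :* y) := y :* (c :* v)) refl c (v j) y ⟩
          y * (c * v j) ∎)
          where
          x = 1# - Q * Q ^ j
          y = N (Q ^ j) * (1# - q * Q ^ j)
          j<m : j ℕ.< m
          j<m = ℕ.≤-trans (s≤s (ℕ.m≤n+m j i)) (ℕ.≤-reflexive e)

    qintR : ℕ → Carrier
    qintR ℕ.zero = 0#
    qintR (suc n) = qintR n + q ^ n

    qint-geometric : ∀ n → (1# - q) * qintR n ≈ 1# - q ^ n
    qint-geometric ℕ.zero = trans (zeroʳ _) (sym (-‿inverseʳ 1#))
    qint-geometric (suc n) = trans (distribˡ _ _ _) (trans (+-congʳ (qint-geometric n))
      (solve 2 (λ q y → (:1 :- y) :+ (:1 :- q) :* y := :1 :- q :* y) refl q (q ^ n)))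

    q^2k : ∀ k → q ^ (2 ℕ.* k) ≈ Q ^ k
    q^2k k = trans (^-* q 2 k) (trans (*-congˡ (*-identityʳ _)) (sym (^-*-distrib q q k)))

    q^2k+1 : ∀ k → q ^ (2 ℕ.* k ℕ.+ 1) ≈ q * Q ^ k
    q^2k+1 k = trans (^-+ q (2 ℕ.* k) 1) (trans (*-cong (q^2k k) (*-identityʳ q)) (*-comm _ _))

    q^4k+1 : ∀ k → q ^ (4 ℕ.* k ℕ.+ 1) ≈ q * (Q ^ k * Q ^ k)
    q^4k+1 k = trans (^-+ q (4 ℕ.* k) 1) (trans (*-cong (trans (^-* q 4 k)
        (trans (solve 1 (λ x → x :* (x :* (x :* (x :* :1))) := (x :* x) :* (x :* x)) refl (q ^ k)) (sym (Qk ⟨*⟩ Qk)))) (*-identityʳ q)) (*-comm _ _))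
      where Qk = ^-*-distrib q q k

    inverse-suc : ∀ {x d i i⁺} → x * i ≈ 1# → x * d * i⁺ ≈ 1# → i⁺ * d ≈ i
    inverse-suc {x} {d} {i} {i⁺} e f = trans (sym (*-identityʳ _)) (trans (*-congˡ (sym e))
      (trans (solve 4 (λ x d i j → (j :* d) :* (x :* i) := (x :* d :* j) :* i) refl x d i i⁺) (trans (*-congʳ f) (*-identityˡ i))))

    module Identity (a a′ b b′ : Carrier) (aa′≈1 : a * a′ ≈ 1#) (bb′≈1 : b * b′ ≈ 1#) (m : ℕ) (iα iα′ iβ iδ : ℕ → Carrier)
      (α-inv : ∀ k → k ℕ.≤ m → pochR (a * Q) Q k * iα k ≈ 1#)
      (α′-inv : ∀ k → k ℕ.≤ m → pochR (Q * a′) Q k * iα′ k ≈ 1#)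
      (β-inv : ∀ k → k ℕ.≤ m → pochR (Q * b′) Q k * iβ k ≈ 1#)
      (δ-inv : ∀ k → k ℕ.≤ m → pochR Q Q k * iδ k ≈ 1#) where

      -- Up to the q-integer, `u k * X k` is the left-hand term, split so that `b` occurs in `X`
      -- only. The sequence `v` solves the recurrence of the inner sums, and `v j * w j` is the
      -- right-hand term.
      A A′ B D E u X w v : ℕ → Carrier
      A = pochR (a * q) Q
      A′ = pochR (q * a′) Q
      B = pochR (b * q) Q
      D = pochR q Q
      E = pochR (q * b′) Q
      u k = A k * A′ k * (D k * D k) * (iα k * iα′ k * (iδ k * iδ k))
      X k = B k * D k * (iβ k * iδ k) * (q * b′) ^ k
      w j = E j * Q ^ j * (iβ j * (iδ j * iδ j))
      v j = A j * A′ j * D j * iδ j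

      lhsTermR rhsTermR : ℕ → Carrier
      lhsTermR k = qintR (4 ℕ.* k ℕ.+ 1) * ((A k * A′ k * B k * (D k ^ 3)) * (iα k * iα′ k * iβ k * (iδ k ^ 3))) * (q * b′) ^ k
      rhsTermR k = ((A k * A′ k * E k * D k) * (iβ k * (iδ k ^ 3))) * q ^ (2 ℕ.* k)

      LHSR RHSR : Carrier
      LHSR = sum (suc m) lhsTermR
      RHSR = qintR (2 ℕ.* m ℕ.+ 1) * (1# * q′ ^ m) * sum (suc m) rhsTermR

      module SZ = Saalschütz b b′ bb′≈1
      module IS = InnerSum a a′ aa′≈1 m u

      δ-suc : ∀ k → k ℕ.< m → iδ (suc k) * (1# - Q * Q ^ k) ≈ iδ k
      δ-suc k k<m = inverse-suc (δ-inv k (ℕ.<⇒≤ k<m)) (δ-inv (suc k) k<m)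

      β-suc : ∀ k → k ℕ.< m → iβ (suc k) * (1# - (Q * b′) * Q ^ k) ≈ iβ k
      β-suc k k<m = inverse-suc (β-inv k (ℕ.<⇒≤ k<m)) (β-inv (suc k) k<m)

      u-suc : ∀ k → k ℕ.< m → u (suc k) * (IS.M (Q * Q ^ k) * ((1# - Q * Q ^ k) * (1# - Q * Q ^ k)))
                             ≈ u k * (IS.N (Q ^ k) * ((1# - q * Q ^ k) * (1# - q * Q ^ k)))
      u-suc k k<m = begin
        (A k * p₁) * (A′ k * p₂) * ((D k * p₃) * (D k * p₃)) * (iα (suc k) * iα′ (suc k) * (iδ (suc k) * iδ (suc k))) * (IS.M (Q * Q ^ k) * (d₃ * d₃))
          ≈⟨ *-congˡ (*-congʳ ((+-congˡ (-‿cong (sym (*-assoc a Q (Q ^ k))))) ⟨*⟩ (+-congˡ (-‿cong (trans (sym (*-assoc a′ Q (Q ^ k))) (*-congʳ (*-comm a′ Q))))))) ⟩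
        (A k * p₁) * (A′ k * p₂) * ((D k * p₃) * (D k * p₃)) * (iα (suc k) * iα′ (suc k) * (iδ (suc k) * iδ (suc k))) * ((d₁ * d₂) * (d₃ * d₃))
          ≈⟨ solve 12 (λ A p B r D s i j l d e f → (A :* p) :* (B :* r) :* ((D :* s) :* (D :* s)) :* (i :* j :* (l :* l)) :* ((d :* e) :* (f :* f))
               := A :* B :* (D :* D) :* ((i :* d) :* (j :* e) :* ((l :* f) :* (l :* f))) :* ((p :* r) :* (s :* s)))
               refl (A k) p₁ (A′ k) p₂ (D k) p₃ (iα (suc k)) (iα′ (suc k)) (iδ (suc k)) d₁ d₂ d₃ ⟩
        A k * A′ k * (D k * D k) * ((iα (suc k) * d₁) * (iα′ (suc k) * d₂) * ((iδ (suc k) * d₃) * (iδ (suc k) * d₃))) * ((p₁ * p₂) * (p₃ * p₃))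
          ≈⟨ *-congˡ (inverse-suc (α-inv k (ℕ.<⇒≤ k<m)) (α-inv (suc k) k<m) ⟨*⟩ inverse-suc (α′-inv k (ℕ.<⇒≤ k<m)) (α′-inv (suc k) k<m) ⟨*⟩ (δ-suc k k<m ⟨*⟩ δ-suc k k<m))
             ⟨*⟩ (((+-congˡ (-‿cong (*-assoc a q (Q ^ k)))) ⟨*⟩ (+-congˡ (-‿cong (trans (*-congʳ (*-comm q a′)) (*-assoc a′ q (Q ^ k)))))) ⟨*⟩ refl) ⟩
        _ ∎
        where
        p₁ = 1# - a * q * Q ^ k
        p₂ = 1# - q * a′ * Q ^ k
        p₃ = 1# - q * Q ^ k
        d₁ = 1# - a * Q * Q ^ k
        d₂ = 1# - Q * a′ * Q ^ k
        d₃ = 1# - Q * Q ^ k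

      X-suc : ∀ k → k ℕ.< m → X (suc k) * SZ.α (Q ^ k) ≈ X k * SZ.β (Q ^ k)
      X-suc k k<m = begin
        (B k * (1# - b * q * y)) * (D k * (1# - q * y)) * (iβ (suc k) * iδ (suc k)) * (q * b′ * e) * ((1# - q * (q * y) * b′) * (1# - q * (q * y)))
          ≈⟨ solve 9 (λ q y b c B D i j e → (B :* (:1 :- b :* q :* y)) :* (D :* (:1 :- q :* y)) :* (i :* j) :* (q :* c :* e) :* ((:1 :- q :* (q :* y) :* c) :* (:1 :- q :* (q :* y)))
               := B :* D :* ((i :* (:1 :- ((q :* q) :* c) :* y)) :* (j :* (:1 :- (q :* q) :* y))) :* e :* ((:1 :- b :* (q :* y)) :* (:1 :- q :* y) :* (q :* c)))
               refl q y b b′ (B k) (D k) (iβ (suc k)) (iδ (suc k)) e ⟩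
        B k * D k * ((iβ (suc k) * (1# - Q * b′ * y)) * (iδ (suc k) * (1# - Q * y))) * e * SZ.β y
          ≈⟨ *-congʳ (*-congʳ (*-congˡ (β-suc k k<m ⟨*⟩ δ-suc k k<m))) ⟩
        _ ∎
        where y = Q ^ k
              e = (q * b′) ^ k

      w-suc : ∀ j → j ℕ.< m → w (suc j) * ((1# - Q * Q ^ j) * (1# - Q * Q ^ j) * (1# - Q * Q ^ j * b′)) ≈ w j * ((1# - q * Q ^ j * b′) * Q)
      w-suc j j<m = begin
        (E j * (1# - q * b′ * z)) * (Q * z) * (iβ (suc j) * (iδ (suc j) * iδ (suc j))) * (d * d * (1# - Q * z * b′))
          ≈⟨ solve 8 (λ E q c z Q i l d → (E :* (:1 :- q :* c :* z)) :* (Q :* z) :* (i :* (l :* l)) :* (d :* d :* (:1 :- Q :* z :* c))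
               := E :* z :* ((i :* (:1 :- Q :* c :* z)) :* ((l :* d) :* (l :* d))) :* ((:1 :- q :* z :* c) :* Q))
               refl (E j) q b′ z Q (iβ (suc j)) (iδ (suc j)) d ⟩
        E j * z * ((iβ (suc j) * (1# - Q * b′ * z)) * ((iδ (suc j) * d) * (iδ (suc j) * d))) * ((1# - q * z * b′) * Q)
          ≈⟨ *-congʳ (*-congˡ (β-suc j j<m ⟨*⟩ (δ-suc j j<m ⟨*⟩ δ-suc j j<m))) ⟩
        _ ∎
        where z = Q ^ j
              d = 1# - Q * z

      v-suc : ∀ j → j ℕ.< m → v (suc j) * (1# - Q * Q ^ j) ≈ v j * (IS.N (Q ^ j) * (1# - q * Q ^ j))
      v-suc j j<m = begin
        (A j * (1# - a * q * z)) * (A′ j * (1# - q * a′ * z)) * (D j * (1# - q * z)) * iδ (suc j) * d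
          ≈⟨ solve 9 (λ A B D a q c z i d → (A :* (:1 :- a :* q :* z)) :* (B :* (:1 :- q :* c :* z)) :* (D :* (:1 :- q :* z)) :* i :* d
               := A :* B :* D :* (i :* d) :* ((:1 :- a :* (q :* z)) :* (:1 :- c :* (q :* z)) :* (:1 :- q :* z)))
               refl (A j) (A′ j) (D j) a q a′ z (iδ (suc j)) d ⟩
        A j * A′ j * D j * (iδ (suc j) * d) * (IS.N z * (1# - q * z)) ≈⟨ *-congʳ (*-congˡ (δ-suc j j<m)) ⟩
        _ ∎
        where z = Q ^ j
              d = 1# - Q * z

      -- The factors of `α` are the last factors of invertible Pochhammer symbols, so the shorter
      -- symbol times the inverse of the longer one inverts each.
      α-unit : ∀ k → k ℕ.< m → SZ.α (Q ^ k) * ((pochR (Q * b′) Q k * iβ (suc k)) * (pochR Q Q k * iδ (suc k))) ≈ 1#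
      α-unit k k<m = trans (solve 7 (λ q c y p i r j → ((:1 :- q :* (q :* y) :* c) :* (:1 :- q :* (q :* y))) :* ((p :* i) :* (r :* j))
          := (p :* (:1 :- (q :* q) :* c :* y) :* i) :* (r :* (:1 :- (q :* q) :* y) :* j)) refl q b′ (Q ^ k) _ _ _ _)
        (trans (β-inv (suc k) k<m ⟨*⟩ δ-inv (suc k) k<m) (*-identityˡ 1#))

      1-Q-unit : ∀ k → k ℕ.< m → (1# - Q * Q ^ k) * (pochR Q Q k * iδ (suc k)) ≈ 1#
      1-Q-unit k k<m = trans (solve 3 (λ d p i → d :* (p :* i) := p :* d :* i) refl _ _ _) (δ-inv (suc k) k<m)

      X≈ : ∀ k → k ℕ.≤ m → X k ≈ sum (suc m) (λ j → P j k * w j)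
      X≈ = SZ.saalschütz m w w-suc X _ X-0 X-suc α-unit
        where
        iδ₀≈1 : iδ 0 ≈ 1#
        iδ₀≈1 = trans (sym (*-identityˡ _)) (δ-inv 0 z≤n)
        X-0 : X 0 ≈ w 0
        X-0 = trans (solve 2 (λ i j → :1 :* :1 :* (i :* j) :* :1 := :1 :* :1 :* (i :* (j :* :1))) refl (iβ 0) (iδ 0))
          (*-congˡ (*-congˡ (*-congˡ (sym iδ₀≈1))))

      -- The part common to the three cases. The specialisation enters through `end`, which removes
      -- the boundary term, and `base`, the value of the last inner sum cleared of denominators. The
      -- factor `1# - q` turns q-integers into 1 - q^k.
      transformation :
        (end : IS.N (Q ^ m) * (1# - q * Q ^ m) ≈ 0#) →
        (unit : ℕ → Carrier) → (∀ j → j ℕ.< m → IS.N (Q ^ j) * (1# - q * Q ^ j) * unit j ≈ 1#) →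
        (base : (1# - q * (Q ^ m * Q ^ m)) * P m m * D m ≈ (1# - q * Q ^ m) * q′ ^ m * (pochR (a * Q) Q m * pochR (Q * a′) Q m * pochR Q Q m)) →
        (1# - q) * LHSR ≈ (1# - q) * RHSR
      transformation end unit N-unit base = begin
        (1# - q) * LHSR ≈⟨ sum-*ˡ (suc m) (1# - q) lhsTermR ⟨
        sum (suc m) (λ k → (1# - q) * lhsTermR k) ≈⟨ sum-cong (suc m) (λ k k≤m → trans (lhs-term k) (*-congˡ (X≈ k (ℕ.≤-pred k≤m)))) ⟩
        sum (suc m) (λ k → t k * sum (suc m) (λ j → P j k * w j))
          ≈⟨ sum-cong (suc m) (λ k _ → sym (sum-*ˡ (suc m) (t k) (λ j → P j k * w j))) ⟩
        sum (suc m) (λ k → sum (suc m) (λ j → t k * (P j k * w j))) ≈⟨ sum-swap (suc m) (suc m) (λ k j → t k * (P j k * w j)) ⟩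
        sum (suc m) (λ j → sum (suc m) (λ k → t k * (P j k * w j)))
          ≈⟨ sum-cong (suc m) (λ j _ → trans (sum-cong (suc m) (λ k _ → sym (*-assoc (t k) (P j k) (w j)))) (sum-*ʳ (suc m) (w j) (IS.term j))) ⟩
        sum (suc m) (λ j → IS.S j * w j)
          ≈⟨ sum-cong (suc m) (λ j j≤m → *-congʳ {w j} (IS.S-closed u-suc _ 1-Q-unit end v c v-suc unit N-unit S-m (m ℕ.∸ j) j (ℕ.m∸n+n≡m (ℕ.≤-pred j≤m)))) ⟩
        sum (suc m) (λ j → c * v j * w j) ≈⟨ sum-cong (suc m) (λ j _ → rhs-term j) ⟩
        sum (suc m) (λ j → c * rhsTermR j) ≈⟨ sum-*ˡ (suc m) c rhsTermR ⟩
        (1# - q * Q ^ m) * q′ ^ m * sum (suc m) rhsTermR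
          ≈⟨ *-congʳ (*-cong (trans (+-congˡ (-‿cong (sym (q^2k+1 m)))) (sym (qint-geometric (2 ℕ.* m ℕ.+ 1)))) (sym (*-identityˡ _))) ⟩
        (1# - q) * qintR (2 ℕ.* m ℕ.+ 1) * (1# * q′ ^ m) * sum (suc m) rhsTermR
          ≈⟨ solve 4 (λ x y z t → x :* y :* z :* t := x :* (y :* z :* t)) refl _ _ _ _ ⟩
        (1# - q) * RHSR ∎
        where
        c = (1# - q * Q ^ m) * q′ ^ m
        t : ℕ → Carrier
        t k = (1# - q * (Q ^ k * Q ^ k)) * u k
        lhs-term : ∀ k → (1# - q) * lhsTermR k ≈ t k * X k
        lhs-term k = trans (solve 11 (λ r n A B C D i j l o e → r :* (n :* ((A :* B :* C :* (D :* (D :* (D :* :1)))) :* (i :* j :* l :* (o :* (o :* (o :* :1))))) :* e)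
             := (r :* n) :* (A :* B :* (D :* D) :* (i :* j :* (o :* o))) :* (C :* D :* (l :* o) :* e)) refl
             (1# - q) (qintR (4 ℕ.* k ℕ.+ 1)) (A k) (A′ k) (B k) (D k) (iα k) (iα′ k) (iβ k) (iδ k) ((q * b′) ^ k))
          (*-congʳ (*-congʳ (trans (qint-geometric (4 ℕ.* k ℕ.+ 1)) (+-congˡ (-‿cong (q^4k+1 k))))))
        rhs-term : ∀ j → c * v j * w j ≈ c * rhsTermR j
        rhs-term j = trans (solve 8 (λ c A B D o E z i → c :* (A :* B :* D :* o) :* (E :* z :* (i :* (o :* o)))
             := c :* ((A :* B :* E :* D) :* (i :* (o :* (o :* (o :* :1)))) :* z)) refl c (A j) (A′ j) (D j) (iδ j) (E j) (Q ^ j) (iβ j))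
          (*-congˡ (*-congˡ (sym (q^2k j))))
        S-m : IS.S m ≈ c * v m
        S-m = begin
          IS.S m ≈⟨ sum-snoc m (IS.term m) ⟩
          sum m (IS.term m) + IS.term m m
            ≈⟨ +-congʳ (sum-zero m (λ k k<m → trans (*-congˡ (P-vanish m k k<m)) (zeroʳ _))) ⟩
          0# + IS.term m m ≈⟨ +-identityˡ _ ⟩
          (1# - q * (Q ^ m * Q ^ m)) * u m * P m m
            ≈⟨ solve 8 (λ f A B D i j o p → f :* (A :* B :* (D :* D) :* (i :* j :* (o :* o))) :* p := (f :* p :* D) :* (A :* B :* D :* (i :* j :* o) :* o))
                 refl (1# - q * (Q ^ m * Q ^ m)) (A m) (A′ m) (D m) (iα m) (iα′ m) (iδ m) (P m m) ⟩
          (1# - q * (Q ^ m * Q ^ m)) * P m m * D m * (A m * A′ m * D m * (iα m * iα′ m * iδ m) * iδ m) ≈⟨ *-congʳ base ⟩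
          c * (pochR (a * Q) Q m * pochR (Q * a′) Q m * pochR Q Q m) * (A m * A′ m * D m * (iα m * iα′ m * iδ m) * iδ m)
            ≈⟨ solve 10 (λ c x y z A B D i j o → c :* (x :* y :* z) :* (A :* B :* D :* (i :* j :* o) :* o) := c :* (A :* B :* D :* o) :* ((x :* i) :* (y :* j) :* (z :* o)))
                 refl c _ _ _ (A m) (A′ m) (D m) (iα m) (iα′ m) (iδ m) ⟩
          c * v m * ((pochR (a * Q) Q m * iα m) * (pochR (Q * a′) Q m * iα′ m) * (pochR Q Q m * iδ m))
            ≈⟨ *-congˡ (trans (α-inv m ℕ.≤-refl ⟨*⟩ α′-inv m ℕ.≤-refl ⟨*⟩ δ-inv m ℕ.≤-refl) (trans (*-identityʳ _) (*-identityʳ _))) ⟩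
          c * v m * 1# ≈⟨ *-identityʳ _ ⟩
          c * v m ∎

      -- Here n = 1 and `1# - q` may be zero, so it cannot be cancelled; both sides are simply 1.
      degenerate : m ≡ 0 → LHSR ≈ RHSR
      degenerate m≡0 = begin
        LHSR ≡⟨ ≡.cong (λ k → sum (suc k) lhsTermR) m≡0 ⟩
        lhsTermR 0 + 0# ≈⟨ +-congʳ lhs₀ ⟩
        1# + 0# ≈⟨ solve 0 (:1 :+ :0 := (:0 :+ :1) :* (:1 :* :1) :* (:1 :+ :0)) refl ⟩
        qintR 1 * (1# * q′ ^ 0) * (1# + 0#) ≈⟨ *-congˡ (+-congʳ rhs₀) ⟨
        qintR 1 * (1# * q′ ^ 0) * (rhsTermR 0 + 0#)
          ≡⟨ ≡.cong (λ k → qintR (2 ℕ.* k ℕ.+ 1) * (1# * q′ ^ k) * sum (suc k) rhsTermR) (≡.sym m≡0) ⟩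
        RHSR ∎
        where
        :0 : Polynomial 0
        :0 = con (ℤ.+ 0)
        β₀≈1 : iβ 0 ≈ 1#
        β₀≈1 = trans (sym (*-identityˡ _)) (β-inv 0 z≤n)
        δ₀≈1 : iδ 0 ^ 3 ≈ 1#
        δ₀≈1 = trans (^-cong 3 (trans (sym (*-identityˡ _)) (δ-inv 0 z≤n))) (1^ 3)
        αα′≈1 : iα 0 * iα′ 0 ≈ 1#
        αα′≈1 = trans (*-cong (trans (sym (*-identityˡ _)) (α-inv 0 z≤n)) (trans (sym (*-identityˡ _)) (α′-inv 0 z≤n))) (*-identityˡ 1#)
        lhs₀ : lhsTermR 0 ≈ 1#
        lhs₀ = trans (*-congʳ (*-cong (+-identityˡ 1#) (*-cong (trans (*-congˡ (1^ 3)) (solve 0 (:1 :* :1 :* :1 :* :1 := :1) refl))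
                 (trans (*-cong (trans (*-cong αα′≈1 β₀≈1) (*-identityˡ 1#)) δ₀≈1) (*-identityˡ 1#)))))
          (solve 0 (:1 :* (:1 :* :1) :* :1 := :1) refl)
        rhs₀ : rhsTermR 0 ≈ 1#
        rhs₀ = trans (*-congʳ (*-congˡ (*-cong β₀≈1 δ₀≈1))) (solve 0 ((:1 :* :1 :* :1 :* :1) :* (:1 :* :1) :* :1 := :1) refl)

    -- The factor in front extends the second symbol of `P m m` to length `suc m`; splitting off the
    -- first factor instead of the last one gives the right-hand side.
    P-diagonal : ∀ m → (1# - q * (Q ^ m * Q ^ m)) * P m m ≈ (1# - q * Q ^ m) * (pochR (Q′ ^ m) Q m * pochR (q * Q ^ m * Q) Q m)
    P-diagonal m = begin
      (1# - q * (Q ^ m * Q ^ m)) * (pochR (Q′ ^ m) Q m * pochR x Q m)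
        ≈⟨ solve 4 (λ q y p r → (:1 :- q :* (y :* y)) :* (p :* r) := p :* (r :* (:1 :- q :* y :* y))) refl q (Q ^ m) _ _ ⟩
      pochR (Q′ ^ m) Q m * pochR x Q (suc m) ≈⟨ *-congˡ (poch-suc x Q m) ⟩
      pochR (Q′ ^ m) Q m * ((1# - x) * pochR (x * Q) Q m)
        ≈⟨ solve 3 (λ p d r → p :* (d :* r) := d :* (p :* r)) refl _ _ _ ⟩
      _ ∎
      where x = q * Q ^ m

    -- Both sides carry the factor 1 - q^n, so `base` reads 0 = 0: in this case the inner sums
    -- vanish together with (1-q)[n].
    base-root-of-unity : ∀ m {z w} → q * Q ^ m ≈ 1# →
      (1# - q * (Q ^ m * Q ^ m)) * P m m * z ≈ (1# - q * Q ^ m) * q′ ^ m * w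
    base-root-of-unity m e = trans (*-congʳ (trans (P-diagonal m) (trans (*-congʳ vanish) (zeroˡ _))))
      (trans (zeroˡ _) (sym (trans (*-congʳ (trans (*-congʳ vanish) (zeroˡ _))) (zeroˡ _))))
      where
      vanish : 1# - q * Q ^ m ≈ 0#
      vanish = trans (+-congˡ (-‿cong e)) (-‿inverseʳ 1#)

    -- Reversal of the order of factors, one step being (1-Q^(-m-1))(1-qQ^m) = q^(-1)
    -- (1-q^(-1)Q^(-m))(1-Q^(m+1)). The accumulated powers of `q′` are the q^((1-n)/2) of the
    -- theorem.
    half-integer-reflection : ∀ m → pochR (Q′ ^ m) Q m * pochR q Q m ≈ q′ ^ m * (pochR (q′ * Q′ ^ m * Q) Q m * pochR Q Q m)
    half-integer-reflection ℕ.zero = sym (*-identityˡ _)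
    half-integer-reflection (suc m) = begin
      pochR (Q′ ^ suc m) Q (suc m) * (pochR q Q m * (1# - q * y))
        ≈⟨ *-congʳ (trans (poch-suc (Q′ ^ suc m) Q m) (*-congˡ (poch-cong Q m (Q′^suc-Q m)))) ⟩
      (1# - Q′ * y′) * pochR (Q′ ^ m) Q m * (pochR q Q m * (1# - q * y))
        ≈⟨ solve 4 (λ c p r d → c :* p :* (r :* d) := (c :* d) :* (p :* r)) refl _ _ _ _ ⟩
      (1# - Q′ * y′) * (1# - q * y) * (pochR (Q′ ^ m) Q m * pochR q Q m) ≈⟨ *-cong lem (half-integer-reflection m) ⟩
      q′ * ((1# - q′ * y′) * (1# - Q * y)) * (q′ ^ m * (pochR (q′ * y′ * Q) Q m * pochR Q Q m))
        ≈⟨ solve 6 (λ i c d e p r → i :* (c :* d) :* (e :* (p :* r)) := (i :* e) :* ((c :* p) :* (r :* d))) refl _ _ _ _ _ _ ⟩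
      q′ ^ suc m * (((1# - q′ * y′) * pochR (q′ * y′ * Q) Q m) * pochR Q Q (suc m))
        ≈⟨ *-congˡ (*-congʳ (trans (sym (poch-suc (q′ * y′) Q m)) (poch-cong Q (suc m) (sym shift)))) ⟩
      _ ∎
      where
      y = Q ^ m
      y′ = Q′ ^ m
      shift : q′ * Q′ ^ suc m * Q ≈ q′ * y′
      shift = trans (*-assoc _ _ _) (*-congˡ (Q′^suc-Q m))
      lem : (1# - Q′ * y′) * (1# - q * y) ≈ q′ * ((1# - q′ * y′) * (1# - Q * y))
      lem = begin
        (1# - Q′ * y′) * (1# - q * y)
          ≈⟨ solve 4 (λ q i y v → (:1 :- (i :* i) :* v) :* (:1 :- q :* y) := :1 :- q :* y :- (i :* i) :* v :+ (q :* i) :* i :* (y :* v)) refl q q′ y y′ ⟩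
        1# - q * y - Q′ * y′ + (q * q′) * q′ * (y * y′)
          ≈⟨ +-congˡ (*-congʳ qq′≈1 ⟨*⟩ Q^Q′^ m) ⟩
        1# - q * y - Q′ * y′ + 1# * q′ * 1#
          ≈⟨ solve 4 (λ q i y v → :1 :- q :* y :- (i :* i) :* v :+ :1 :* i :* :1 := i :- (:1 :* q) :* y :- (i :* i) :* v :+ (:1 :* :1) :* :1) refl q q′ y y′ ⟩
        q′ - (1# * q) * y - Q′ * y′ + (1# * 1#) * 1#
          ≈⟨ +-cong (+-congʳ (refl ⟨-⟩ (*-congʳ (*-congʳ (sym qq′≈1))))) ((sym qq′≈1 ⟨*⟩ sym qq′≈1) ⟨*⟩ sym (Q^Q′^ m)) ⟩
        q′ - ((q * q′) * q) * y - Q′ * y′ + ((q * q′) * (q * q′)) * (y * y′)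
          ≈⟨ solve 4 (λ q i y v → i :- ((q :* i) :* q) :* y :- (i :* i) :* v :+ ((q :* i) :* (q :* i)) :* (y :* v)
               := i :* ((:1 :- i :* v) :* (:1 :- (q :* q) :* y))) refl q q′ y y′ ⟩
        _ ∎

    base-terminating : ∀ m {a a′} → a ≈ q * Q ^ m → a′ ≈ q′ * Q′ ^ m →
      (1# - q * (Q ^ m * Q ^ m)) * P m m * pochR q Q m ≈ (1# - q * Q ^ m) * q′ ^ m * (pochR (a * Q) Q m * pochR (Q * a′) Q m * pochR Q Q m)
    base-terminating m {a} {a′} e e′ = begin
      (1# - q * (Q ^ m * Q ^ m)) * P m m * pochR q Q m ≈⟨ *-congʳ (P-diagonal m) ⟩
      (1# - q * Q ^ m) * (pochR (Q′ ^ m) Q m * x) * pochR q Q m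
        ≈⟨ solve 4 (λ d p x r → d :* (p :* x) :* r := d :* x :* (p :* r)) refl _ _ _ _ ⟩
      (1# - q * Q ^ m) * x * (pochR (Q′ ^ m) Q m * pochR q Q m) ≈⟨ *-congˡ (half-integer-reflection m) ⟩
      (1# - q * Q ^ m) * x * (q′ ^ m * (y * pochR Q Q m))
        ≈⟨ solve 5 (λ d x i y r → d :* x :* (i :* (y :* r)) := d :* i :* (x :* y :* r)) refl _ _ _ _ _ ⟩
      (1# - q * Q ^ m) * q′ ^ m * (x * y * pochR Q Q m)
        ≈⟨ *-congˡ (*-congʳ (poch-cong Q m (*-congʳ (sym e)) ⟨*⟩ poch-cong Q m (trans (*-congʳ (sym e′)) (*-comm a′ Q)))) ⟩
      _ ∎
      where x = pochR (q * Q ^ m * Q) Q m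
            y = pochR (q′ * Q′ ^ m * Q) Q m

-- Divisibility among the elements x^n - 1.

module CyclotomicDivisibility (R : CommutativeRing 0ℓ 0ℓ) (D : IsGCDDomain R) (x : CommutativeRing.Carrier R) where
  open CommutativeRing R
  import Data.Nat.Divisibility as ℕ
  open import Data.Nat.GCD using (module Bézout; gcd; gcd-GCD; gcd[m,n]∣m; gcd[m,n]∣n)
  open import Data.List.Relation.Unary.All as All using (All; []; _∷_)
  open import Data.List.Relation.Unary.AllPairs using (AllPairs; []; _∷_)
  open import Data.List.Relation.Unary.Any using (here; there)
  open import Data.List.Membership.Propositional using (_∈_)
  open Eval using (module Power)
  open Divisibility R
  open IntSolver R
  open Power R
  open GCDProperties R D

  geometric : Carrier → ℕ → Carrier
  geometric y ℕ.zero = 0#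
  geometric y (suc k) = y * geometric y k + 1#

  geometric-sum : ∀ y k → (y - 1#) * geometric y k ≈ y ^ k - 1#
  geometric-sum y ℕ.zero = trans (zeroʳ _) (sym (-‿inverseʳ 1#))
  geometric-sum y (suc k) = trans (solve 2 (λ y g → (y :- :1) :* (y :* g :+ :1) := y :* ((y :- :1) :* g) :+ (y :- :1)) refl y (geometric y k))
    (trans (+-congʳ (*-congˡ (geometric-sum y k))) (solve 2 (λ y p → y :* (p :- :1) :+ (y :- :1) := y :* p :- :1) refl y (y ^ k)))

  E : ℕ → Carrier
  E n = x ^ n - 1#

  E-+ : ∀ m n → E (m ℕ.+ n) ≈ x ^ m * E n + E m
  E-+ m n = trans (+-congʳ (^-+ x m n)) (solve 2 (λ y z → y :* z :- :1 := y :* (z :- :1) :+ (y :- :1)) refl (x ^ m) (x ^ n))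

  E-* : ∀ k d → E d * geometric (x ^ d) k ≈ E (k ℕ.* d)
  E-* k d = trans (geometric-sum (x ^ d) k) (+-congʳ (sym (^-* x k d)))

  E-∣ : ∀ {d n} → d ℕ.∣ n → E d ∣ E n
  E-∣ {d} (ℕ.divides k ≡.refl) = divides (geometric (x ^ d) k) (E-* k d)

  regular-* : ∀ {h k g} → RegularMod h g → RegularMod k g → RegularMod (h * k) g
  regular-* r s d = s (r (∣-resp (*-assoc _ _ _) d))

  regular-∣ : ∀ {h k g} → h ∣ k → RegularMod k g → RegularMod h g
  regular-∣ {h} {k} h∣k r {y} d = r (∣-trans d (*-mono-∣ h∣k (∣-refl {y})))

  product : (ℕ → Carrier) → List ℕ → Carrier
  product F L = foldr _*_ 1# (map F L)

  ∣-product : ∀ F {d L} → d ∈ L → F d ∣ product F L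
  ∣-product F (here ≡.refl) = x∣xy _ _
  ∣-product F (there d∈L) = ∣-*ˡ _ (∣-product F d∈L)

  -- If `N` is the product over the tail times `c`, then `F d` divides that multiple, and since each
  -- later factor is regular modulo `F d`, it divides `c`.
  product-∣ : ∀ F L {N} → AllPairs (λ d e → RegularMod (F e) (F d)) L → All (λ d → F d ∣ N) L → product F L ∣ N
  product-∣ F [] _ _ = 1∣
  product-∣ F (d ∷ L) {N} (p ∷ ps) (Fd∣N ∷ ds) with product-∣ F L ps ds
  ... | divides c e = ∣-resp e (∣-resp (*-comm c (product F L)) (*-mono-∣ Fd∣c (∣-refl {product F L})))
    where
    regular-product : ∀ L → All (λ e → RegularMod (F e) (F d)) L → RegularMod (product F L) (F d)
    regular-product [] [] = ∣-resp (*-identityˡ _)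
    regular-product (e ∷ L) (r ∷ rs) = regular-* r (regular-product L rs)
    Fd∣c : F d ∣ c
    Fd∣c = regular-product L p (∣-resp (sym e) Fd∣N)

  module _ (nat : ℕ → Carrier) (nat-zero : nat 0 ≈ 0#) (nat-suc : ∀ k → nat (suc k) ≈ 1# + nat k)
           (E≉0 : ∀ d → ¬ E (suc d) ≈ 0#) where

    geometric-mod : ∀ y k → y - 1# ∣ geometric y k - nat k
    geometric-mod y ℕ.zero = ∣-resp (sym (trans (+-congˡ (-‿cong nat-zero)) (-‿inverseʳ 0#))) ∣0
    geometric-mod y (suc k) = ∣-resp
      (trans (solve 3 (λ y g m → (y :- :1) :* g :+ (g :- m) := (y :* g :+ :1) :- (:1 :+ m)) refl y (geometric y k) (nat k)) (+-congˡ (-‿cong (sym (nat-suc k)))))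
      (∣-+ (x∣xy _ _) (geometric-mod y k))

    -- Bézout reduces E i to E d with d = gcd i n, and (x^n - 1)/(x^d - 1) ≡ n/d modulo x^d - 1.
    E-regular : ∀ n Φ → ℕ.NonZero n → Φ ∣ E n → (∀ d → d ℕ.< n → d ℕ.∣ n → E d * Φ ∣ E n) → (∀ k → ℕ.NonZero k → RegularMod (nat k) Φ) →
      ∀ i → ℕ.NonZero i → i ℕ.< n → RegularMod (E i) Φ
    E-regular n Φ n≢0 Φ∣E Ed∣ nat-reg i i≢0 i<n {t} Φ∣Et = conclusion
      where
      d = gcd i n
      d∣n = gcd[m,n]∣n i n
      tE : ∀ {m k} → m ℕ.∣ k → Φ ∣ t * E m → Φ ∣ t * E k
      tE m∣k p = ∣-trans p (*-mono-∣ (∣-refl {t}) (E-∣ m∣k))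
      Ei : Φ ∣ t * E i
      Ei = ∣-resp (*-comm _ _) Φ∣Et
      step : ∀ u w → d ℕ.+ u ≡ w → Φ ∣ t * E u → Φ ∣ t * E w → Φ ∣ t * E d
      step u _ ≡.refl p r = ∣-cancel-+ {x = t * (x ^ d * E u)}
        (∣-resp (trans (*-congˡ (E-+ d u)) (distribˡ _ _ _)) r)
        (∣-resp (solve 3 (λ t y e → y :* (t :* e) := t :* (y :* e)) refl t (x ^ d) (E u)) (∣-*ˡ (x ^ d) p))
      Φ∣tEd : Φ ∣ t * E d
      Φ∣tEd with Bézout.identity (gcd-GCD i n)
      ... | Bézout.+- u w e = step (w ℕ.* n) (u ℕ.* i) e (∣-*ˡ t (∣-trans Φ∣E (E-∣ (ℕ.n∣m*n w)))) (tE (ℕ.n∣m*n u) Ei)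
      ... | Bézout.-+ u w e = step (u ℕ.* i) (w ℕ.* n) e (tE (ℕ.n∣m*n u) Ei) (∣-*ˡ t (∣-trans Φ∣E (E-∣ (ℕ.n∣m*n w))))
      d≤i : d ℕ.≤ i
      d≤i = ℕ.∣⇒≤ ⦃ i≢0 ⦄ (gcd[m,n]∣m i n)
      conclusion : Φ ∣ t
      conclusion with d∣n | Ed∣ d (ℕ.≤-<-trans d≤i i<n) d∣n
      ... | ℕ.divides k n≡kd | divides h e = nat-reg k k≢0 (∣-resp (*-comm t (nat k)) Φ∣tk)
        where
        k≢0 : ℕ.NonZero k
        k≢0 = ℕ.≢-nonZero λ { ≡.refl → ℕ.≢-nonZero⁻¹ n ⦃ n≢0 ⦄ n≡kd }
        Ed≉0 : ¬ E d ≈ 0#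
        Ed≉0 with d in eq
        ... | ℕ.zero = λ _ → ℕ.≢-nonZero⁻¹ n ⦃ n≢0 ⦄ (≡.trans n≡kd (ℕ.*-zeroʳ k))
        ... | suc d′ = E≉0 d′
        G = geometric (x ^ d) k
        Φ∣G : Φ ∣ G
        Φ∣G = divides h (*-cancel Ed≉0 (trans (sym (*-assoc _ _ _)) (trans e (trans (reflexive (≡.cong E n≡kd)) (sym (E-* k d))))))
        Φ∣tk : Φ ∣ t * nat k
        Φ∣tk = ∣-resp (solve 3 (λ t g m → t :* g :+ (:- (t :* (g :- m))) := t :* m) refl t G (nat k))
          (∣-+ (∣-*ˡ t Φ∣G) (∣-neg (∣-trans Φ∣tEd (*-mono-∣ (∣-refl {t}) (geometric-mod (x ^ d) k)))))

-- Correctness of the computed cyclotomic polynomials.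

module Cyclotomic where
  open import Data.Bool using (true; false; T)
  open import Data.Nat using (_≤ᵇ_)
  import Data.Nat.Divisibility as ℕ
  open import Data.Nat.Induction using (<-rec)
  open import Data.List using (reverse; applyUpTo)
  open import Data.List.Properties using (length-map; length-reverse; reverse-involutive; unfold-reverse; reverse-++; map-cong-local; length-++; map-cong; map-id)
  open import Data.List.Relation.Unary.All as All using (All; []; _∷_)
  import Data.List.Relation.Unary.All.Properties as All
  open import Data.List.Relation.Unary.AllPairs using (AllPairs; []; _∷_)
  import Data.List.Relation.Unary.AllPairs.Properties as AllPairs
  import Data.List.Relation.Unary.AllPairs as AllPairs
  open import Data.List.Membership.Propositional using (_∈_)
  open import Data.List.Membership.Propositional.Properties using (∈-filter⁺; ∈-applyUpTo⁺)
  open import Data.Unit using (tt)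
  open Tower
  open Eval using (module Power)

  open U₁ using (_≋_; at≈; _at_; add; mul; scale; const; neg; ≋-refl; ≋-sym; ≋-trans; add-cong; mul-congˡ; mul-congʳ)
  open V₁ using (X; shift)
  module Z = CommutativeRing ℤ[q]
  module ZD = Divisibility ℤ[q]
  module ZS = IntSolver ℤ[q]
  module C = CyclotomicDivisibility ℤ[q] G₁.polyIsGCDDomain X
  open Power ℤ[q] using () renaming (_^_ to _^Z_)
  open GCDProperties ℤ[q] G₁.polyIsGCDDomain using (regularMod-sym)

  addU≡add : ∀ p r → addU p r ≡ add p r
  addU≡add [] r = ≡.refl
  addU≡add (x ∷ p) [] = ≡.refl
  addU≡add (x ∷ p) (y ∷ r) = ≡.cong (x ℤ.+ y ∷_) (addU≡add p r)

  mulU≡mul : ∀ p r → mulU p r ≡ mul p r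
  mulU≡mul [] r = ≡.refl
  mulU≡mul (c ∷ p) r = ≡.trans (addU≡add (map (c ℤ.*_) r) (0ℤ ∷ mulU p r)) (≡.cong (λ s → add (map (c ℤ.*_) r) (0ℤ ∷ s)) (mulU≡mul p r))

  -- A condition on the list itself, not up to `≋`: `divU` discards the last entry of the divisor on
  -- the assumption that it is the leading 1, so trailing zeros must be excluded.
  MonicOfDegree : ℕ → List ℤ → Set
  MonicOfDegree k p = Σ (List ℤ) λ r → p ≡ r ++ [ 1ℤ ] × length r ≡ k

  add-short-monic : ∀ {k} p r → length p ℕ.≤ k → MonicOfDegree k r → MonicOfDegree k (add p r)
  add-short-monic {k} p _ le (r , ≡.refl , ≡.refl) = go p r le
    where
    go : ∀ p r → length p ℕ.≤ length r → MonicOfDegree (length r) (add p (r ++ [ 1ℤ ]))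
    go [] r _ = r , ≡.refl , ≡.refl
    go (x ∷ p) (y ∷ r) (s≤s le) with go p r le
    ... | s , e , l = x ℤ.+ y ∷ s , ≡.cong (x ℤ.+ y ∷_) e , ≡.cong suc l

  mul-monic : ∀ {j k p r} → MonicOfDegree j p → MonicOfDegree k r → MonicOfDegree (j ℕ.+ k) (mul p r)
  mul-monic {k = k} {r = r} (p , ≡.refl , ≡.refl) (s , e , l) = go p
    where
    go : ∀ p → MonicOfDegree (length p ℕ.+ k) (mul (p ++ [ 1ℤ ]) r)
    -- The product ends with the addition of `[ 0ℤ ]`, which does not change a nonempty list.
    go [] = s , ≡.trans (≡.cong (λ t → add t [ 0ℤ ]) (≡.trans (map-cong ℤ.*-identityˡ r) (map-id r)))
        (≡.trans (add-[0] r s e) e) , l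
      where
      add-[0] : ∀ r s → r ≡ s ++ [ 1ℤ ] → add r [ 0ℤ ] ≡ r
      add-[0] (x ∷ []) s _ = ≡.cong [_] (ℤ.+-identityʳ x)
      add-[0] (x ∷ y ∷ r) s _ = ≡.cong (_∷ y ∷ r) (ℤ.+-identityʳ x)
      add-[0] [] [] ()
      add-[0] [] (_ ∷ _) ()
    go (c ∷ p) with go p
    ... | t , e′ , l′ = add-short-monic (scale c r) (0ℤ ∷ mul (p ++ [ 1ℤ ]) r) short (0ℤ ∷ t , ≡.cong (0ℤ ∷_) e′ , ≡.cong suc l′)
      where
      short : length (scale c r) ℕ.≤ suc (length p ℕ.+ k)
      short = ℕ.≤-trans (ℕ.≤-reflexive (≡.trans (length-map (c ℤ.*_) r) (≡.trans (≡.cong length e)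
        (≡.trans (length-++ s) (≡.trans (ℕ.+-comm (length s) 1) (≡.cong suc l)))))) (s≤s (ℕ.m≤n+m k (length p)))

  monic-at : ∀ {k p} → MonicOfDegree k p → p at k ≡ 1ℤ
  monic-at (r , ≡.refl , ≡.refl) = go r
    where
    go : ∀ r → (r ++ [ 1ℤ ]) at length r ≡ 1ℤ
    go [] = ≡.refl
    go (x ∷ r) = go r

  monic-at> : ∀ {k p} → MonicOfDegree k p → ∀ i → k ℕ.< i → p at i ≡ 0ℤ
  monic-at> (r , ≡.refl , ≡.refl) = go r
    where
    go : ∀ r i → length r ℕ.< i → (r ++ [ 1ℤ ]) at i ≡ 0ℤ
    go [] (suc i) _ = ≡.refl
    go (x ∷ r) (suc i) (s≤s lt) = go r i lt

  -- A multiple of a monic polynomial that has smaller degree is zero. The higher coefficients of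
  -- `c` vanish first, and then coefficient `k` of the product is `c₀`. Hence an exact division
  -- leaves no remainder.
  monic-degree : ∀ {k p} → MonicOfDegree k p → ∀ c → (∀ i → k ℕ.≤ i → mul p c at i ≡ 0ℤ) → c ≋ []
  monic-degree {k} {p} mon [] _ = ≋-refl
  monic-degree {k} {p} mon (c₀ ∷ c) z = U₁.∷-zero c₀≡0 c≋[]
    where
    coefficients : ∀ i → mul p (c₀ ∷ c) at i ≡ c₀ ℤ.* (p at i) ℤ.+ ((0ℤ ∷ mul p c) at i)
    coefficients i = ≡.trans (at≈ (U₁.mul-∷ p c₀ c) i) (≡.trans (U₁.add-at (scale c₀ p) (0ℤ ∷ mul p c) i) (≡.cong (ℤ._+ _) (U₁.scale-at c₀ p i)))
    c≋[] : c ≋ []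
    c≋[] = monic-degree mon c λ i k≤i → ≡.trans (≡.sym (≡.trans (coefficients (suc i))
      (≡.trans (≡.cong (λ t → c₀ ℤ.* t ℤ.+ (mul p c at i)) (monic-at> mon (suc i) (s≤s k≤i)))
        (≡.trans (≡.cong (ℤ._+ (mul p c at i)) (ℤ.*-zeroʳ c₀)) (ℤ.+-identityˡ _))))) (z (suc i) (ℕ.m≤n⇒m≤1+n k≤i))
    tail-zero : (0ℤ ∷ mul p c) at k ≡ 0ℤ
    tail-zero = at≈ (U₁.∷-zero ≡.refl (≋-trans (mul-congˡ p c≋[]) (U₁.mul-zeroʳ p))) k
    c₀≡0 : c₀ ≡ 0ℤ
    c₀≡0 = ≡.trans (≡.sym (≡.trans (coefficients k) (≡.trans (≡.cong₂ (λ s t → c₀ ℤ.* s ℤ.+ t) (monic-at mon) tail-zero)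
      (≡.trans (ℤ.+-identityʳ _) (ℤ.*-identityʳ c₀))))) (z k ℕ.≤-refl)

  -- Coefficients are listed highest degree first, as in divH.
  fromHigh : List ℤ → List ℤ
  fromHigh [] = []
  fromHigh (c ∷ cs) = add (mul (const c) (X ^Z length cs)) (fromHigh cs)

  fromHigh-reverse : ∀ h → fromHigh h ≋ reverse h
  fromHigh-reverse [] = ≋-refl
  fromHigh-reverse (c ∷ h) = ≋-trans (add-cong (V₁.X^-shift c (length h)) (fromHigh-reverse h))
    (≋-trans (≡.subst (λ k → add (shift k c) (reverse h) ≋ reverse h ++ [ c ]) (length-reverse h) (snoc (reverse h)))
      (Z.reflexive (≡.sym (unfold-reverse c h))))
    where
    snoc : ∀ r → add (shift (length r) c) r ≋ r ++ [ c ]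
    snoc [] = ≋-refl
    snoc (x ∷ r) = U₁.∷-cong (ℤ.+-identityˡ x) (snoc r)

  -- Aligning the lists at their heads amounts to multiplying the shorter one by the missing power
  -- of `X`.
  fromHigh-subPref : ∀ xs ys → length ys ℕ.≤ length xs →
    fromHigh (subPref xs ys) ≋ add (fromHigh xs) (neg (mul (X ^Z (length xs ℕ.∸ length ys)) (fromHigh ys)))
    × length (subPref xs ys) ≡ length xs
  fromHigh-subPref xs [] _ = ≋-sym (≋-trans (add-cong (≋-refl {fromHigh xs}) (U₁.neg-cong (U₁.mul-zeroʳ (X ^Z length xs)))) (U₁.add-[] (fromHigh xs))) , ≡.refl
  fromHigh-subPref (x ∷ xs) (y ∷ ys) (s≤s le) with fromHigh-subPref xs ys le
  ... | e , l = ≋-trans (add-cong (≋-trans (≡.subst (λ k → mul (const (x ℤ.- y)) (X ^Z length (subPref xs ys)) ≋ mul (const (x ℤ.- y)) (X ^Z k)) l ≋-refl)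
                          (≋-trans (mul-congˡ (const (x ℤ.- y)) split) (≋-refl {mul (add (const x) (neg (const y))) (mul A B)})) ) e)
      (≋-trans (ZS.solve 6 (λ x y A B f g → (x ZS.:- y) ZS.:* (A ZS.:* B) ZS.:+ (f ZS.:- A ZS.:* g) ZS.:=
          (x ZS.:* (A ZS.:* B) ZS.:+ f) ZS.:- A ZS.:* (y ZS.:* B ZS.:+ g)) ≋-refl (const x) (const y) A B (fromHigh xs) (fromHigh ys))
        (add-cong (add-cong (mul-congˡ (const x) (≋-sym split)) (≋-refl {fromHigh xs})) (≋-refl {neg (mul A (fromHigh (y ∷ ys)))})))
      , ≡.cong suc l
    where
    A = X ^Z (length xs ℕ.∸ length ys)
    B = X ^Z length ys
    split : X ^Z length xs ≋ mul A B
    split = ≋-trans (Z.reflexive (≡.cong (X ^Z_) (≡.sym (ℕ.m∸n+n≡m le)))) (Power.^-+ ℤ[q] X (length xs ℕ.∸ length ys) (length ys))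

  fromHigh-scale : ∀ c h → fromHigh (map (c ℤ.*_) h) ≋ mul (const c) (fromHigh h)
  fromHigh-scale c [] = ≋-sym (U₁.mul-zeroʳ (const c))
  fromHigh-scale c (x ∷ h) = ≋-trans (add-cong
      (≋-trans (≡.subst (λ k → mul (const (c ℤ.* x)) (X ^Z length (map (c ℤ.*_) h)) ≋ mul (const (c ℤ.* x)) (X ^Z k)) (length-map (c ℤ.*_) h) ≋-refl)
        (mul-congʳ (X ^Z length h) (V₁.const-* c x))) (fromHigh-scale c h))
    (ZS.solve 4 (λ c x p f → (c ZS.:* x) ZS.:* p ZS.:+ c ZS.:* f ZS.:= c ZS.:* (x ZS.:* p ZS.:+ f)) ≋-refl (const c) (const x) (X ^Z length h) (fromHigh h))

  module LongDivision (rd : List ℤ) where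
    divisor : List ℤ
    divisor = fromHigh (1ℤ ∷ rd)

    divisor-reverse : divisor ≋ reverse (1ℤ ∷ rd)
    divisor-reverse = fromHigh-reverse (1ℤ ∷ rd)

    reverse-monic : MonicOfDegree (length rd) (reverse (1ℤ ∷ rd))
    reverse-monic = reverse rd , unfold-reverse 1ℤ rd , length-reverse rd

    fromHigh-at≥ : ∀ h i → length h ℕ.≤ i → fromHigh h at i ≡ 0ℤ
    fromHigh-at≥ h i le = ≡.trans (at≈ (fromHigh-reverse h) i) (at≥ (reverse h) i (ℕ.≤-trans (ℕ.≤-reflexive (length-reverse h)) le))
      where
      at≥ : ∀ r i → length r ℕ.≤ i → r at i ≡ 0ℤ
      at≥ [] i _ = ≡.refl
      at≥ (x ∷ r) (suc i) (s≤s le) = at≥ r i le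

    short⇒zero : ∀ h → length h ℕ.≤ length rd → divisor ZD.∣ fromHigh h → fromHigh h ≋ []
    short⇒zero h le (ZD.divides c e) = ≋-trans (≋-sym e′)
        (≋-trans (mul-congˡ (reverse (1ℤ ∷ rd)) (monic-degree reverse-monic c λ i k≤i → ≡.trans (at≈ e′ i) (fromHigh-at≥ h i (ℕ.≤-trans le k≤i))))
          (U₁.mul-zeroʳ (reverse (1ℤ ∷ rd))))
      where
      e′ : mul (reverse (1ℤ ∷ rd)) c ≋ fromHigh h
      e′ = ≋-trans (mul-congʳ c (≋-sym divisor-reverse)) e

    -- The length of the quotient belongs to the statement because `fromHigh` reads the degree of
    -- the first entry off the length of the list. When the dividend is too short to continue,
    -- divisibility forces it to be zero.
    divH-exact : ∀ f h → length h ℕ.≤ f → divisor ZD.∣ fromHigh h →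
      mul divisor (fromHigh (divH f h rd)) ≋ fromHigh h × length (divH f h rd) ≡ length h ℕ.∸ length rd
    divH-exact ℕ.zero [] _ _ = U₁.mul-zeroʳ divisor , ≡.sym (ℕ.0∸n≡0 (length rd))
    divH-exact (suc f) [] _ _ = U₁.mul-zeroʳ divisor , ≡.sym (ℕ.0∸n≡0 (length rd))
    divH-exact (suc f) (c ∷ cs) (s≤s le) d with length rd ≤ᵇ length cs in eq
    ... | false = ≋-trans (U₁.mul-zeroʳ divisor) (≋-sym (short⇒zero (c ∷ cs) short d)) , ≡.sym (ℕ.m≤n⇒m∸n≡0 short)
      where
      short : suc (length cs) ℕ.≤ length rd
      short = ℕ.≰⇒> λ le′ → ≡.subst T eq (ℕ.≤⇒≤ᵇ le′)
    ... | true = exact , ≡.trans (≡.cong suc (≡.trans lengths (≡.cong (ℕ._∸ length rd) len))) (≡.sym (ℕ.+-∸-assoc 1 rd≤cs))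
      where
      rd≤cs : length rd ℕ.≤ length cs
      rd≤cs = ℕ.≤ᵇ⇒≤ (length rd) (length cs) (≡.subst T (≡.sym eq) tt)
      crd = map (c ℤ.*_) rd
      sub = fromHigh-subPref cs crd (ℕ.≤-trans (ℕ.≤-reflexive (length-map (c ℤ.*_) rd)) rd≤cs)
      rest = subPref cs crd
      len : length rest ≡ length cs
      len = proj₂ sub
      k = length cs ℕ.∸ length rd
      Y = X ^Z k
      rest≋ : fromHigh rest ≋ add (fromHigh cs) (neg (mul Y (mul (const c) (fromHigh rd))))
      rest≋ = ≋-trans (proj₁ sub) (add-cong (≋-refl {fromHigh cs}) (U₁.neg-cong
        (≋-trans (mul-congʳ (fromHigh crd) (Z.reflexive (≡.cong (λ l → X ^Z (length cs ℕ.∸ l)) (length-map (c ℤ.*_) rd)))) (mul-congˡ Y (fromHigh-scale c rd)))))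
      split : X ^Z length cs ≋ mul Y (X ^Z length rd)
      split = ≋-trans (Z.reflexive (≡.cong (X ^Z_) (≡.sym (ℕ.m∸n+n≡m rd≤cs)))) (Power.^-+ ℤ[q] X k (length rd))
      decompose : fromHigh (c ∷ cs) ≋ add (mul divisor (mul (const c) Y)) (fromHigh rest)
      decompose = ≋-trans (add-cong (mul-congˡ (const c) split) (≋-refl {fromHigh cs}))
        (≋-trans (ZS.solve 5 (λ c Y r g f → c ZS.:* (Y ZS.:* r) ZS.:+ f ZS.:= (ZS.:1 ZS.:* r ZS.:+ g) ZS.:* (c ZS.:* Y) ZS.:+ (f ZS.:- Y ZS.:* (c ZS.:* g)))
            ≋-refl (const c) Y (X ^Z length rd) (fromHigh rd) (fromHigh cs))
          (add-cong (≋-refl {mul divisor (mul (const c) Y)}) (≋-sym rest≋)))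
      d′ : divisor ZD.∣ fromHigh rest
      d′ = ZD.∣-cancel-+ (ZD.∣-resp decompose d) (ZD.divides (mul (const c) Y) ≋-refl)
      ih = divH-exact f rest (ℕ.≤-trans (ℕ.≤-reflexive len) le) d′
      lengths : length (divH f rest rd) ≡ length rest ℕ.∸ length rd
      lengths = proj₂ ih
      exact : mul divisor (fromHigh (c ∷ divH f rest rd)) ≋ fromHigh (c ∷ cs)
      exact = ≋-trans (mul-congˡ divisor (add-cong (mul-congˡ (const c) (Z.reflexive (≡.cong (X ^Z_) (≡.trans lengths (≡.cong (ℕ._∸ length rd) len))))) (≋-refl {fromHigh (divH f rest rd)})))
        (≋-trans (Z.distribˡ divisor (mul (const c) Y) (fromHigh (divH f rest rd)))
          (≋-trans (add-cong (≋-refl {mul divisor (mul (const c) Y)}) (proj₁ ih)) (≋-sym decompose)))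

  divU-exact : ∀ {k j p d} → MonicOfDegree k p → MonicOfDegree j d → d ZD.∣ p → ¬ p ≋ [] →
    mul d (divU p d) ≋ p × Σ ℕ λ i → MonicOfDegree i (divU p d)
  divU-exact {p = p} {d} (s , ≡.refl , ≡.refl) (r , ≡.refl , ≡.refl) d∣p p≉[] rewrite reverse-++ r [ 1ℤ ] | reverse-++ s [ 1ℤ ] = go (length p) ≡.refl
    where
    open LongDivision (reverse r)
    h = 1ℤ ∷ reverse s
    D≋ : divisor ≋ r ++ [ 1ℤ ]
    D≋ = ≋-trans divisor-reverse (Z.reflexive (≡.trans (unfold-reverse 1ℤ (reverse r)) (≡.cong (_++ [ 1ℤ ]) (reverse-involutive r))))
    h≋ : fromHigh h ≋ s ++ [ 1ℤ ]
    h≋ = ≋-trans (fromHigh-reverse h) (Z.reflexive (≡.trans (unfold-reverse 1ℤ (reverse s)) (≡.cong (_++ [ 1ℤ ]) (reverse-involutive s))))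
    divisor∣h : divisor ZD.∣ fromHigh h
    divisor∣h = ZD.∣-resp (≋-sym h≋) (ZD.∣-trans (ZD.∣-reflexive D≋) d∣p)
    length-p : length (s ++ [ 1ℤ ]) ≡ suc (length (reverse s))
    length-p = ≡.trans (length-++ s) (≡.trans (ℕ.+-comm (length s) 1) (≡.cong suc (≡.sym (length-reverse s))))
    go : ∀ f → f ≡ length (s ++ [ 1ℤ ]) → mul (r ++ [ 1ℤ ]) (reverse (divH f h (reverse r))) ≋ s ++ [ 1ℤ ] × Σ ℕ λ i → MonicOfDegree i (reverse (divH f h (reverse r)))
    go f e = ≋-trans (mul-congʳ _ (≋-sym D≋)) (≋-trans (mul-congˡ divisor (≋-sym (fromHigh-reverse (divH f h (reverse r))))) (≋-trans (proj₁ exact) h≋)) , leading f e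
      where
      exact = divH-exact f h (ℕ.≤-reflexive (≡.sym (≡.trans e length-p))) divisor∣h
      leading : ∀ f → f ≡ length (s ++ [ 1ℤ ]) → Σ ℕ λ i → MonicOfDegree i (reverse (divH f h (reverse r)))
      leading ℕ.zero e′ = contradiction (≡.trans e′ length-p) λ ()
      -- The first entry of the quotient is that of `h`, namely 1; an empty quotient would force the
      -- nonzero dividend to vanish.
      leading (suc f) e′ with length (reverse r) ≤ᵇ length (reverse s) in eq
      ... | true = _ , reverse rest , unfold-reverse 1ℤ rest , ≡.refl
        where rest = divH f (subPref (reverse s) (map (1ℤ ℤ.*_) (reverse r))) (reverse r)
      ... | false = contradiction (≋-trans (≋-sym h≋) (short⇒zero h (ℕ.≰⇒> λ le → ≡.subst T eq (ℕ.≤⇒≤ᵇ le)) divisor∣h)) p≉[]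

  private
    mutual
      -- The hole stands for the local worker of `xnm1`; checking `xnm1-shift` solves it by
      -- unification.
      xnm1-worker : ∀ n → _ ≡ shift n 1ℤ
      xnm1-worker = worker _ ≡.refl (λ _ → ≡.refl)

      xnm1-shift : ∀ n → xnm1 (suc n) ≡ -1ℤ ∷ shift n 1ℤ
      xnm1-shift n = ≡.cong (-1ℤ ∷_) (xnm1-worker n)

      worker : (go : ℕ → List ℤ) → go 0 ≡ [ 1ℤ ] → (∀ k → go (suc k) ≡ 0ℤ ∷ go k) → ∀ n → go n ≡ shift n 1ℤ
      worker go z s ℕ.zero = z
      worker go z s (suc n) = ≡.trans (s n) (≡.cong (0ℤ ∷_) (worker go z s n))

  X^≋shift : ∀ n → X ^Z n ≋ shift n 1ℤ
  X^≋shift n = ≋-trans (≋-sym (U₁.mul-identityˡ (X ^Z n))) (V₁.X^-shift 1ℤ n)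

  xnm1≋E : ∀ n → xnm1 (suc n) ≋ C.E (suc n)
  xnm1≋E n = ≋-trans (Z.reflexive (xnm1-shift n)) (≋-sym (≋-trans
    (add-cong (≋-trans (V₁.X-mul (X ^Z n)) (U₁.∷-cong ≡.refl (X^≋shift n))) (≋-refl {neg [ 1ℤ ]}))
    (U₁.∷-cong ≡.refl (U₁.add-[] (shift n 1ℤ)))))

  xnm1-monic : ∀ n → MonicOfDegree (suc n) (xnm1 (suc n))
  xnm1-monic n rewrite xnm1-shift n = go n
    where
    shift-monic : ∀ n → MonicOfDegree n (shift n 1ℤ)
    shift-monic ℕ.zero = [] , ≡.refl , ≡.refl
    shift-monic (suc n) with shift-monic n
    ... | r , e , l = 0ℤ ∷ r , ≡.cong (0ℤ ∷_) e , ≡.cong suc l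
    go : ∀ n → MonicOfDegree (suc n) (-1ℤ ∷ shift n 1ℤ)
    go n with shift-monic n
    ... | r , e , l = -1ℤ ∷ r , ≡.cong (-1ℤ ∷_) e , ≡.cong suc l

  E≉0 : ∀ n → ¬ C.E (suc n) ≋ []
  E≉0 n e with at≈ (≋-trans (Z.reflexive (≡.sym (xnm1-shift n))) (≋-trans (xnm1≋E n) e)) 0
  ... | ()

  ProperDivisor : ℕ → ℕ → Set
  ProperDivisor n d = ℕ.NonZero d × d ℕ.< n × d ℕ.∣ n

  properDivisors-sound : ∀ n → All (ProperDivisor n) (properDivisors n)
  properDivisors-sound ℕ.zero = []
  properDivisors-sound (suc n) = All.map (λ ((d≢0 , d<n) , d∣n) → d≢0 , d<n , d∣n)
    (All.zip (All.filter⁺ (ℕ._∣? suc n) bounds , All.all-filter (ℕ._∣? suc n) (applyUpTo suc n)))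
    where
    bounds : All (λ d → ℕ.NonZero d × d ℕ.< suc n) (applyUpTo suc n)
    bounds = All.applyUpTo⁺₁ suc n λ i<n → _ , s≤s i<n

  properDivisors-complete : ∀ {n d} → ProperDivisor n d → d ∈ properDivisors n
  properDivisors-complete {suc n} {suc d} (_ , s≤s d<n , d∣n) = ∈-filter⁺ (ℕ._∣? suc n) (∈-applyUpTo⁺ suc d<n) d∣n

  properDivisors-increasing : ∀ n → AllPairs ℕ._<_ (properDivisors n)
  properDivisors-increasing ℕ.zero = []
  properDivisors-increasing (suc n) = AllPairs.filter⁺ (ℕ._∣? suc n) (AllPairs.applyUpTo⁺₁ suc n λ i<j _ → s≤s i<j)

  -- Recursive calls are made at proper divisors only, so fuel `n` already suffices at `n`.
  cycF-fuel : ∀ f g n → ℕ.NonZero n → n ℕ.≤ f → n ℕ.≤ g → cycF f n ≡ cycF g n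
  cycF-fuel (suc f) (suc g) n n≢0 n≤f n≤g = ≡.cong (λ L → divU (xnm1 n) (foldr mulU [ 1ℤ ] L))
    (map-cong-local (All.map (λ (d≢0 , d<n , _) → cycF-fuel f g _ d≢0 (ℕ.≤-pred (ℕ.≤-trans d<n n≤f)) (ℕ.≤-pred (ℕ.≤-trans d<n n≤g))) (properDivisors-sound n)))
  cycF-fuel ℕ.zero g (suc n) _ () _
  cycF-fuel (suc f) ℕ.zero (suc n) _ _ ()

  cyclotomic-suc : ∀ n → cyclotomic (suc n) ≡ divU (xnm1 (suc n)) (C.product cyclotomic (properDivisors (suc n)))
  cyclotomic-suc n = ≡.cong (divU (xnm1 (suc n))) (≡.trans
    (≡.cong (foldr mulU [ 1ℤ ]) (map-cong-local (All.map (λ { (d≢0 , s≤s d≤n , _) → cycF-fuel n _ _ d≢0 d≤n ℕ.≤-refl }) (properDivisors-sound (suc n)))))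
    (foldr-mulU (map cyclotomic (properDivisors (suc n)))))
    where
    foldr-mulU : ∀ L → foldr mulU [ 1ℤ ] L ≡ foldr mul [ 1ℤ ] L
    foldr-mulU [] = ≡.refl
    foldr-mulU (p ∷ L) = ≡.trans (mulU≡mul p (foldr mulU [ 1ℤ ] L)) (≡.cong (mul p) (foldr-mulU L))

  -- Proved together by strong induction. That the product over proper divisors divides x^n - 1
  -- needs pairwise regularity, which is `E-regular` at smaller indices; `divU` is correct for monic
  -- divisors only; and `E-regular` at `n` uses the exactness just obtained.
  record CyclotomicProperties (n : ℕ) : Set where
    field
      exact : mul (C.product cyclotomic (properDivisors n)) (cyclotomic n) ≋ C.E n
      degree : ℕ
      monic : MonicOfDegree degree (cyclotomic n)
      E-regular : ∀ i → ℕ.NonZero i → i ℕ.< n → ZD.RegularMod (C.E i) (cyclotomic n)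

    divides-E : cyclotomic n ZD.∣ C.E n
    divides-E = ZD.∣-resp exact (ZD.y∣xy (C.product cyclotomic (properDivisors n)) (cyclotomic n))

    isPrimitive : G₁.Primitive (cyclotomic n)
    isPrimitive = G₁.unit-coefficient⇒primitive (cyclotomic n) degree (monic-at monic)

  cyclotomic-properties : ∀ n → ℕ.NonZero n → CyclotomicProperties n
  cyclotomic-properties = <-rec (λ n → ℕ.NonZero n → CyclotomicProperties n) step
    where
    step : ∀ n → (∀ {d} → d ℕ.< n → ℕ.NonZero d → CyclotomicProperties d) → ℕ.NonZero n → CyclotomicProperties n
    step n@(suc n₀) ih n≢0 = record { exact = exact ; degree = proj₁ (proj₂ quotient) ; monic = monic ; E-regular = E-regular }
      where
      Φs : ℕ → List ℤ
      Φs = cyclotomic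
      pd = properDivisors n
      prop : ∀ {d} → ProperDivisor n d → CyclotomicProperties d
      prop (d≢0 , d<n , _) = ih d<n d≢0

      Φ≉0 : ∀ {d} → CyclotomicProperties d → ¬ Φs d ≋ []
      Φ≉0 K = G₁.primitive⇒≉[] (CyclotomicProperties.isPrimitive K)

      -- Φ_d divides x^d - 1, which is regular modulo Φ_e by induction.
      regular-< : ∀ {d e} → ℕ.NonZero d → d ℕ.< e → CyclotomicProperties d → CyclotomicProperties e → ZD.RegularMod (Φs d) (Φs e)
      regular-< d≢0 d<e K L {y} = C.regular-∣ (CyclotomicProperties.divides-E K) (λ {y} → CyclotomicProperties.E-regular L _ d≢0 d<e {y}) {y}

      regular-> : ∀ {d e} → ℕ.NonZero d → d ℕ.< e → CyclotomicProperties d → CyclotomicProperties e → ZD.RegularMod (Φs e) (Φs d)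
      regular-> d≢0 d<e K L {y} = regularMod-sym (Φ≉0 L) (λ {y} → regular-< d≢0 d<e K L {y}) {y}

      increasing⇒regular : ∀ L → AllPairs ℕ._<_ L → All (ProperDivisor n) L → AllPairs (λ d e → ZD.RegularMod (Φs e) (Φs d)) L
      increasing⇒regular [] [] [] = []
      increasing⇒regular (d ∷ L) (lt ∷ p) (d∈ ∷ ds) =
        All.map (λ (d<e , e∈) {y} → regular-> (proj₁ d∈) d<e (prop d∈) (prop e∈) {y}) (All.zip (lt , ds)) ∷ increasing⇒regular L p ds

      product∣E : C.product Φs pd ZD.∣ C.E n
      product∣E = C.product-∣ Φs pd (increasing⇒regular pd (properDivisors-increasing n) (properDivisors-sound n))
        (All.map (λ d∈ → ZD.∣-trans (CyclotomicProperties.divides-E (prop d∈)) (C.E-∣ (proj₂ (proj₂ d∈)))) (properDivisors-sound n))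

      product-monic : ∀ L → All (ProperDivisor n) L → Σ ℕ λ k → MonicOfDegree k (C.product Φs L)
      product-monic [] [] = 0 , [] , ≡.refl , ≡.refl
      product-monic (d ∷ L) (d∈ ∷ ds) = _ , mul-monic (CyclotomicProperties.monic (prop d∈)) (proj₂ (product-monic L ds))

      quotient : mul (C.product Φs pd) (divU (xnm1 n) (C.product Φs pd)) ≋ xnm1 n × Σ ℕ λ i → MonicOfDegree i (divU (xnm1 n) (C.product Φs pd))
      quotient = divU-exact (xnm1-monic n₀) (proj₂ (product-monic pd (properDivisors-sound n)))
        (ZD.∣-resp (≋-sym (xnm1≋E n₀)) product∣E) (λ e → E≉0 n₀ (≋-trans (≋-sym (xnm1≋E n₀)) e))

      monic : MonicOfDegree (proj₁ (proj₂ quotient)) (Φs n)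
      monic = ≡.subst (MonicOfDegree _) (≡.sym (cyclotomic-suc n₀)) (proj₂ (proj₂ quotient))

      exact : mul (C.product Φs pd) (Φs n) ≋ C.E n
      exact = ≋-trans (mul-congˡ (C.product Φs pd) (Z.reflexive (cyclotomic-suc n₀))) (≋-trans (proj₁ quotient) (xnm1≋E n₀))

      -- x^d - 1 is the product of Φ_e over all divisors e of d, `d` included. These are proper
      -- divisors of `n`, and being pairwise regular they divide the product over all of the latter
      -- jointly.
      E-product : ∀ d → ProperDivisor n d → C.E d ZD.∣ C.product Φs pd
      E-product d d∈@(d≢0 , d<n , d∣n) = ZD.∣-trans (ZD.∣-reflexive (≋-sym (≋-trans (Z.*-comm (Φs d) (C.product Φs (properDivisors d))) (CyclotomicProperties.exact (prop d∈)))))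
        (C.product-∣ Φs (d ∷ properDivisors d)
          (All.map (λ (e≢0 , e<d , e∣d) {y} → regular-< e≢0 e<d (prop (e≢0 , ℕ.<-trans e<d d<n , ℕ.∣-trans e∣d d∣n)) (prop d∈) {y}) (properDivisors-sound d)
            ∷ increasing⇒regular (properDivisors d) (properDivisors-increasing d) (All.map lift (properDivisors-sound d)))
          (All.map (λ e∈ → C.∣-product Φs (properDivisors-complete e∈)) (d∈ ∷ All.map lift (properDivisors-sound d))))
        where
        lift : ∀ {e} → ProperDivisor d e → ProperDivisor n e
        lift (e≢0 , e<d , e∣d) = e≢0 , ℕ.<-trans e<d d<n , ℕ.∣-trans e∣d d∣n

      Φ-primitive : G₁.Primitive (Φs n)
      Φ-primitive = G₁.unit-coefficient⇒primitive (Φs n) _ (monic-at monic)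

      E-regular : ∀ i → ℕ.NonZero i → i ℕ.< n → ZD.RegularMod (C.E i) (Φs n)
      E-regular = C.E-regular (λ k → const (+ k)) (U₁.∷-zero ≡.refl ≋-refl) (λ k → ≋-refl) E≉0 n (Φs n) n≢0
        (ZD.∣-resp exact (ZD.y∣xy (C.product Φs pd) (Φs n)))
        (λ { ℕ.zero _ 0∣n → contradiction (ℕ.0∣⇒≡0 0∣n) λ ()
           ; d@(suc _) d<n d∣n → ZD.∣-resp exact (ZD.*-mono-∣ (E-product d (_ , d<n , d∣n)) (ZD.∣-refl {Φs n})) })
        -- The monic Φ_n is primitive, hence regular modulo a positive integer; symmetry gives the
        -- regularity of that integer modulo Φ_n.
        (λ { (suc k) _ {y} → regularMod-sym {g = const (+ suc k)} {h = Φs n} (λ e → contradiction (at≈ e 0) λ ()) (λ {y} → G₁.primitive⇒regular {Φs n} (+ suc k) Φ-primitive {y}) {y} })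

-- Interfaces for rings in which formal polynomials are evaluated.

module Interpretations where
  -- Stated for an arbitrary target, so that one construction of fractions serves every quotient of
  -- the polynomial ring.
  record Interpretation (K : CommutativeRing 0ℓ 0ℓ) : Set where
    open CommutativeRing K
    field
      φ : Poly → Carrier
      φ-+ : ∀ p r → φ (p +ₚ r) ≈ φ p + φ r
      φ-* : ∀ p r → φ (p *ₚ r) ≈ φ p * φ r
      φ-minus : ∀ p r → φ (p -ₚ r) ≈ φ p - φ r
      φ-1 : φ 1ₚ ≈ 1#
      φ-0 : φ 0ₚ ≈ 0#

  record Presentation (T : CommutativeRing 0ℓ 0ℓ) : Set where
    open CommutativeRing T
    field interpretation : Interpretation T
    open Interpretation interpretation public
    field
      q a b : Carrier
      φ-q : φ qₚ ≈ q
      φ-a : φ aₚ ≈ a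
      φ-b : φ bₚ ≈ b
      φ-cong : ∀ {p r} → p ≈ₚ r → φ p ≈ φ r
      φ-injective : ∀ {p r} → φ p ≈ φ r → p ≈ₚ r
      encode : Carrier → Poly
      φ-encode : ∀ t → φ (encode t) ≈ t

open Interpretations

-- Quotient rings and total rings of fractions.

module Localize where
  module Quotient (R : CommutativeRing 0ℓ 0ℓ) (g : CommutativeRing.Carrier R) where
    open CommutativeRing R
    open Divisibility R
    open IntSolver R

    infix 4 _≈ₘ_
    record _≈ₘ_ (x y : Carrier) : Set where
      constructor mk≈ₘ
      field difference-∣ : g ∣ x - y
    open _≈ₘ_ public

    ≈⇒≈ₘ : ∀ {x y} → x ≈ y → x ≈ₘ y
    ≈⇒≈ₘ e = mk≈ₘ (∣-resp (sym (trans (+-congʳ e) (-‿inverseʳ _))) ∣0)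

    ≈ₘ0⇒∣ : ∀ {x} → x ≈ₘ 0# → g ∣ x
    ≈ₘ0⇒∣ {x} (mk≈ₘ d) = ∣-resp (solve 1 (λ x → x :- con (ℤ.+ 0) := x) refl x) d
      where import Data.Integer as ℤ

    ∣⇒≈ₘ0 : ∀ {x} → g ∣ x → x ≈ₘ 0#
    ∣⇒≈ₘ0 {x} d = mk≈ₘ (∣-resp (solve 1 (λ x → x := x :- con (ℤ.+ 0)) refl x) d)
      where import Data.Integer as ℤ

    private
      sym-≈ₘ : ∀ {x y} → x ≈ₘ y → y ≈ₘ x
      sym-≈ₘ {x} {y} (mk≈ₘ d) = mk≈ₘ (∣-resp (solve 2 (λ x y → :- (x :- y) := y :- x) refl x y) (∣-neg d))

      trans-≈ₘ : ∀ {x y z} → x ≈ₘ y → y ≈ₘ z → x ≈ₘ z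
      trans-≈ₘ {x} {y} {z} (mk≈ₘ d) (mk≈ₘ e) = mk≈ₘ (∣-resp (solve 3 (λ x y z → (x :- y) :+ (y :- z) := x :- z) refl x y z) (∣-+ d e))

      +-cong-≈ₘ : ∀ {x y u v} → x ≈ₘ y → u ≈ₘ v → x + u ≈ₘ y + v
      +-cong-≈ₘ {x} {y} {u} {v} (mk≈ₘ d) (mk≈ₘ e) =
        mk≈ₘ (∣-resp (solve 4 (λ x y u v → (x :- y) :+ (u :- v) := (x :+ u) :- (y :+ v)) refl x y u v) (∣-+ d e))

      *-cong-≈ₘ : ∀ {x y u v} → x ≈ₘ y → u ≈ₘ v → x * u ≈ₘ y * v
      *-cong-≈ₘ {x} {y} {u} {v} (mk≈ₘ d) (mk≈ₘ e) =
        mk≈ₘ (∣-resp (solve 4 (λ x y u v → (x :- y) :* u :+ y :* (u :- v) := (x :* u) :- (y :* v)) refl x y u v) (∣-+ (∣-*ʳ u d) (∣-*ˡ y e)))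

      -‿cong-≈ₘ : ∀ {x y} → x ≈ₘ y → - x ≈ₘ - y
      -‿cong-≈ₘ {x} {y} (mk≈ₘ d) = mk≈ₘ (∣-resp (solve 2 (λ x y → :- (x :- y) := (:- x) :- (:- y)) refl x y) (∣-neg d))

    -- The carrier stays the same and only equality is coarsened, so evaluation maps can be reused
    -- unchanged.
    quotientRing : CommutativeRing 0ℓ 0ℓ
    quotientRing = record
      { Carrier = Carrier ; _≈_ = _≈ₘ_ ; _+_ = _+_ ; _*_ = _*_ ; -_ = -_ ; 0# = 0# ; 1# = 1#
      ; isCommutativeRing = record
        { isRing = record
          { +-isAbelianGroup = record
            { isGroup = record
              { isMonoid = record
                { isSemigroup = record
                  { isMagma = record
                    { isEquivalence = record { refl = ≈⇒≈ₘ refl ; sym = sym-≈ₘ ; trans = trans-≈ₘ }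
                    ; ∙-cong = +-cong-≈ₘ }
                  ; assoc = λ x y z → ≈⇒≈ₘ (+-assoc x y z) }
                ; identity = (λ x → ≈⇒≈ₘ (+-identityˡ x)) , (λ x → ≈⇒≈ₘ (+-identityʳ x)) }
              ; inverse = (λ x → ≈⇒≈ₘ (-‿inverseˡ x)) , (λ x → ≈⇒≈ₘ (-‿inverseʳ x))
              ; ⁻¹-cong = -‿cong-≈ₘ }
            ; comm = λ x y → ≈⇒≈ₘ (+-comm x y) }
          ; *-cong = *-cong-≈ₘ
          ; *-assoc = λ x y z → ≈⇒≈ₘ (*-assoc x y z)
          ; *-identity = (λ x → ≈⇒≈ₘ (*-identityˡ x)) , (λ x → ≈⇒≈ₘ (*-identityʳ x))
          ; distrib = (λ x y z → ≈⇒≈ₘ (distribˡ x y z)) , (λ x y z → ≈⇒≈ₘ (distribʳ x y z)) }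
        ; *-comm = λ x y → ≈⇒≈ₘ (*-comm x y) } }

  module Localization (R : CommutativeRing 0ℓ 0ℓ) where
    open CommutativeRing R
    open IntSolver R

    record Regular (d : Carrier) : Set where
      constructor mkRegular
      field cancel₀ : ∀ {y} → d * y ≈ 0# → y ≈ 0#
    open Regular public

    regular-resp : ∀ {x y} → x ≈ y → Regular x → Regular y
    regular-resp e r = mkRegular λ f → cancel₀ r (trans (*-congʳ e) f)

    regular-1 : Regular 1#
    regular-1 = mkRegular (trans (sym (*-identityˡ _)))

    regular-* : ∀ {x y} → Regular x → Regular y → Regular (x * y)
    regular-* r s = mkRegular λ e → cancel₀ s (cancel₀ r (trans (sym (*-assoc _ _ _)) e))

    regular-factor : ∀ {x} y → Regular (x * y) → Regular x
    regular-factor {x} y r = mkRegular λ {z} e → cancel₀ r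
      (trans (solve 3 (λ x y z → (x :* y) :* z := (x :* z) :* y) refl x y z) (trans (*-congʳ e) (zeroˡ y)))

    regular-cancel : ∀ {d x y} → Regular d → d * x ≈ d * y → x ≈ y
    regular-cancel {d} {x} {y} r e = trans (solve 2 (λ x y → x := (x :- y) :+ y) refl x y)
      (trans (+-congʳ (cancel₀ r (trans (solve 3 (λ d x y → d :* (x :- y) := d :* x :- d :* y) refl d x y) (trans (+-congʳ e) (-‿inverseʳ _))))) (+-identityˡ y))

    -- The total ring of fractions: every non-zero-divisor becomes a unit and no nonzero element is
    -- killed, so a vanishing fraction has vanishing numerator.
    record Fraction : Set where
      constructor frac
      field
        numer denom : Carrier
        denom-regular : Regular denom
    open Fraction public

    infix 4 _≃_
    record _≃_ (x y : Fraction) : Set where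
      constructor mk≃
      field cross : numer x * denom y ≈ numer y * denom x
    open _≃_ public

    private
      _⊕_ _⊗_ : Fraction → Fraction → Fraction
      x ⊕ y = frac (numer x * denom y + numer y * denom x) (denom x * denom y) (regular-* (denom-regular x) (denom-regular y))
      x ⊗ y = frac (numer x * numer y) (denom x * denom y) (regular-* (denom-regular x) (denom-regular y))

      ⊖_ : Fraction → Fraction
      ⊖ x = frac (- numer x) (denom x) (denom-regular x)

      0L 1L : Fraction
      0L = frac 0# 1# regular-1
      1L = frac 1# 1# regular-1

      -- Cancelling the middle denominator is where regularity is used.
      trans-≃ : ∀ {x y z} → x ≃ y → y ≃ z → x ≃ z
      trans-≃ {frac n d r} {frac n′ d′ r′} {frac n″ d″ r″} (mk≃ e) (mk≃ f) = mk≃ (regular-cancel r′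
        (trans (solve 3 (λ n d′ d″ → d′ :* (n :* d″) := (n :* d′) :* d″) refl n d′ d″) (trans (*-congʳ e)
          (trans (solve 3 (λ n′ d d″ → (n′ :* d) :* d″ := (n′ :* d″) :* d) refl n′ d d″) (trans (*-congʳ f)
            (solve 3 (λ n″ d d′ → (n″ :* d′) :* d := d′ :* (n″ :* d)) refl n″ d d′))))))

      ⊕-cong : ∀ {x y u v} → x ≃ y → u ≃ v → x ⊕ u ≃ y ⊕ v
      ⊕-cong {frac n d _} {frac n′ d′ _} {frac k e _} {frac k′ e′ _} (mk≃ p) (mk≃ r) = mk≃
        (trans (solve 6 (λ n d k e d′ e′ → (n :* e :+ k :* d) :* (d′ :* e′) := (n :* d′) :* (e :* e′) :+ (k :* e′) :* (d :* d′)) refl n d k e d′ e′)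
          (trans (+-cong (*-congʳ p) (*-congʳ r))
            (solve 6 (λ n′ d′ k′ e′ d e → (n′ :* d) :* (e :* e′) :+ (k′ :* e) :* (d :* d′) := (n′ :* e′ :+ k′ :* d′) :* (d :* e)) refl n′ d′ k′ e′ d e)))

      ⊗-cong : ∀ {x y u v} → x ≃ y → u ≃ v → x ⊗ u ≃ y ⊗ v
      ⊗-cong {frac n d _} {frac n′ d′ _} {frac k e _} {frac k′ e′ _} (mk≃ p) (mk≃ r) = mk≃
        (trans (solve 4 (λ n k d′ e′ → (n :* k) :* (d′ :* e′) := (n :* d′) :* (k :* e′)) refl n k d′ e′)
          (trans (*-cong p r) (solve 4 (λ n d k e → (n :* d) :* (k :* e) := (n :* k) :* (d :* e)) refl n′ d k′ e)))

      ⊖-cong : ∀ {x y} → x ≃ y → ⊖ x ≃ ⊖ y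
      ⊖-cong {frac n d _} {frac n′ d′ _} (mk≃ p) = mk≃ (trans (solve 2 (λ n d → (:- n) :* d := :- (n :* d)) refl n d′)
        (trans (-‿cong p) (solve 2 (λ n d → :- (n :* d) := (:- n) :* d) refl n′ d)))

      0′ : ∀ {n} → Polynomial n
      0′ = con (ℤ.+ 0)
        where import Data.Integer as ℤ

    localRing : CommutativeRing 0ℓ 0ℓ
    localRing = record
      { Carrier = Fraction ; _≈_ = _≃_ ; _+_ = _⊕_ ; _*_ = _⊗_ ; -_ = ⊖_ ; 0# = 0L ; 1# = 1L
      ; isCommutativeRing = record
        { isRing = record
          { +-isAbelianGroup = record
            { isGroup = record
              { isMonoid = record
                { isSemigroup = record
                  { isMagma = record
                    { isEquivalence = record { refl = mk≃ refl ; sym = λ e → mk≃ (sym (cross e)) ; trans = trans-≃ }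
                    ; ∙-cong = ⊕-cong }
                  ; assoc = λ (frac n d _) (frac k e _) (frac l f _) → mk≃ (solve 6 (λ n d k e l f →
                      ((n :* e :+ k :* d) :* f :+ l :* (d :* e)) :* (d :* (e :* f)) := (n :* (e :* f) :+ (k :* f :+ l :* e) :* d) :* ((d :* e) :* f)) refl n d k e l f) }
                ; identity = (λ (frac n d _) → mk≃ (solve 2 (λ n d → (0′ :* d :+ n :* :1) :* d := n :* (:1 :* d)) refl n d))
                           , (λ (frac n d _) → mk≃ (solve 2 (λ n d → (n :* :1 :+ 0′ :* d) :* d := n :* (d :* :1)) refl n d)) }
              ; inverse = (λ (frac n d _) → mk≃ (solve 2 (λ n d → ((:- n) :* d :+ n :* d) :* :1 := 0′ :* (d :* d)) refl n d))
                        , (λ (frac n d _) → mk≃ (solve 2 (λ n d → (n :* d :+ (:- n) :* d) :* :1 := 0′ :* (d :* d)) refl n d))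
              ; ⁻¹-cong = ⊖-cong }
            ; comm = λ (frac n d _) (frac k e _) → mk≃ (solve 4 (λ n d k e → (n :* e :+ k :* d) :* (e :* d) := (k :* d :+ n :* e) :* (d :* e)) refl n d k e) }
          ; *-cong = ⊗-cong
          ; *-assoc = λ (frac n d _) (frac k e _) (frac l f _) → mk≃ (solve 6 (λ n d k e l f →
              ((n :* k) :* l) :* (d :* (e :* f)) := (n :* (k :* l)) :* ((d :* e) :* f)) refl n d k e l f)
          ; *-identity = (λ (frac n d _) → mk≃ (solve 2 (λ n d → (:1 :* n) :* d := n :* (:1 :* d)) refl n d))
                       , (λ (frac n d _) → mk≃ (solve 2 (λ n d → (n :* :1) :* d := n :* (d :* :1)) refl n d))
          ; distrib = (λ (frac n d _) (frac k e _) (frac l f _) → mk≃ (solve 6 (λ n d k e l f →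
                (n :* (k :* f :+ l :* e)) :* ((d :* e) :* (d :* f)) := ((n :* k) :* (d :* f) :+ (n :* l) :* (d :* e)) :* (d :* (e :* f))) refl n d k e l f))
            , (λ (frac n d _) (frac k e _) (frac l f _) → mk≃ (solve 6 (λ n d k e l f →
                ((k :* f :+ l :* e) :* n) :* ((e :* d) :* (f :* d)) := ((k :* n) :* (f :* d) :+ (l :* n) :* (e :* d)) :* ((e :* f) :* d)) refl n d k e l f)) }
        ; *-comm = λ (frac n d _) (frac k e _) → mk≃ (solve 4 (λ n d k e → (n :* k) :* (e :* d) := (k :* n) :* (d :* e)) refl n d k e) } }

    private module L = CommutativeRing localRing

    ι : Carrier → Fraction
    ι x = frac x 1# regular-1

    ι-cong : ∀ {x y} → x ≈ y → ι x ≃ ι y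
    ι-cong e = mk≃ (*-congʳ e)

    ι-* : ∀ x y → ι (x * y) ≃ ι x L.* ι y
    ι-* x y = mk≃ (solve 2 (λ x y → (x :* y) :* (:1 :* :1) := (x :* y) :* :1) refl x y)

    ι-minus : ∀ x y → ι (x - y) ≃ ι x L.- ι y
    ι-minus x y = mk≃ (solve 2 (λ x y → (x :- y) :* (:1 :* :1) := (x :* :1 :+ (:- y) :* :1) :* :1) refl x y)

    reciprocal : ∀ {d} → Regular d → Fraction
    reciprocal {d} r = frac 1# d r

    ι-reciprocal : ∀ {d} (r : Regular d) → ι d L.* reciprocal r ≃ L.1#
    ι-reciprocal {d} r = mk≃ (solve 1 (λ d → (d :* :1) :* :1 := :1 :* (:1 :* d)) refl d)

    -- The product of the numerators equals a product of regular denominators, and a factor of a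
    -- regular element is regular.
    unit⇒regular : ∀ {x y} → x L.* y ≃ L.1# → Regular (numer x)
    unit⇒regular {frac n d r} {frac k e s} (mk≃ u) = regular-factor k
      (regular-resp (trans (sym (*-identityˡ _)) (trans (sym u) (*-identityʳ _))) (regular-* r s))

-- Values of formal fractions in the localisation.

module Represent (K : CommutativeRing 0ℓ 0ℓ) (I : Interpretation K) where
  open CommutativeRing K
  open Interpretation I
  open import Data.List using (applyUpTo)
  open IntSolver K
  open Localize.Localization K
  open Eval using (module Power)
  open QSeries

  module L = CommutativeRing localRing
  module LP = Power localRing
  open Pochhammer localRing using (pochR)
  open Sums localRing using (sum)

  private
    module InverseUnique (R : CommutativeRing 0ℓ 0ℓ) where
      module M = CommutativeRing R
      inverse-unique : ∀ x y z → x M.* y M.≈ M.1# → x M.* z M.≈ M.1# → y M.≈ z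
      inverse-unique x y z e f = M.trans (M.sym (M.*-identityʳ y)) (M.trans (M.*-congˡ (M.sym f)) (M.trans (M.sym (M.*-assoc y x z))
        (M.trans (M.*-congʳ (M.trans (M.*-comm y x) e)) (M.*-identityˡ z))))

  -- x ⊢ ℓ: the formal fraction x is defined in the localisation, where its value is ℓ.
  infix 4 _⊢_
  record _⊢_ (x : Frac) (ℓ : Fraction) : Set where
    constructor rep
    field
      den-regular : Regular (φ (den x))
      value : φ (num x) * denom ℓ ≈ numer ℓ * φ (den x)
  open _⊢_ public

  private
    asFraction : ∀ {x ℓ} → x ⊢ ℓ → Fraction
    asFraction {x} r = frac (φ (num x)) (φ (den x)) (den-regular r)

    asFraction≃ : ∀ {x ℓ} (r : x ⊢ ℓ) → asFraction r ≃ ℓ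
    asFraction≃ r = mk≃ (value r)

    fromFraction : ∀ {x} y ℓ → y ≃ ℓ → φ (num x) ≈ numer y → φ (den x) ≈ denom y → x ⊢ ℓ
    fromFraction y ℓ (mk≃ c) n d = rep (regular-resp (sym d) (denom-regular y)) (trans (*-congʳ n) (trans c (*-congˡ (sym d))))

  ⊢-resp : ∀ {x ℓ k} → ℓ ≃ k → x ⊢ ℓ → x ⊢ k
  ⊢-resp e r = rep (den-regular r) (cross (L.trans (asFraction≃ r) e))

  ⊢-+ : ∀ {x y ℓ k} → x ⊢ ℓ → y ⊢ k → x +f y ⊢ ℓ L.+ k
  ⊢-+ {n / d} {n′ / d′} {ℓ} {k} r s = fromFraction (asFraction r L.+ asFraction s) (ℓ L.+ k) (L.+-cong {asFraction r} {ℓ} {asFraction s} {k} (asFraction≃ r) (asFraction≃ s))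
    (trans (φ-+ _ _) (+-cong (φ-* n d′) (φ-* n′ d))) (φ-* d d′)

  ⊢-minus : ∀ {x y ℓ k} → x ⊢ ℓ → y ⊢ k → x -f y ⊢ ℓ L.- k
  ⊢-minus {n / d} {n′ / d′} {ℓ} {k} r s = fromFraction (asFraction r L.- asFraction s) (ℓ L.- k) (L.+-cong {asFraction r} {ℓ} {L.- asFraction s} {L.- k} (asFraction≃ r) (L.-‿cong {asFraction s} {k} (asFraction≃ s)))
    (trans (φ-minus _ _) (trans (+-cong (φ-* n d′) (-‿cong (φ-* n′ d)))
      (solve 3 (λ a x y → a :- x :* y := a :+ (:- x) :* y) refl (φ n * φ d′) (φ n′) (φ d)))) (φ-* d d′)

  ⊢-* : ∀ {x y ℓ k} → x ⊢ ℓ → y ⊢ k → x *f y ⊢ ℓ L.* k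
  ⊢-* {n / d} {n′ / d′} {ℓ} {k} r s = fromFraction (asFraction r L.* asFraction s) (ℓ L.* k) (L.*-cong {asFraction r} {ℓ} {asFraction s} {k} (asFraction≃ r) (asFraction≃ s))
    (φ-* n n′) (φ-* d d′)

  -- Formal division makes the numerator of `y` a denominator. It is regular because the value of
  -- `y` has the inverse `k′`, and the inverse fraction equals `k′` by uniqueness of inverses.
  ⊢-÷ : ∀ {x y ℓ k k′} → x ⊢ ℓ → y ⊢ k → k L.* k′ ≃ L.1# → x ÷f y ⊢ ℓ L.* k′
  ⊢-÷ {y = n / d} {ℓ} {k} {k′} r s u = ⊢-* {ℓ = ℓ} {k = k′} r (rep n-regular (cross inverse))
    where
    sk′≃1 : asFraction s L.* k′ ≃ L.1#
    sk′≃1 = L.trans (L.*-congʳ {k′} {asFraction s} {k} (asFraction≃ s)) u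
    n-regular : Regular (φ n)
    n-regular = unit⇒regular {asFraction s} {k′} sk′≃1
    y⁻¹ : Fraction
    y⁻¹ = frac (φ d) (φ n) n-regular
    inverse : y⁻¹ ≃ k′
    inverse = InverseUnique.inverse-unique localRing (asFraction s) y⁻¹ k′ unit sk′≃1
      where
      unit : asFraction s L.* y⁻¹ ≃ L.1#
      unit = mk≃ (solve 2 (λ d n → (n :* d) :* :1 := :1 :* (d :* n)) refl (φ d) (φ n))

  ⊢-poly : ∀ p → poly p ⊢ ι (φ p)
  ⊢-poly p = fromFraction (ι (φ p)) _ L.refl refl φ-1

  ⊢-1 : 1f ⊢ L.1#
  ⊢-1 = fromFraction L.1# _ L.refl φ-1 φ-1

  ⊢-0 : poly 0ₚ ⊢ L.0#
  ⊢-0 = fromFraction L.0# _ L.refl φ-0 φ-1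

  ⊢-^ : ∀ {x ℓ} k → x ⊢ ℓ → x ^f k ⊢ ℓ LP.^ k
  ⊢-^ ℕ.zero r = ⊢-1
  ⊢-^ (suc k) r = ⊢-* r (⊢-^ k r)

  ⊢-poch : ∀ {x p ℓ k} n → x ⊢ ℓ → p ⊢ k → poch x p n ⊢ pochR ℓ k n
  ⊢-poch ℕ.zero r s = ⊢-1
  ⊢-poch (suc n) r s = ⊢-* (⊢-poch n r s) (⊢-minus ⊢-1 (⊢-* r (⊢-^ n s)))

  ⊢-sumTo : ∀ m {f g} → (∀ k → k ≤ m → f k ⊢ g k) → sumTo m f ⊢ sum (suc m) g
  ⊢-sumTo m {f} {g} r = go (suc m) (λ i → i) g λ i i<n → r i (ℕ.≤-pred i<n)
    where
    -- `upTo` is `applyUpTo` at the identity; the recursion composes that function with successors,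
    -- so it is generalised to `h`.
    go : ∀ n (h : ℕ → ℕ) g → (∀ i → i < n → f (h i) ⊢ g i) → foldr _+f_ (poly 0ₚ) (map f (applyUpTo h n)) ⊢ sum n g
    go ℕ.zero h g r = ⊢-0
    go (suc n) h g r = ⊢-+ (r 0 (s≤s z≤n)) (go n (λ i → h (suc i)) (λ i → g (suc i)) λ i i<n → r (suc i) (s≤s i<n))

  -- The way out of the localisation: the formal difference represents 0, whose denominator is 1, so
  -- its numerator is zero in `K` itself.
  difference-vanishes : ∀ {x y ℓ k} → x ⊢ ℓ → y ⊢ k → ℓ ≃ k → φ (num (x -f y)) ≈ 0#
  difference-vanishes {ℓ = ℓ} {k} r s e = trans (sym (*-identityʳ _)) (trans (value (⊢-resp zero≃ (⊢-minus r s))) (zeroˡ _))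
    where
    zero≃ : ℓ L.- k ≃ L.0#
    zero≃ = L.trans (L.+-congʳ {L.- k} {ℓ} {k} e) (L.-‿inverseʳ k)

-- Both sides of the congruence in the localised quotient.

module Assembly where
  open Eval using (module Power)
  open QSeries

  record Model : Set₁ where
    field
      L : CommutativeRing 0ℓ 0ℓ
    open CommutativeRing L
    open Power L
    open Pochhammer L
    open Sums L
    field
      _⊢_ : Frac → Carrier → Set
      ⊢-* : ∀ {x y ℓ k} → x ⊢ ℓ → y ⊢ k → (x *f y) ⊢ (ℓ * k)
      ⊢-+ : ∀ {x y ℓ k} → x ⊢ ℓ → y ⊢ k → (x +f y) ⊢ (ℓ + k)
      ⊢-÷ : ∀ {x y ℓ k k′} → x ⊢ ℓ → y ⊢ k → k * k′ ≈ 1# → (x ÷f y) ⊢ (ℓ * k′)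
      ⊢-1 : 1f ⊢ 1#
      ⊢-0 : poly 0ₚ ⊢ 0#
      ⊢-^ : ∀ {x ℓ} k → x ⊢ ℓ → (x ^f k) ⊢ (ℓ ^ k)
      ⊢-poch : ∀ {x p ℓ k} n → x ⊢ ℓ → p ⊢ k → poch x p n ⊢ pochR ℓ k n
      ⊢-sumTo : ∀ m {f g} → (∀ k → k ≤ m → f k ⊢ g k) → sumTo m f ⊢ sum (suc m) g

  module Assemble (M : Model) (q q′ a a′ b b′ : CommutativeRing.Carrier (Model.L M))
    (qf⊢q : Model._⊢_ M qf q) (af⊢a : Model._⊢_ M af a) (bf⊢b : Model._⊢_ M bf b)
    (qq′≈1 : Inverse (Model.L M) q q′) (aa′≈1 : Inverse (Model.L M) a a′) (bb′≈1 : Inverse (Model.L M) b b′) where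
    open Model M
    open CommutativeRing L
    open Power L
    open Pochhammer L
    open Sums L
    open IntSolver L
    open Transformation L q q′ qq′≈1

    Unit : Carrier → Set
    Unit x = Σ Carrier λ y → x * y ≈ 1#

    inverse-* : ∀ {x y u v} → x * u ≈ 1# → y * v ≈ 1# → (x * y) * (u * v) ≈ 1#
    inverse-* {x} {y} {u} {v} e f =
      trans (solve 4 (λ x y u v → (x :* y) :* (u :* v) := (x :* u) :* (y :* v)) refl x y u v) (trans (*-cong e f) (*-identityˡ 1#))

    unit-* : ∀ {x y} → Unit x → Unit y → Unit (x * y)
    unit-* (u , e) (v , f) = u * v , inverse-* e f

    unit-resp : ∀ {x y} → x ≈ y → Unit x → Unit y
    unit-resp e (u , f) = u , trans (*-congʳ (sym e)) f

    inverses : ∀ n (f : ℕ → Carrier) → (∀ i → i < n → Unit (f i)) → Σ (ℕ → Carrier) λ g → ∀ i → i < n → f i * g i ≈ 1#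
    inverses n f u = g , g-inverse
      where
      g : ℕ → Carrier
      g i with i ℕ.<? n
      ... | yes i<n = proj₁ (u i i<n)
      -- An arbitrary default; inverses are only guaranteed below `n`.
      ... | no _ = 0#
      g-inverse : ∀ i → i < n → f i * g i ≈ 1#
      g-inverse i i<n with i ℕ.<? n
      ... | yes i<n′ = proj₂ (u i i<n′)
      ... | no i≮n = contradiction i<n i≮n

    poch-unit : ∀ x m → (∀ i → i < m → Unit (1# - x * Q ^ i)) → ∀ k → k < suc m → Unit (pochR x Q k)
    poch-unit x m u ℕ.zero _ = 1# , *-identityˡ 1#
    poch-unit x m u (suc k) (s≤s k<m) = unit-* (poch-unit x m u k (s≤s (ℕ.<⇒≤ k<m))) (u k k<m)

    UnitsBelow : ℕ → (ℕ → Carrier) → Set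
    UnitsBelow n f = ∀ i → ℕ.NonZero i → i < n → Unit (f i)

    module _ (m : ℕ)
      (1-qⁱ : UnitsBelow (2 ℕ.* m ℕ.+ 1) (λ i → 1# - q ^ i)) (1-aqⁱ : UnitsBelow (2 ℕ.* m ℕ.+ 1) (λ i → 1# - a * q ^ i))
      (1-a′qⁱ : UnitsBelow (2 ℕ.* m ℕ.+ 1) (λ i → 1# - a′ * q ^ i)) (1-b′qⁱ : UnitsBelow (2 ℕ.* m ℕ.+ 1) (λ i → 1# - b′ * q ^ i)) where

      private
        n : ℕ
        n = 2 ℕ.* m ℕ.+ 1

        even< : ∀ {k} → k < m → 2 ℕ.* suc k < n
        even< {k} k<m = ℕ.≤-trans (s≤s (ℕ.*-monoʳ-≤ 2 k<m)) (ℕ.≤-reflexive (ℕ.+-comm 1 (2 ℕ.* m)))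
        odd< : ∀ {k} → k < m → 2 ℕ.* k ℕ.+ 1 < n
        odd< k<m = ℕ.+-monoˡ-< 1 (ℕ.*-monoʳ-< 2 k<m)
        odd-nonZero : ∀ k → ℕ.NonZero (2 ℕ.* k ℕ.+ 1)
        odd-nonZero k = ≡.subst ℕ.NonZero (ℕ.+-comm 1 (2 ℕ.* k)) _

        -- Denominators contribute the exponents 2, 4, ..., 2m of `q`, and the recurrence for the
        -- inner sums the exponents 1, 3, ..., 2m-1. All lie strictly between 0 and n, which is the
        -- range in which units are assumed.
        even-factor : ∀ {c x} → c * Q ≈ x → UnitsBelow n (λ i → 1# - c * q ^ i) → ∀ k → k < suc m → Unit (pochR x Q k)
        even-factor {c} {x} e u = poch-unit x m λ k k<m → unit-resp
          (+-congˡ (-‿cong (trans (*-congˡ (q^2k (suc k))) (trans (sym (*-assoc c Q (Q ^ k))) (*-congʳ e))))) (u (2 ℕ.* suc k) _ (even< k<m))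

        odd-factor : ∀ c → UnitsBelow n (λ i → 1# - c * q ^ i) → ∀ k → k < m → Unit (1# - c * (q * Q ^ k))
        odd-factor c u k k<m = unit-resp (+-congˡ (-‿cong (*-congˡ (q^2k+1 k)))) (u (2 ℕ.* k ℕ.+ 1) (odd-nonZero k) (odd< k<m))

        1*1-qⁱ : UnitsBelow n (λ i → 1# - 1# * q ^ i)
        1*1-qⁱ i i≢0 i<n = unit-resp (+-congˡ (-‿cong (sym (*-identityˡ _)))) (1-qⁱ i i≢0 i<n)

        α = inverses (suc m) (pochR (a * Q) Q) (even-factor refl 1-aqⁱ)
        α′ = inverses (suc m) (pochR (Q * a′) Q) (even-factor (*-comm a′ Q) 1-a′qⁱ)
        β = inverses (suc m) (pochR (Q * b′) Q) (even-factor (*-comm b′ Q) 1-b′qⁱ)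
        δ = inverses (suc m) (pochR Q Q) (even-factor (*-identityˡ Q) 1*1-qⁱ)

      open Identity a a′ b b′ aa′≈1 bb′≈1 m (proj₁ α) (proj₁ α′) (proj₁ β) (proj₁ δ)
        (λ k k≤m → proj₂ α k (s≤s k≤m)) (λ k k≤m → proj₂ α′ k (s≤s k≤m)) (λ k k≤m → proj₂ β k (s≤s k≤m)) (λ k k≤m → proj₂ δ k (s≤s k≤m))
        public

      private
        q2⊢Q : q2 ⊢ Q
        q2⊢Q = ⊢-* qf⊢q qf⊢q

        qint⊢ : ∀ k → qint k ⊢ qintR k
        qint⊢ ℕ.zero = ⊢-0
        qint⊢ (suc k) = ⊢-+ (qint⊢ k) (⊢-^ k qf⊢q)

        A⊢ : ∀ k → poch (af *f qf) q2 k ⊢ A k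
        A⊢ k = ⊢-poch k (⊢-* af⊢a qf⊢q) q2⊢Q
        A′⊢ : ∀ k → poch (qf ÷f af) q2 k ⊢ A′ k
        A′⊢ k = ⊢-poch k (⊢-÷ qf⊢q af⊢a aa′≈1) q2⊢Q
        D⊢ : ∀ k → poch qf q2 k ⊢ D k
        D⊢ k = ⊢-poch k qf⊢q q2⊢Q
        β⊢ : ∀ k → poch (q2 ÷f bf) q2 k ⊢ pochR (Q * b′) Q k
        β⊢ k = ⊢-poch k (⊢-÷ q2⊢Q bf⊢b bb′≈1) q2⊢Q
        δ³⊢ : ∀ k → (poch q2 q2 k ^f 3) ⊢ (pochR Q Q k ^ 3)
        δ³⊢ k = ⊢-^ 3 (⊢-poch k q2⊢Q q2⊢Q)

        cube-inverse : ∀ {x y} → x * y ≈ 1# → x ^ 3 * y ^ 3 ≈ 1#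
        cube-inverse {x} {y} e = trans (sym (^-*-distrib x y 3)) (trans (^-cong 3 e) (1^ 3))

        q^q′^ : ∀ k → q ^ k * q′ ^ k ≈ 1#
        q^q′^ k = trans (sym (^-*-distrib q q′ k)) (trans (^-cong k qq′≈1) (1^ k))

      private
        lhsTerm⊢ : ∀ k → k ≤ m → lhsTerm k ⊢ lhsTermR k
        lhsTerm⊢ k k≤m = ⊢-* (⊢-* (qint⊢ (4 ℕ.* k ℕ.+ 1)) (⊢-÷ numerator denominator inverse)) (⊢-^ k (⊢-÷ qf⊢q bf⊢b bb′≈1))
          where
          numerator = ⊢-* (⊢-* (⊢-* (A⊢ k) (A′⊢ k)) (⊢-poch k (⊢-* bf⊢b qf⊢q) q2⊢Q)) (⊢-^ 3 (D⊢ k))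
          denominator = ⊢-* (⊢-* (⊢-* (⊢-poch k (⊢-* af⊢a q2⊢Q) q2⊢Q) (⊢-poch k (⊢-÷ q2⊢Q af⊢a aa′≈1) q2⊢Q)) (β⊢ k)) (δ³⊢ k)
          inverse = inverse-* (inverse-* (inverse-* (proj₂ α k (s≤s k≤m)) (proj₂ α′ k (s≤s k≤m))) (proj₂ β k (s≤s k≤m))) (cube-inverse (proj₂ δ k (s≤s k≤m)))

        rhsTerm⊢ : ∀ k → k ≤ m → rhsTerm k ⊢ rhsTermR k
        rhsTerm⊢ k k≤m = ⊢-* (⊢-÷ numerator (⊢-* (β⊢ k) (δ³⊢ k)) inverse) (⊢-^ (2 ℕ.* k) qf⊢q)
          where
          numerator = ⊢-* (⊢-* (⊢-* (A⊢ k) (A′⊢ k)) (⊢-poch k (⊢-÷ qf⊢q bf⊢b bb′≈1) q2⊢Q)) (D⊢ k)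
          inverse = inverse-* (proj₂ β k (s≤s k≤m)) (cube-inverse (proj₂ δ k (s≤s k≤m)))

      LHS⊢ : LHS m ⊢ LHSR
      LHS⊢ = ⊢-sumTo m lhsTerm⊢

      RHS⊢ : RHS m ⊢ RHSR
      RHS⊢ = ⊢-* (⊢-* (qint⊢ (2 ℕ.* m ℕ.+ 1)) (⊢-÷ ⊢-1 (⊢-^ m qf⊢q) (q^q′^ m))) (⊢-sumTo m rhsTerm⊢)

      private
        1-x≈0 : ∀ {x} → x ≈ 1# → 1# - x ≈ 0#
        1-x≈0 e = trans (+-congˡ (-‿cong e)) (-‿inverseʳ 1#)

        other-inverse : ∀ {x y} → x * y ≈ 1# → x ≈ q * Q ^ m → y ≈ q′ * Q′ ^ m
        other-inverse {x} {y} e f = cancel-unit e (trans e (sym (trans (*-congʳ f)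
          (trans (solve 4 (λ q y i v → (q :* y) :* (i :* v) := (q :* i) :* (y :* v)) refl q (Q ^ m) q′ (Q′ ^ m))
            (trans (*-cong qq′≈1 (Q^Q′^ m)) (*-identityˡ 1#))))))

        N-units : Σ (ℕ → Carrier) λ unit → ∀ j → j < m → IS.N (Q ^ j) * (1# - q * Q ^ j) * unit j ≈ 1#
        N-units = inverses m _ λ j j<m → unit-* (unit-* (odd-factor a 1-aqⁱ j j<m) (odd-factor a′ 1-a′qⁱ j j<m))
          (unit-resp (+-congˡ (-‿cong (*-identityˡ _))) (odd-factor 1# 1*1-qⁱ j j<m))

        scaled : q ^ n ≈ 1# ⊎ (a ≈ q ^ n ⊎ a′ ≈ q ^ n) → (1# - q) * LHSR ≈ (1# - q) * RHSR
        scaled (inj₁ qⁿ≈1) = transformation (trans (*-congˡ (1-x≈0 qQ^m≈1)) (zeroʳ _)) _ (proj₂ N-units) (base-root-of-unity m qQ^m≈1)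
          where
          qQ^m≈1 : q * Q ^ m ≈ 1#
          qQ^m≈1 = trans (sym (q^2k+1 m)) qⁿ≈1
        scaled (inj₂ (inj₁ e)) = transformation
          (trans (*-congʳ (trans (*-congˡ (1-x≈0 (trans (*-comm a′ _) (trans (*-congʳ (sym a≈)) aa′≈1)))) (zeroʳ _))) (zeroˡ _)) _ (proj₂ N-units)
          (base-terminating m a≈ (other-inverse aa′≈1 a≈))
          where
          a≈ : a ≈ q * Q ^ m
          a≈ = trans e (q^2k+1 m)
        scaled (inj₂ (inj₂ e)) = transformation
          (trans (*-congʳ (trans (*-congʳ (1-x≈0 (trans (*-congˡ (sym a′≈)) aa′≈1))) (zeroˡ _))) (zeroˡ _)) _ (proj₂ N-units)
          -- The situation is symmetric in `a` and `a′`: the evaluation at q^n is applied to `a′`,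
          -- and the two Pochhammer factors are swapped back.
          (trans (base-terminating m a′≈ (other-inverse (trans (*-comm a′ a) aa′≈1) a′≈))
            (*-congˡ (*-congʳ (trans (*-comm _ _) (*-cong (poch-cong Q m (*-comm Q a)) (poch-cong Q m (*-comm a′ Q)))))))
          where
          a′≈ : a′ ≈ q * Q ^ m
          a′≈ = trans e (q^2k+1 m)

      LHSR≈RHSR : q ^ n ≈ 1# ⊎ (a ≈ q ^ n ⊎ a′ ≈ q ^ n) → LHSR ≈ RHSR
      LHSR≈RHSR cases = by-cases (m ℕ.≟ 0)
        where
        by-cases : Dec (m ≡ 0) → LHSR ≈ RHSR
        by-cases (yes m≡0) = degenerate m≡0
        -- For `m` nonzero 1 < n, so `1# - q` is among the given units.
        by-cases (no m≢0) = cancel-unit (trans (*-congʳ (+-congˡ (-‿cong (sym (*-identityʳ q)))))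
          (proj₂ (1-qⁱ 1 _ (ℕ.+-monoˡ-< 1 (ℕ.*-monoʳ-< 2 (ℕ.n≢0⇒n>0 m≢0)))))) (scaled cases)

-- From regular polynomial factors to the vanishing of the numerator.

module Bridge (K : CommutativeRing 0ℓ 0ℓ) (I : Interpretation K) where
  open CommutativeRing K
  open Interpretation I
  open Localize.Localization K using (Regular)
  open Eval using (module Power)
  open Assembly
  open Power K

  private
    module InverseLemmas (R : CommutativeRing 0ℓ 0ℓ) where
      module M = CommutativeRing R
      open IntSolver R
      inverse-difference : ∀ a a′ x → a M.* a′ M.≈ M.1# → a′ M.* (a M.- x) M.≈ M.1# M.- a′ M.* x
      inverse-difference a a′ x e = M.trans (solve 3 (λ a c x → c :* (a :- x) := a :* c :- c :* x) M.refl a a′ x) (M.+-congʳ e)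

      inverse-of : ∀ a a′ x → a M.* a′ M.≈ M.1# → a M.* x M.≈ M.1# → a′ M.≈ x
      inverse-of a a′ x e f = M.trans (M.sym (M.*-identityʳ a′)) (M.trans (M.*-congˡ (M.sym f))
        (M.trans (solve 3 (λ a c x → c :* (a :* x) := (a :* c) :* x) M.refl a a′ x) (M.trans (M.*-congʳ e) (M.*-identityˡ x))))

  record LocalModel : Set₁ where
    field model : Model
    open Model model public
    module L = CommutativeRing L
    module LP = Power L
    field
      ι : Carrier → L.Carrier
      ι-cong : ∀ {x y} → x ≈ y → ι x L.≈ ι y
      ι-1 : ι 1# L.≈ L.1#
      ι-* : ∀ x y → ι (x * y) L.≈ ι x L.* ι y
      ι-minus : ∀ x y → ι (x - y) L.≈ ι x L.- ι y
      reciprocal : ∀ {x} → Regular x → L.Carrier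
      ι-reciprocal : ∀ {x} (r : Regular x) → ι x L.* reciprocal r L.≈ L.1#
      ⊢-poly : ∀ p → poly p ⊢ ι (φ p)
      ⊢-minus : ∀ {x y ℓ k} → x ⊢ ℓ → y ⊢ k → (x -f y) ⊢ (ℓ L.- k)
      den-regular : ∀ {x ℓ} → x ⊢ ℓ → Regular (φ (den x))
      difference-vanishes : ∀ {x y ℓ k} → x ⊢ ℓ → y ⊢ k → ℓ L.≈ k → φ (num (x -f y)) ≈ 0#

  q a b : Carrier
  q = φ qₚ
  a = φ aₚ
  b = φ bₚ

  -- The denominators contain 1 - q^i/a and 1 - q^i/b. Regularity is a condition on polynomials,
  -- hence the forms `a - q ^ i` and `b - q ^ i`, which differ from these by a unit in the
  -- localisation.
  record RegularFactors (n : ℕ) : Set where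
    field
      q-regular : Regular q
      a-regular : Regular a
      b-regular : Regular b
      1-qⁱ : ∀ i → ℕ.NonZero i → i < n → Regular (1# - q ^ i)
      1-aqⁱ : ∀ i → ℕ.NonZero i → i < n → Regular (1# - a * q ^ i)
      a-qⁱ : ∀ i → ℕ.NonZero i → i < n → Regular (a - q ^ i)
      b-qⁱ : ∀ i → ℕ.NonZero i → i < n → Regular (b - q ^ i)

  module WithModel (M : LocalModel) (m : ℕ) (r : RegularFactors (2 ℕ.* m ℕ.+ 1)) where
    open LocalModel M
    open RegularFactors r
    open InverseLemmas L

    private
      n = 2 ℕ.* m ℕ.+ 1
      qL aL bL q′ a′ b′ : L.Carrier
      qL = ι q
      aL = ι a
      bL = ι b
      q′ = reciprocal q-regular
      a′ = reciprocal a-regular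
      b′ = reciprocal b-regular

      open Assemble model qL q′ aL a′ bL b′ (⊢-poly qₚ) (⊢-poly aₚ) (⊢-poly bₚ)
        (ι-reciprocal q-regular) (ι-reciprocal a-regular) (ι-reciprocal b-regular)

      ι-^ : ∀ x i → ι (x ^ i) L.≈ ι x LP.^ i
      ι-^ x ℕ.zero = ι-1
      ι-^ x (suc i) = L.trans (ι-* x (x ^ i)) (L.*-congˡ (ι-^ x i))

      regular⇒unit : ∀ {x ℓ} → ι x L.≈ ℓ → Regular x → Unit ℓ
      regular⇒unit e s = reciprocal s , L.trans (L.*-congʳ (L.sym e)) (ι-reciprocal s)

      ι-difference : ∀ x i → ι (x - q ^ i) L.≈ ι x L.- qL LP.^ i
      ι-difference x i = L.trans (ι-minus x (q ^ i)) (L.+-congˡ (L.-‿cong (ι-^ q i)))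

      ι-aqⁱ : ∀ i → ι (a * q ^ i) L.≈ aL L.* qL LP.^ i
      ι-aqⁱ i = L.trans (ι-* a (q ^ i)) (L.*-congˡ (ι-^ q i))

      inverse-unit : ∀ {x} (s : Regular x) i → Regular (x - q ^ i) → Unit (L.1# L.- reciprocal s L.* qL LP.^ i)
      inverse-unit {x} s i t with regular⇒unit (ι-difference x i) t
      ... | y , e = ι x L.* y , L.trans (L.*-congʳ (L.sym (inverse-difference (ι x) x′ (qL LP.^ i) (ι-reciprocal s))))
            (inverse-* (L.trans (L.*-comm x′ (ι x)) (ι-reciprocal s)) e)
        where x′ = reciprocal s

      u₁ : UnitsBelow n (λ i → L.1# L.- qL LP.^ i)
      u₁ i i≢0 i<n = regular⇒unit (L.trans (ι-difference 1# i) (L.+-congʳ ι-1)) (1-qⁱ i i≢0 i<n)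

      u₂ : UnitsBelow n (λ i → L.1# L.- aL L.* qL LP.^ i)
      u₂ i i≢0 i<n = regular⇒unit (L.trans (ι-minus 1# (a * q ^ i)) (L.+-cong ι-1 (L.-‿cong (ι-aqⁱ i)))) (1-aqⁱ i i≢0 i<n)

      u₃ : UnitsBelow n (λ i → L.1# L.- a′ L.* qL LP.^ i)
      u₃ i i≢0 i<n = inverse-unit a-regular i (a-qⁱ i i≢0 i<n)

      u₄ : UnitsBelow n (λ i → L.1# L.- b′ L.* qL LP.^ i)
      u₄ i i≢0 i<n = inverse-unit b-regular i (b-qⁱ i i≢0 i<n)

    numerator-vanishes : q ^ n ≈ 1# ⊎ (a ≈ q ^ n ⊎ a * q ^ n ≈ 1#) → φ (num (LHS m -f RHS m)) ≈ 0#
    numerator-vanishes cases = difference-vanishes (LHS⊢ m u₁ u₂ u₃ u₄) (RHS⊢ m u₁ u₂ u₃ u₄) (LHSR≈RHSR m u₁ u₂ u₃ u₄ (lift cases))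
      where
      lift : q ^ n ≈ 1# ⊎ (a ≈ q ^ n ⊎ a * q ^ n ≈ 1#) → qL LP.^ n L.≈ L.1# ⊎ (aL L.≈ qL LP.^ n ⊎ a′ L.≈ qL LP.^ n)
      lift (inj₁ e) = inj₁ (L.trans (L.sym (ι-^ q n)) (L.trans (ι-cong e) ι-1))
      lift (inj₂ (inj₁ e)) = inj₂ (inj₁ (L.trans (ι-cong e) (ι-^ q n)))
      lift (inj₂ (inj₂ e)) = inj₂ (inj₂ (inverse-of aL a′ (qL LP.^ n) (ι-reciprocal a-regular)
        (L.trans (L.sym (ι-aqⁱ n)) (L.trans (ι-cong e) ι-1))))

    denominator-regular : Regular (φ (den (LHS m -f RHS m)))
    denominator-regular = den-regular (⊢-minus (LHS⊢ m u₁ u₂ u₃ u₄) (RHS⊢ m u₁ u₂ u₃ u₄))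

  localModel : LocalModel
  localModel = record
    { model = record
      { L = localRing ; _⊢_ = _⊢_
      ; ⊢-* = λ {x} {y} {ℓ} {k} → ⊢-* {x} {y} {ℓ} {k} ; ⊢-+ = λ {x} {y} {ℓ} {k} → ⊢-+ {x} {y} {ℓ} {k}
      ; ⊢-÷ = λ {x} {y} {ℓ} {k} {k′} → ⊢-÷ {x} {y} {ℓ} {k} {k′} ; ⊢-1 = ⊢-1 ; ⊢-0 = ⊢-0
      ; ⊢-^ = λ {x} {ℓ} → ⊢-^ {x} {ℓ} ; ⊢-poch = λ {x} {p} {ℓ} {k} → ⊢-poch {x} {p} {ℓ} {k} ; ⊢-sumTo = λ m {f} {g} → ⊢-sumTo m {f} {g} }
    ; ι = ι ; ι-cong = ι-cong ; ι-1 = L.refl {L.1#} ; ι-* = ι-* ; ι-minus = ι-minus ; reciprocal = reciprocal ; ι-reciprocal = ι-reciprocal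
    ; ⊢-poly = ⊢-poly ; ⊢-minus = λ {x} {y} {ℓ} {k} → ⊢-minus {x} {y} {ℓ} {k} ; den-regular = λ {x} {ℓ} → den-regular {x} {ℓ}
    ; difference-vanishes = λ {x} {y} {ℓ} {k} → difference-vanishes {x} {y} {ℓ} {k} }
    where
    open Localize.Localization K
    open Represent K I

  numerator-vanishes : ∀ m → let n = 2 ℕ.* m ℕ.+ 1 in RegularFactors n →
    q ^ n ≈ 1# ⊎ (a ≈ q ^ n ⊎ a * q ^ n ≈ 1#) → φ (num (LHS m -f RHS m)) ≈ 0#
  numerator-vanishes = WithModel.numerator-vanishes localModel

  denominator-regular : ∀ m → RegularFactors (2 ℕ.* m ℕ.+ 1) → Regular (φ (den (LHS m -f RHS m)))
  denominator-regular = WithModel.denominator-regular localModel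

-- Reduced fractions, and regularity after specialising a.

module ReducedFractions where
  open Eval using (module Power)

  module ReducedForm (T : CommutativeRing 0ℓ 0ℓ) (D : IsGCDDomain T) (P : Presentation T) where
    open CommutativeRing T
    open Divisibility T
    open Presentation P using (φ; φ-*; φ-1; φ-0; φ-cong; φ-injective; encode; φ-encode)
    open IsGCDDomain D
    open GCDProperties T D
    open IntSolver T

    ∣ₚ⇒∣ : ∀ {p r} → p ∣ₚ r → φ p ∣ φ r
    ∣ₚ⇒∣ {p} (c , e) = divides (φ c) (trans (sym (φ-* p c)) (φ-cong e))

    ∣⇒∣ₚ : ∀ {p r} → φ p ∣ φ r → p ∣ₚ r
    ∣⇒∣ₚ {p} (divides c e) = encode c , φ-injective (trans (φ-* p (encode c)) (trans (*-congˡ (φ-encode c)) e))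

    -- Each modulus passes to the cofactor left by the earlier ones, because these are regular
    -- modulo it.
    three-factors : ∀ {g₀ g₁ g₂ x} → RegularMod g₀ g₁ → RegularMod (g₀ * g₁) g₂ → g₀ ∣ x → g₁ ∣ x → g₂ ∣ x → g₀ * g₁ * g₂ ∣ x
    three-factors {g₀} {g₁} {g₂} r₁ r₂ (divides c e) d₁ d₂ with r₁ (∣-resp (sym e) d₁)
    ... | divides c′ e′ with r₂ (∣-resp (sym e″) d₂)
      where e″ = trans (*-assoc g₀ g₁ c′) (trans (*-congˡ e′) e)
    ... | divides c″ f = divides c″ (trans (solve 4 (λ x y z w → x :* y :* z :* w := x :* (y :* (z :* w))) refl g₀ g₁ g₂ c″)
            (trans (*-congˡ (trans (*-congˡ f) e′)) e))

    -- Dividing by the gcd gives N and E with den * N = num * E. A modulus that divides num, and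
    -- modulo which den is regular, therefore divides N.
    reduced : ∀ A B P {g₀ g₁ g₂} (let x = A -f B) → φ P ≈ g₀ * g₁ * g₂ → RegularMod g₀ g₁ → RegularMod (g₀ * g₁) g₂ →
      (∀ g → g ≡ g₀ ⊎ (g ≡ g₁ ⊎ g ≡ g₂) → g ∣ φ (num x) × RegularMod (φ (den x)) g) → ¬ φ (den x) ≈ 0# → A ≡ B mod P
    reduced A B P {g₀} {g₁} {g₂} φP r₁ r₂ factors den≉0 =
      (λ e → den≉0 (trans (φ-cong e) φ-0)) , encode N , encode E ,
      (λ e → E≉0 (trans (sym (φ-encode E)) (trans (φ-cong e) φ-0))) ,
      φ-injective (trans (φ-* (encode N) (den x)) (trans (*-congʳ (φ-encode N)) (trans N*den≈num*E (sym (trans (φ-* (num x) (encode E)) (*-congˡ (φ-encode E))))))) ,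
      coprime ,
      ∣⇒∣ₚ (∣-trans (∣-reflexive φP) (∣-resp (sym (φ-encode N)) (three-factors r₁ r₂ (g∣N g₀ (inj₁ ≡.refl)) (g∣N g₁ (inj₂ (inj₁ ≡.refl))) (g∣N g₂ (inj₂ (inj₂ ≡.refl))))))
      where
      x = A -f B
      d = gcd (φ (num x)) (φ (den x))
      N = quotient (gcd∣ˡ (φ (num x)) (φ (den x)))
      E = quotient (gcd∣ʳ (φ (num x)) (φ (den x)))
      dN≈num : d * N ≈ φ (num x)
      dN≈num = equality (gcd∣ˡ (φ (num x)) (φ (den x)))
      dE≈den : d * E ≈ φ (den x)
      dE≈den = equality (gcd∣ʳ (φ (num x)) (φ (den x)))
      d≉0 : ¬ d ≈ 0#
      d≉0 e = den≉0 (trans (sym dE≈den) (trans (*-congʳ e) (zeroˡ E)))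
      E≉0 : ¬ E ≈ 0#
      E≉0 e = den≉0 (trans (sym dE≈den) (trans (*-congˡ e) (zeroʳ d)))
      N*den≈num*E : N * φ (den x) ≈ φ (num x) * E
      N*den≈num*E = trans (*-congˡ (sym dE≈den)) (trans (solve 3 (λ N d E → N :* (d :* E) := (d :* N) :* E) refl N d E) (*-congʳ dN≈num))
      -- If `g` divides both quotients, then `d` times `g` divides numerator and denominator, hence
      -- divides their gcd `d`; cancelling `d` leaves a unit.
      coprime : Coprimeₚ (encode N) (encode E)
      coprime g g∣N g∣E = ∣⇒∣ₚ (∣-resp (sym φ-1) (*-cancel-∣ d≉0 (∣-resp (sym (*-identityʳ d))
        (gcd-greatest (lift dN≈num (∣-resp (φ-encode N) (∣ₚ⇒∣ g∣N))) (lift dE≈den (∣-resp (φ-encode E) (∣ₚ⇒∣ g∣E)))))))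
        where
        lift : ∀ {y z} → d * y ≈ z → φ g ∣ y → d * φ g ∣ z
        lift e g∣y = ∣-resp e (*-mono-∣ (∣-refl {d}) g∣y)
      g∣N : ∀ g → g ≡ g₀ ⊎ (g ≡ g₁ ⊎ g ≡ g₂) → g ∣ N
      g∣N g c with factors g c
      ... | g∣num , regular = regular (∣-resp (trans (sym N*den≈num*E) (*-comm N _)) (∣-*ʳ E g∣num))

  record GenericBase (K : CommutativeRing 0ℓ 0ℓ) (q : CommutativeRing.Carrier K) : Set where
    open CommutativeRing K
    open Localize.Localization K using (Regular)
    open Power K
    field
      q-regular : Regular q
      1-qⁱ : ∀ i → ℕ.NonZero i → Regular (1# - q ^ i)

  module Specialised (K : CommutativeRing 0ℓ 0ℓ) (q a : CommutativeRing.Carrier K) (base : GenericBase K q) (n : ℕ) (n≢0 : ℕ.NonZero n) where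
    open CommutativeRing K
    open Localize.Localization K
    open Power K
    open GenericBase base
    open IntSolver K

    q^-regular : ∀ k → Regular (q ^ k)
    q^-regular ℕ.zero = regular-1
    q^-regular (suc k) = regular-* q-regular (q^-regular k)

    -- Up to sign this is q^i (1 - q^(n-i)).
    qⁿ-qⁱ : ∀ i → i < n → Regular (q ^ n - q ^ i)
    qⁿ-qⁱ i i<n = regular-factor (- 1#) (regular-resp
      (trans (solve 2 (λ x y → x :* (:1 :- y) := (x :* y :- x) :* (:- :1)) refl (q ^ i) (q ^ (n ℕ.∸ i)))
        (*-congʳ (+-congʳ (trans (sym (^-+ q i (n ℕ.∸ i))) (reflexive (≡.cong (q ^_) (ℕ.m+[n∸m]≡n (ℕ.<⇒≤ i<n))))))))
      (regular-* (q^-regular i) (1-qⁱ (n ℕ.∸ i) (ℕ.>-nonZero (ℕ.m<n⇒0<n∸m i<n)))))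

    1-qⁿ⁺ⁱ : ∀ i → Regular (1# - q ^ n * q ^ i)
    1-qⁿ⁺ⁱ i = regular-resp (+-congˡ (-‿cong (^-+ q n i))) (1-qⁱ (n ℕ.+ i) (nonZero+ n n≢0))
      where
      nonZero+ : ∀ n → ℕ.NonZero n → ℕ.NonZero (n ℕ.+ i)
      nonZero+ (suc n) _ = _

    module AtPower (a≈qⁿ : a ≈ q ^ n) where
      a-regular : Regular a
      a-regular = regular-resp (sym a≈qⁿ) (q^-regular n)

      1-aqⁱ : ∀ i → Regular (1# - a * q ^ i)
      1-aqⁱ i = regular-resp (+-congˡ (-‿cong (*-congʳ (sym a≈qⁿ)))) (1-qⁿ⁺ⁱ i)

      a-qⁱ : ∀ i → i < n → Regular (a - q ^ i)
      a-qⁱ i i<n = regular-resp (+-congʳ (sym a≈qⁿ)) (qⁿ-qⁱ i i<n)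

    module AtInversePower (aqⁿ≈1 : a * q ^ n ≈ 1#) where
      a-regular : Regular a
      a-regular = regular-factor (q ^ n) (regular-resp (sym aqⁿ≈1) regular-1)

      -- At a = q^(-n) the two families exchange roles: multiplication by q^n turns 1 - aq^i into
      -- q^n - q^i, and a - q^i into 1 - q^(n+i).
      1-aqⁱ : ∀ i → i < n → Regular (1# - a * q ^ i)
      1-aqⁱ i i<n = regular-factor (q ^ n) (regular-resp
        (trans (+-congˡ (-‿cong (trans (sym (*-identityˡ _)) (*-congʳ (sym aqⁿ≈1)))))
          (solve 3 (λ a x y → x :- (a :* x) :* y := (:1 :- a :* y) :* x) refl a (q ^ n) (q ^ i))) (qⁿ-qⁱ i i<n))

      a-qⁱ : ∀ i → Regular (a - q ^ i)
      a-qⁱ i = regular-factor (q ^ n) (regular-resp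
        (trans (+-congʳ (sym aqⁿ≈1)) (solve 3 (λ a x y → a :* x :- x :* y := (a :- y) :* x) refl a (q ^ n) (q ^ i))) (1-qⁿ⁺ⁱ i))

  module RegularModulo (R : CommutativeRing 0ℓ 0ℓ) (g : CommutativeRing.Carrier R) where
    open CommutativeRing R
    open Divisibility R
    open Localize.Quotient R g
    open Localize.Localization quotientRing using (Regular; mkRegular; cancel₀)

    toRegular : ∀ {h} → RegularMod h g → Regular h
    toRegular r = mkRegular λ e → ∣⇒≈ₘ0 (r (≈ₘ0⇒∣ e))

    fromRegular : ∀ {h} → Regular h → RegularMod h g
    fromRegular r d = ≈ₘ0⇒∣ (cancel₀ r (∣⇒≈ₘ0 d))

    -- The powers are separate recursions over two ring structures with the same multiplication, so
    -- at a variable exponent they agree by induction only.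
    quotient-^ : ∀ x i → Power._^_ R x i ≡ Power._^_ quotientRing x i
    quotient-^ x ℕ.zero = ≡.refl
    quotient-^ x (suc i) = ≡.cong (x *_) (quotient-^ x i)

  module PowerCongruence (R : CommutativeRing 0ℓ 0ℓ) where
    open CommutativeRing R
    open Power R
    difference-cong : ∀ {x x₀ q q₀} i → x ≈ x₀ → q ≈ q₀ → x - q ^ i ≈ x₀ - q₀ ^ i
    difference-cong i e f = +-cong e (-‿cong (^-cong i f))

    1-product-cong : ∀ {a a₀ q q₀} i → a ≈ a₀ → q ≈ q₀ → 1# - a * q ^ i ≈ 1# - a₀ * q₀ ^ i
    1-product-cong i e f = +-congˡ (-‿cong (*-cong e (^-cong i f)))

-- The congruence modulo each factor, and their combination.

module ModuloFactor where
  open Eval using (module Power)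
  open ReducedFractions

  module Step (T : CommutativeRing 0ℓ 0ℓ) (P : Presentation T) where
    open CommutativeRing T
    open Divisibility T
    open Power T
    open Presentation P
    open IntSolver T

    record RegularFactorsMod (g : Carrier) (n : ℕ) : Set where
      field
        q-regular : RegularMod q g
        a-regular : RegularMod a g
        b-regular : RegularMod b g
        1-qⁱ : ∀ i → ℕ.NonZero i → i < n → RegularMod (1# - q ^ i) g
        1-aqⁱ : ∀ i → ℕ.NonZero i → i < n → RegularMod (1# - a * q ^ i) g
        a-qⁱ : ∀ i → ℕ.NonZero i → i < n → RegularMod (a - q ^ i) g
        b-qⁱ : ∀ i → ℕ.NonZero i → i < n → RegularMod (b - q ^ i) g

    -- Regularity that holds modulo any polynomial primitive in a.
    record SpecialisedData (g : Carrier) : Set where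
      field
        q-regular : RegularMod q g
        1-qⁱ : ∀ i → ℕ.NonZero i → RegularMod (1# - q ^ i) g
        b-regular : RegularMod b g
        b-qⁱ : ∀ i → RegularMod (b - q ^ i) g

    module Modulo (g : Carrier) where
      data Specialisation (n : ℕ) : Set where
        root-of-unity : g ∣ q ^ n - 1# → Specialisation n
        power : g ∣ a - q ^ n → Specialisation n
        inverse-power : g ∣ a * q ^ n - 1# → Specialisation n

      private
        open Localize.Quotient T g
        open Localize.Localization quotientRing using (Regular)
        open RegularModulo T g
        open PowerCongruence T
        module K = CommutativeRing quotientRing
        module KP = Power quotientRing

        toRegular′ : ∀ {x y} → x ≈ y → RegularMod y g → Regular x
        toRegular′ e r = toRegular λ d → r (∣-resp (*-congʳ e) d)

      quotientInterpretation : Interpretation quotientRing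
      quotientInterpretation = record
        { φ = φ ; φ-+ = λ p s → ≈⇒≈ₘ (φ-+ p s) ; φ-* = λ p s → ≈⇒≈ₘ (φ-* p s) ; φ-minus = λ p s → ≈⇒≈ₘ (φ-minus p s)
        ; φ-1 = ≈⇒≈ₘ φ-1 ; φ-0 = ≈⇒≈ₘ φ-0 }

      module _ (m : ℕ) (r : RegularFactorsMod g (2 ℕ.* m ℕ.+ 1)) where
        private
          n = 2 ℕ.* m ℕ.+ 1
          module B = Bridge quotientRing quotientInterpretation

          factors : B.RegularFactors n
          factors = record
            { q-regular = toRegular′ φ-q q-regular ; a-regular = toRegular′ φ-a a-regular ; b-regular = toRegular′ φ-b b-regular
            ; 1-qⁱ = λ i i≢0 i<n → ≡.subst (λ y → Regular (1# - y)) (quotient-^ (φ qₚ) i) (toRegular′ (difference-cong i refl φ-q) (1-qⁱ i i≢0 i<n))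
            ; 1-aqⁱ = λ i i≢0 i<n → ≡.subst (λ y → Regular (1# - φ aₚ * y)) (quotient-^ (φ qₚ) i) (toRegular′ (1-product-cong i φ-a φ-q) (1-aqⁱ i i≢0 i<n))
            ; a-qⁱ = λ i i≢0 i<n → ≡.subst (λ y → Regular (φ aₚ - y)) (quotient-^ (φ qₚ) i) (toRegular′ (difference-cong i φ-a φ-q) (a-qⁱ i i≢0 i<n))
            ; b-qⁱ = λ i i≢0 i<n → ≡.subst (λ y → Regular (φ bₚ - y)) (quotient-^ (φ qₚ) i) (toRegular′ (difference-cong i φ-b φ-q) (b-qⁱ i i≢0 i<n)) }
            where open RegularFactorsMod r

        denominator-regular : RegularMod (φ (den (LHS m -f RHS m))) g
        denominator-regular = fromRegular (B.denominator-regular m factors)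

        ∣-numerator : Specialisation n → g ∣ φ (num (LHS m -f RHS m))
        ∣-numerator s = ≈ₘ0⇒∣ (B.numerator-vanishes m factors (lift s))
          where
          qⁿ : q ^ n ≈ Power._^_ T (φ qₚ) n
          qⁿ = ^-cong n (sym φ-q)
          lift : Specialisation n → (φ qₚ KP.^ n) ≈ₘ 1# ⊎ (φ aₚ ≈ₘ (φ qₚ KP.^ n) ⊎ (φ aₚ * (φ qₚ KP.^ n)) ≈ₘ 1#)
          lift rewrite ≡.sym (quotient-^ (φ qₚ) n) = λ
            { (root-of-unity d) → inj₁ (mk≈ₘ (∣-resp (+-congʳ qⁿ) d))
            ; (power d) → inj₂ (inj₁ (mk≈ₘ (∣-resp (+-cong (sym φ-a) (-‿cong qⁿ)) d)))
            ; (inverse-power d) → inj₂ (inj₂ (mk≈ₘ (∣-resp (+-congʳ (*-cong (sym φ-a) qⁿ)) d))) }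

      module SpecialisedModulo (n : ℕ) (n≢0 : ℕ.NonZero n) (data′ : SpecialisedData g) where
        open SpecialisedData data′
        private
          base : GenericBase quotientRing q
          base = record
            { q-regular = toRegular q-regular
            ; 1-qⁱ = λ i i≢0 → ≡.subst (λ y → Regular (1# - y)) (quotient-^ q i) (toRegular (1-qⁱ i i≢0)) }

          module S = Specialised quotientRing q a base n n≢0

          back : ∀ (f : Carrier → Carrier) i → Regular (f (q KP.^ i)) → RegularMod (f (q ^ i)) g
          back f i r = fromRegular (≡.subst (λ y → Regular (f y)) (≡.sym (quotient-^ q i)) r)

        module AtPower (d : g ∣ a - q ^ n) where
          private module P = S.AtPower (≡.subst (a ≈ₘ_) (quotient-^ q n) (mk≈ₘ d))

          1-aqⁱ : ∀ i → RegularMod (1# - a * q ^ i) g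
          1-aqⁱ i = back (λ y → 1# - a * y) i (P.1-aqⁱ i)

          factors : RegularFactorsMod g n
          factors = record
            { q-regular = q-regular ; a-regular = fromRegular P.a-regular ; b-regular = b-regular
            ; 1-qⁱ = λ i i≢0 _ → 1-qⁱ i i≢0 ; 1-aqⁱ = λ i _ _ → 1-aqⁱ i
            ; a-qⁱ = λ i _ i<n → back (λ y → a - y) i (P.a-qⁱ i i<n) ; b-qⁱ = λ i _ _ → b-qⁱ i }

        module AtInversePower (d : g ∣ a * q ^ n - 1#) where
          private module P = S.AtInversePower (≡.subst (λ y → (a * y) ≈ₘ 1#) (quotient-^ q n) (mk≈ₘ d))

          factors : RegularFactorsMod g n
          factors = record
            { q-regular = q-regular ; a-regular = fromRegular P.a-regular ; b-regular = b-regular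
            ; 1-qⁱ = λ i i≢0 _ → 1-qⁱ i i≢0 ; 1-aqⁱ = λ i _ i<n → back (λ y → 1# - a * y) i (P.1-aqⁱ i i<n)
            ; a-qⁱ = λ i _ i<n → back (λ y → a - y) i (P.a-qⁱ i) ; b-qⁱ = λ i _ _ → b-qⁱ i }

    private
      negated-difference : ∀ {g} x → g ≈ 1# - x → g ∣ x - 1#
      negated-difference x e = ∣-resp (trans (-‿cong e) (solve 1 (λ x → :- (:1 :- x) := x :- :1) refl x)) (∣-neg ∣-refl)

    conclusion : (D : IsGCDDomain T)
      (m : ℕ) (let n = 2 ℕ.* m ℕ.+ 1) → ℕ.NonZero n → (g₀ g₁ g₂ z : Carrier) →
      φ (Φ n) ≈ g₀ → g₁ ≈ 1# - a * q ^ n → g₂ ≈ a - q ^ n → z ≈ 0# →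
      RegularFactorsMod g₀ n → g₀ ∣ q ^ n - 1# → SpecialisedData g₁ → SpecialisedData g₂ → RegularFactorsMod z n →
      RegularMod g₀ g₁ → RegularMod g₀ g₂ → LHS m ≡ RHS m mod modulus n
    conclusion D m n≢0 g₀ g₁ g₂ z φ-Φ g₁≈ g₂≈ z≈0 factors₀ g₀∣ data₁ data₂ factors-z g₀g₁ g₀g₂ =
      R.reduced (LHS m) (RHS m) (modulus n) φ-modulus g₀g₁
        -- Modulo `a - q ^ n` the factor `1# - a * q ^ n` becomes 1 - q^(2n), which is regular
        -- there.
        (λ d → regularMod-resp g₁≈ (A₂.1-aqⁱ n) (g₀g₂ (∣-resp (*-assoc _ _ _) d)))
        (λ { _ (inj₁ ≡.refl) → Modulo.∣-numerator g₀ m factors₀ (Modulo.root-of-unity g₀∣) , Modulo.denominator-regular g₀ m factors₀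
           ; _ (inj₂ (inj₁ ≡.refl)) → Modulo.∣-numerator g₁ m A₁.factors (Modulo.inverse-power g₁∣) , Modulo.denominator-regular g₁ m A₁.factors
           ; _ (inj₂ (inj₂ ≡.refl)) → Modulo.∣-numerator g₂ m A₂.factors (Modulo.power g₂∣) , Modulo.denominator-regular g₂ m A₂.factors })
        denominator≉0
      where
      n = 2 ℕ.* m ℕ.+ 1
      module R = ReducedForm T D P
      g₁∣ : g₁ ∣ a * q ^ n - 1#
      g₁∣ = negated-difference (a * q ^ n) g₁≈
      g₂∣ : g₂ ∣ a - q ^ n
      g₂∣ = ∣-reflexive g₂≈
      module S₁ = Modulo.SpecialisedModulo g₁ n n≢0 data₁
      module S₂ = Modulo.SpecialisedModulo g₂ n n≢0 data₂
      module A₁ = S₁.AtInversePower g₁∣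
      module A₂ = S₂.AtPower g₂∣
      -- A zero denominator would be regular modulo `z ≈ 0#`, and regularity applied to 1 would make
      -- `z` divide 1.
      denominator≉0 : ¬ φ (den (LHS m -f RHS m)) ≈ 0#
      denominator≉0 e = ¬z∣1 (Modulo.denominator-regular z m factors-z {1#} (∣-resp (sym (trans (*-identityʳ _) e)) ∣0))
        where
        ¬z∣1 : ¬ z ∣ 1#
        ¬z∣1 (divides c f) = IsGCDDomain.1≉0 D (trans (sym f) (trans (*-congʳ z≈0) (zeroˡ c)))
      φ-qⁿ : φ (qₚ ^ₚ n) ≈ q ^ n
      φ-qⁿ = φ-^ n
        where
        φ-^ : ∀ i → φ (qₚ ^ₚ i) ≈ q ^ i
        φ-^ ℕ.zero = φ-1
        φ-^ (suc i) = trans (φ-* qₚ (qₚ ^ₚ i)) (*-cong φ-q (φ-^ i))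
      φ-modulus : φ (modulus n) ≈ g₀ * g₁ * g₂
      φ-modulus = trans (φ-* _ _) (*-cong (trans (φ-* _ _) (*-cong φ-Φ
        (trans (φ-minus _ _) (trans (+-cong φ-1 (-‿cong (trans (φ-* _ _) (*-cong φ-a φ-qⁿ)))) (sym g₁≈)))))
        (trans (φ-minus _ _) (trans (+-cong φ-a (-‿cong φ-qⁿ)) (sym g₂≈))))

-- Instantiation in ℤ[q][a][b].

module Conclusion where
  open Tower
  open Eval using (module Power)
  open Cyclotomic
  open ModuloFactor

  open U₁ using (_≋_; at≈; neg; ≋-refl; ≋-sym; ≋-trans)
  open V₁ using (X)
  open Power ℤ[q] using () renaming (_^_ to _^Z_)
  module TD = Divisibility ℤ[q,a,b]
  module AD = Divisibility ℤ[q,a]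
  module GA = GCDProperties ℤ[q,a] G₂.polyIsGCDDomain
  module GT = GCDProperties ℤ[q,a,b] G₃.polyIsGCDDomain
  open Power ℤ[q,a,b] using () renaming (_^_ to _^T_)
  open E using (eval)

  presentation : Presentation ℤ[q,a,b]
  presentation = record
    { interpretation = record { φ = eval ; φ-+ = E.eval-+ ; φ-* = E.eval-* ; φ-minus = E.eval-minus ; φ-1 = E.eval-1 ; φ-0 = U₃.≋-refl }
    ; q = qT ; a = aT ; b = bT ; φ-q = E.eval-q ; φ-a = E.eval-a ; φ-b = E.eval-b
    ; φ-cong = λ {p} {r} → eval-cong {p} {r} ; φ-injective = λ {p} {r} → eval-injective {p} {r} ; encode = encode ; φ-encode = eval-encode }

  module StepT = Step ℤ[q,a,b] presentation

  1-aX^ a-X^ : ℕ → List (List ℤ)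
  1-aX^ i = [ 1ℤ ] ∷ neg (X ^Z i) ∷ []
  a-X^ i = neg (X ^Z i) ∷ [ 1ℤ ] ∷ []

  1-aX^-primitive : ∀ i → G₂.Primitive (1-aX^ i)
  1-aX^-primitive i = G₂.unit-coefficient⇒primitive (1-aX^ i) 0 ≋-refl

  a-X^-primitive : ∀ i → G₂.Primitive (a-X^ i)
  a-X^-primitive i = G₂.unit-coefficient⇒primitive (a-X^ i) 1 ≋-refl

  q^≈ : ∀ i → qT ^T i T.≈ cc (X ^Z i)
  q^≈ = cc-^ X

  1-q^≈ : ∀ i → T.1# T.- qT ^T i T.≈ cc (Z.1# Z.- X ^Z i)
  1-q^≈ i = T.+-congˡ {T.1#} {T.- qT ^T i} {T.- cc (X ^Z i)} (T.-‿cong {qT ^T i} {cc (X ^Z i)} (q^≈ i))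

  1-aq^≈ : ∀ i → T.1# T.- aT T.* qT ^T i T.≈ U₃.const (1-aX^ i)
  1-aq^≈ i = T.trans {T.1# T.- aT T.* qT ^T i} {T.1# T.- U₃.const (U₂.mul V₂.X (U₂.const (X ^Z i)))}
    (T.+-congˡ {T.1#} {T.- (aT T.* qT ^T i)} (T.-‿cong {aT T.* qT ^T i} (T.trans {aT T.* qT ^T i} (U₃.mul-congˡ aT (q^≈ i))
      (T.sym {U₃.const (U₂.mul V₂.X (U₂.const (X ^Z i)))} (V₃.const-* V₂.X (U₂.const (X ^Z i)))))))
    (V₃.const-cong (V₂.1-X-const (X ^Z i)))

  a-q^≈ : ∀ i → aT T.- qT ^T i T.≈ U₃.const (a-X^ i)
  a-q^≈ i = T.trans {aT T.- qT ^T i} {aT T.- cc (X ^Z i)} (T.+-congˡ {aT} {T.- qT ^T i} (T.-‿cong {qT ^T i} (q^≈ i)))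
    (V₃.const-cong (V₂.X-minus-const (X ^Z i)))

  b-q^≈ : ∀ i → bT T.- qT ^T i T.≈ U₂.neg (U₂.const (X ^Z i)) ∷ U₂.const [ 1ℤ ] ∷ []
  b-q^≈ i = T.trans {bT T.- qT ^T i} {bT T.- cc (X ^Z i)} (T.+-congˡ {bT} {T.- qT ^T i} (T.-‿cong {qT ^T i} (q^≈ i)))
    (V₃.X-minus-const (U₂.const (X ^Z i)))

  b-regular : ∀ g → TD.RegularMod bT (U₃.const g)
  b-regular g {y} = G₃.primitive⇒regular {bT} g (G₃.unit-coefficient⇒primitive bT 1 U₂.≋-refl) {y}

  b-qⁱ-regular : ∀ g i → TD.RegularMod (bT T.- qT ^T i) (U₃.const g)
  b-qⁱ-regular g i {y} = TD.regularMod-resp {bT T.- qT ^T i} (b-q^≈ i)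
    (λ {y} → G₃.primitive⇒regular {h} g (G₃.unit-coefficient⇒primitive h 1 U₂.≋-refl) {y}) {y}
    where h = U₂.neg (U₂.const (X ^Z i)) ∷ U₂.const [ 1ℤ ] ∷ []

  X≉0 : ¬ X ≋ []
  X≉0 e with at≈ e 1
  ... | ()

  1-X^-regular : ∀ {g i} → ZD.RegularMod (C.E i) g → ZD.RegularMod (Z.1# Z.- X ^Z i) g
  1-X^-regular {g} {i} r {y} = ZD.regularMod-neg {C.E i} (ZS.solve 1 (λ x → ZS.:1 ZS.:- x ZS.:= ZS.:- (x ZS.:- ZS.:1)) ≋-refl (X ^Z i)) (λ {y} → r {y}) {y}

  -- Covers the moduli Φ_n and 0. Factors in `q` alone are handled coefficientwise; those containing
  -- `a` or `b` have a coefficient 1 in that variable, hence are primitive and regular modulo any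
  -- constant.
  module ModuloConstant (g : List ℤ) (n : ℕ) (X-regular : ZD.RegularMod X g) (E-regular : ∀ i → ℕ.NonZero i → i < n → ZD.RegularMod (C.E i) g) where
    lift : ∀ {h} → ZD.RegularMod h g → TD.RegularMod (cc h) (cc g)
    lift {h} r {y} = G₃.const-regular {U₂.const h} {U₂.const g} (λ {y} → G₂.const-regular {h} {g} (λ {y} → r {y}) {y}) {y}

    primitive-regular : ∀ {h} → G₂.Primitive h → TD.RegularMod (U₃.const h) (cc g)
    primitive-regular {h} p {y} = G₃.const-regular {h} {U₂.const g} (λ {y} → G₂.primitive⇒regular {h} g p {y}) {y}

    factors : StepT.RegularFactorsMod (cc g) n
    factors = record
      { q-regular = λ {y} → lift {X} (λ {y} → X-regular {y}) {y}
      ; a-regular = λ {y} → primitive-regular {V₂.X} (G₂.unit-coefficient⇒primitive V₂.X 1 ≋-refl) {y}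
      ; b-regular = λ {y} → b-regular (U₂.const g) {y}
      ; 1-qⁱ = λ i i≢0 i<n {y} → TD.regularMod-resp {T.1# T.- qT ^T i} (1-q^≈ i) (λ {y} → lift {Z.1# Z.- X ^Z i} (λ {y} → 1-X^-regular {g} {i} (λ {y} → E-regular i i≢0 i<n {y}) {y}) {y}) {y}
      ; 1-aqⁱ = λ i _ _ {y} → TD.regularMod-resp {T.1# T.- aT T.* qT ^T i} (1-aq^≈ i) (λ {y} → primitive-regular {1-aX^ i} (1-aX^-primitive i) {y}) {y}
      ; a-qⁱ = λ i _ _ {y} → TD.regularMod-resp {aT T.- qT ^T i} (a-q^≈ i) (λ {y} → primitive-regular {a-X^ i} (a-X^-primitive i) {y}) {y}
      ; b-qⁱ = λ i _ _ {y} → b-qⁱ-regular (U₂.const g) i {y} }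

  module ModuloPrimitive (h : List (List ℤ)) (prim : G₂.Primitive h) where
    g = U₃.const h

    -- A primitive `h` is regular modulo the constant `c`, and the symmetry of regularity turns this
    -- round.
    const-regular : ∀ {c} → ¬ c ≋ [] → TD.RegularMod (cc c) g
    const-regular {c} c≉0 {y} = G₃.const-regular {U₂.const c} {h} (λ {y} → GA.regularMod-sym {U₂.const c} {h} (λ e → c≉0 (U₂.head≈0 e))
      (λ {y} → G₂.primitive⇒regular {h} c prim {y}) {y}) {y}

    q-regular : TD.RegularMod qT g
    q-regular {y} = const-regular {X} X≉0 {y}

    1-qⁱ : ∀ i → ℕ.NonZero i → TD.RegularMod (T.1# T.- qT ^T i) g
    1-qⁱ i@(suc i′) _ {y} = TD.regularMod-resp {T.1# T.- qT ^T i} (1-q^≈ i) (λ {y} → const-regular {Z.1# Z.- X ^Z i} 1-X^≉0 {y}) {y}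
      where
      1-X^≉0 : ¬ (Z.1# Z.- X ^Z i) ≋ []
      1-X^≉0 e = E≉0 i′ (≋-trans (ZS.solve 1 (λ x → x ZS.:- ZS.:1 ZS.:= ZS.:- (ZS.:1 ZS.:- x)) ≋-refl (X ^Z i)) (U₁.neg-cong e))

  horner≈ : ∀ f → E.horner f T.≈ cc f
  horner≈ [] = T.sym {cc []} (U₃.∷-zero (U₂.∷-zero U₁.≋-refl U₂.≋-refl) U₃.≋-refl)
  horner≈ (c ∷ f) = T.trans {E.horner (c ∷ f)} (U₃.addʳ (ιT c) (U₃.mul-congˡ qT (horner≈ f)))
    (T.sym {cc (c ∷ f)} (T.trans {cc (c ∷ f)} (cc-cong (V₁.∷-split c f)) (U₃.addʳ (ιT c) (cc-* X f))))

  module Main (m : ℕ) where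
    n : ℕ
    n = 2 ℕ.* m ℕ.+ 1

    n≢0 : ℕ.NonZero n
    n≢0 = ≡.subst ℕ.NonZero (ℕ.+-comm 1 (2 ℕ.* m)) _

    open CyclotomicProperties (cyclotomic-properties n n≢0)

    Φn : List ℤ
    Φn = cyclotomic n

    -- Since X^n is 1 modulo Φ_n and n = 2m+1, the power X^(2m) is an inverse of `X`.
    X-regular : ZD.RegularMod X Φn
    X-regular {y} d = ZD.∣-resp (ZS.solve 3 (λ x p y → (x ZS.:* y) ZS.:* p ZS.:- y ZS.:* (x ZS.:* p ZS.:- ZS.:1) ZS.:= y) ≋-refl X (X ^Z (2 ℕ.* m)) y)
      (ZD.∣-+ (ZD.∣-*ʳ (X ^Z (2 ℕ.* m)) d) (ZD.∣-neg (ZD.∣-*ˡ y Φ∣)))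
      where
      Φ∣ : Φn ZD.∣ (X Z.* X ^Z (2 ℕ.* m) Z.- Z.1#)
      Φ∣ = ≡.subst (λ k → Φn ZD.∣ C.E k) (ℕ.+-comm (2 ℕ.* m) 1) divides-E

    -- Regularity modulo 0 is what shows that the denominator does not vanish.
    zero-regular : ∀ {h} → ¬ h ≋ [] → ZD.RegularMod h []
    zero-regular {h} h≉0 {y} (ZD.divides c e) with G₁.poly-integral h y (≋-sym e)
    ... | inj₁ h≋0 = contradiction h≋0 h≉0
    ... | inj₂ y≋0 = ZD.divides [] (≋-sym y≋0)

    E-zero-regular : ∀ i → ℕ.NonZero i → i < n → ZD.RegularMod (C.E i) []
    E-zero-regular (suc i) _ _ {y} = zero-regular (E≉0 i) {y}

    module M₀ = ModuloConstant Φn n (λ {y} → X-regular {y}) (λ i i≢0 i<n {y} → E-regular i i≢0 i<n {y})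
    module M₋ = ModuloConstant [] n (λ {y} → zero-regular X≉0 {y}) (λ i i≢0 i<n {y} → E-zero-regular i i≢0 i<n {y})

    Φ∣q^-1 : cc Φn TD.∣ qT ^T n T.- T.1#
    Φ∣q^-1 = TD.divides (cc c) (T.trans {cc Φn T.* cc c} (T.sym {cc (U₁.mul Φn c)} (cc-* Φn c))
          (T.trans {cc (U₁.mul Φn c)} (cc-cong (ZD.equality divides-E)) (T.+-congʳ {T.- T.1#} {cc (X ^Z n)} (T.sym {qT ^T n} (q^≈ n)))))
      where c = ZD.quotient divides-E

    specialised : ∀ h → G₂.Primitive h → StepT.SpecialisedData (U₃.const h)
    specialised h p = record
      { q-regular = λ {y} → ModuloPrimitive.q-regular h p {y} ; 1-qⁱ = λ i i≢0 {y} → ModuloPrimitive.1-qⁱ h p i i≢0 {y}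
      ; b-regular = λ {y} → b-regular h {y} ; b-qⁱ = λ i {y} → b-qⁱ-regular h i {y} }

    Φ-regular : ∀ h → G₂.Primitive h → TD.RegularMod (cc Φn) (U₃.const h)
    Φ-regular h p {y} = ModuloPrimitive.const-regular h p {Φn} (G₁.primitive⇒≉[] {Φn} isPrimitive) {y}

    theorem : LHS m ≡ RHS m mod modulus n
    theorem = StepT.conclusion G₃.polyIsGCDDomain m n≢0 (cc Φn) (U₃.const (1-aX^ n)) (U₃.const (a-X^ n)) (cc [])
      (T.trans {eval (Φ n)} (E.eval-fromU Φn) (horner≈ Φn)) (T.sym {T.1# T.- aT T.* qT ^T n} (1-aq^≈ n)) (T.sym {aT T.- qT ^T n} (a-q^≈ n))
      (U₃.∷-zero (U₂.∷-zero U₁.≋-refl U₂.≋-refl) U₃.≋-refl)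
      M₀.factors Φ∣q^-1 (specialised (1-aX^ n) (1-aX^-primitive n)) (specialised (a-X^ n) (a-X^-primitive n)) M₋.factors
      (λ {y} → Φ-regular (1-aX^ n) (1-aX^-primitive n) {y}) (λ {y} → Φ-regular (a-X^ n) (a-X^-primitive n) {y})

open import Data.Nat using (_+_; _*_)

theorem3p3 : (m : ℕ) → LHS m ≡ RHS m mod modulus (2 * m + 1)
theorem3p3 m = Conclusion.Main.theorem m
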